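{- Let $R_2=\mathbb{F}_2[u,v]/\langle u^2,v^2,uv-vu\rangle$, let $\phi:R_2^{16}\to\mathbb{F}_2^{64}$ be the Gray map, and let $\mathcal{D}$ be the binary self-dual $[16,8,4]$ code generated by $[I_8\,|\,A_2]$, where $$A_2=\begin{bmatrix} 1&0&0&1&1&1&1&0\\ 0&1&0&1&1&1&1&0\\ 0&0&1&1&1&1&1&0\\ 0&0&0&1&0&0&1&1\\ 0&0&0&0&1&0&1&1\\ 0&0&0&0&0&1&1&1\\ 1&1&1&1&1&1&0&1\\ 1&1&1&0&0&0&1&1 \end{bmatrix}.$$ Then: (1) for each $\beta\in\{16,20,24,26,28,30,34,38\}$ there exists a linear code $\mathcal{L}$ of length $16$ over $R_2$, generated by a matrix of the form $[I_8\,|\,L]$ with $L$ an $8\times 8$ matrix over $R_2$, such that $\mathcal{L}$ is a lift of $\mathcal{D}$ and $\phi(\mathcal{L})$ is an extremal binary self-dual Type I $[64,32,12]$ code with weight enumerator $W_{64,1}$ with parameter $\beta$; (2) for each $\beta\in\{3,7,11,15,26,27,35\}$ there exists a linear code $\mathcal{L}$ of length $16$ over $R_2$, generated by a matrix of the form $[I_8\,|\,L]$ with $L$ an $8\times 8$ matrix over $R_2$, such that $\mathcal{L}$ is a lift of $\mathcal{D}$ and $\phi(\mathcal{L})$ is an extremal binary self-dual Type I $[64,32,12]$ code with weight enumerator $W_{64,2}$ with parameter $\beta$.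
   Context: A linear code of length $n$ over a commutative ring $R$ is an $R$-submodule of $R^n$; it is self-dual if it equals its dual with respect to the standard inner product $\sum_i a_ib_i$. A binary $[n,k,d]$ code is a $k$-dimensional subspace of $\mathbb{F}_2^n$ with minimum Hamming distance $d$. A binary self-dual code is Type II if all its codeword weights are divisible by $4$ and Type I (singly-even) otherwise. A binary self-dual code of length $n$ has minimum distance $d\le 4\lfloor n/24\rfloor+6$ if $n\equiv 22\pmod{24}$ and $d\le 4\lfloor n/24\rfloor+4$ otherwise, and it is called extremal if it meets this bound; for $n=64$ this means $d=12$. Every element of $R_2^n$ is uniquely $\bar a+u\bar b+v\bar c+uv\bar d$ with $\bar a,\bar b,\bar c,\bar d\in\mathbb{F}_2^n$. The Gray map $\phi:R_2^n\to\mathbb{F}_2^{4n}$ is $\phi(\bar a+u\bar b+v\bar c+uv\bar d)=(\bar d,\ \bar c+\bar d,\ \bar b+\bar d,\ \bar a+\bar b+\bar c+\bar d)$. The projection $\pi:R_2^n\to\mathbb{F}_2^n$ is $\pi(\bar a+u\bar b+v\bar c+uv\bar d)=\bar a$. A code $\mathcal{L}$ over $R_2$ is a lift of a binary self-dual code $\mathcal{D}$ if $\pi(\mathcal{L})=\mathcal{D}$. The weight enumerator of a binary code is $\sum_i A_iy^i$, where $A_i$ is the number of codewords of Hamming weight $i$. An extremal singly-even self-dual $[64,32,12]$ code has a weight enumerator of one of the two forms $W_{64,1}=1+(1312+16\beta)y^{12}+(22016-64\beta)y^{14}+\cdots$ with $14\le\beta\le 284$, or $W_{64,2}=1+(1312+16\beta)y^{12}+(23040-64\beta)y^{14}+\cdots$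 with $0\le\beta\le 277$. Having weight enumerator $W_{64,1}$ (resp. $W_{64,2}$) with parameter $\beta$ means that the numbers of codewords of weights $12$ and $14$ are the displayed coefficients for that $\beta$. -}

module Defs where

open import Level using (0ℓ)
open import Algebra.Bundles using (CommutativeRing)
open import Algebra.Structures using (IsCommutativeRing)
open import Data.Bool.Base using (Bool; true; false; _xor_; _∧_; if_then_else_)
open import Data.Bool.Properties using (xor-∧-commutativeRing)
open import Data.Bool.Solver using (module xor-∧-Solver)
import Data.Bool.Properties as Bool
open import Data.Fin.Base using (Fin)
import Data.Fin.Properties as Fin
open import Data.List.Base as List using (List)
import Data.List.Membership.Propositional as List
open import Data.List.Relation.Unary.Unique.Propositional using (Unique)
open import Data.Nat.Base using (ℕ; _+_; _*_; _∸_; _≤_; _/_; _%_)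
open import Data.Nat.Divisibility using (_∣_)
import Data.Nat.Properties as ℕ
open import Data.Product.Base using (Σ-syntax; ∃-syntax; _×_; _,_)
open import Data.Vec.Base as Vec
  using (Vec; []; _∷_; _++_; map; zip; zipWith; foldr′; replicate; tabulate; concat; count)
open import Function.Bundles using (_⇔_)
open import Relation.Binary.PropositionalEquality
  using (_≡_; _≢_; refl; cong₂; isEquivalence)
open import Relation.Nullary.Decidable using (does; ¬?)
open import Relation.Nullary.Negation using (¬_)
open import Relation.Unary using (Pred; _∈_; _≐_)

-- A code is an arbitrary set of words; linearity is the separate predicate
-- IsLinear.  The ring is taken with propositional equality, so that words can
-- be compared with _≡_.

Code : Set → ℕ → Set₁
Code A n = Pred (Vec A n) 0ℓ

image : ∀ {A B : Set} {m n} → (Vec A m → Vec B n) → Code A m → Code B n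
image f C y = ∃[ x ] x ∈ C × f x ≡ y

Matrix : Set → ℕ → ℕ → Set
Matrix A k n = Vec (Vec A n) k

module LinearCodes
  {A : Set} {_⊕_ _⊗_ : A → A → A} { ⊖_ : A → A} {0# 1# : A}
  (isCommutativeRing : IsCommutativeRing _≡_ _⊕_ _⊗_ ⊖_ 0# 1#)
  where

  infixl 6 _+ⱽ_
  infixr 7 _•_ _∙ᴹ_

  0ⱽ : ∀ {n} → Vec A n
  0ⱽ = replicate _ 0#

  _+ⱽ_ : ∀ {n} → Vec A n → Vec A n → Vec A n
  _+ⱽ_ = zipWith _⊕_

  _•_ : ∀ {n} → A → Vec A n → Vec A n
  r • x = map (r ⊗_) x

  ⟨_,_⟩ : ∀ {n} → Vec A n → Vec A n → A
  ⟨ x , y ⟩ = foldr′ _⊕_ 0# (zipWith _⊗_ x y)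

  -- The linear combination of the rows of G with coefficients c.
  _∙ᴹ_ : ∀ {k n} → Vec A k → Matrix A k n → Vec A n
  c ∙ᴹ G = foldr′ _+ⱽ_ 0ⱽ (zipWith _•_ c G)

  record IsLinear {n} (C : Code A n) : Set where
    field
      0-closed : 0ⱽ ∈ C
      +-closed : ∀ {x y} → x ∈ C → y ∈ C → x +ⱽ y ∈ C
      •-closed : ∀ r {x} → x ∈ C → r • x ∈ C

  dual : ∀ {n} → Code A n → Code A n
  dual C x = ∀ y → y ∈ C → ⟨ x , y ⟩ ≡ 0#

  record IsSelfDual {n} (C : Code A n) : Set where
    field
      linear : IsLinear C
      C≐dual : C ≐ dual C

  rowSpan : ∀ {k n} → Matrix A k n → Code A n
  rowSpan G x = ∃[ c ] x ≡ c ∙ᴹ G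

  _IsGeneratedBy_ : ∀ {k n} → Code A n → Matrix A k n → Set
  C IsGeneratedBy G = C ≐ rowSpan G

  LinearlyIndependentRows : ∀ {k n} → Matrix A k n → Set
  LinearlyIndependentRows G = ∀ c → c ∙ᴹ G ≡ 0ⱽ → c ≡ 0ⱽ

  -- C has a basis of k words.
  HasDimension : ∀ {n} → Code A n → ℕ → Set
  HasDimension {n} C k =
    Σ[ G ∈ Matrix A k n ] C IsGeneratedBy G × LinearlyIndependentRows G

  I : ∀ k → Matrix A k k
  I k = tabulate λ i → tabulate λ j → if does (i Fin.≟ j) then 1# else 0#

  [I∣_] : ∀ {k m} → Matrix A k m → Matrix A k (k + m)
  [I∣_] {k} M = zipWith _++_ (I k) M

𝔽₂ : Set
𝔽₂ = Bool

module Binary = LinearCodes (CommutativeRing.isCommutativeRing xor-∧-commutativeRing)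

weight : ∀ {n} → Vec 𝔽₂ n → ℕ
weight = count (Bool._≟ true)

distance : ∀ {n} → Vec 𝔽₂ n → Vec 𝔽₂ n → ℕ
distance x y = count (λ (a , b) → ¬? (a Bool.≟ b)) (zip x y)

record HasMinimumDistance {n} (C : Code 𝔽₂ n) (d : ℕ) : Set where
  field
    attained   : ∃[ x ] ∃[ y ] x ∈ C × y ∈ C × x ≢ y × distance x y ≡ d
    lowerBound : ∀ x y → x ∈ C → y ∈ C → x ≢ y → d ≤ distance x y

record Is[_,_,_]Code (n k d : ℕ) (C : Code 𝔽₂ n) : Set where
  field
    linear          : Binary.IsLinear C
    dimension       : Binary.HasDimension C k
    minimumDistance : HasMinimumDistance C d

DoublyEven : ∀ {n} → Code 𝔽₂ n → Set
DoublyEven C = ∀ x → x ∈ C → 4 ∣ weight x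

record IsTypeI {n} (C : Code 𝔽₂ n) : Set where
  field
    selfDual      : Binary.IsSelfDual C
    notDoublyEven : ¬ DoublyEven C

extremalDistance : ℕ → ℕ
extremalDistance n =
  if does (n % 24 ℕ.≟ 22) then 4 * (n / 24) + 6 else 4 * (n / 24) + 4

record IsExtremal {n} (C : Code 𝔽₂ n) : Set where
  field
    selfDual        : Binary.IsSelfDual C
    minimumDistance : HasMinimumDistance C (extremalDistance n)

-- C has exactly N words of weight w: they can be listed without repetition in
-- a list of length N.
NumberOfWordsOfWeight : ∀ {n} → Code 𝔽₂ n → ℕ → ℕ → Set
NumberOfWordsOfWeight {n} C w N =
  Σ[ xs ∈ List (Vec 𝔽₂ n) ]
    Unique xs
    × List.length xs ≡ N
    × (∀ x → (x List.∈ xs) ⇔ (x ∈ C × weight x ≡ w))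

-- The bounds on β keep both truncated subtractions below exact.

record HasWeightEnumeratorW₆₄,₁ (C : Code 𝔽₂ 64) (β : ℕ) : Set where
  field
    14≤β  : 14 ≤ β
    β≤284 : β ≤ 284
    A₁₂   : NumberOfWordsOfWeight C 12 (1312 + 16 * β)
    A₁₄   : NumberOfWordsOfWeight C 14 (22016 ∸ 64 * β)

record HasWeightEnumeratorW₆₄,₂ (C : Code 𝔽₂ 64) (β : ℕ) : Set where
  field
    β≤277 : β ≤ 277
    A₁₂   : NumberOfWordsOfWeight C 12 (1312 + 16 * β)
    A₁₄   : NumberOfWordsOfWeight C 14 (23040 ∸ 64 * β)

-- R₂ = 𝔽₂[u,v]/⟨u²,v²,uv-vu⟩, on the 𝔽₂-basis 1, u, v, uv of the quotient:
-- the record with components a b c d is a + ub + vc + uvd.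
record R₂ : Set where
  constructor ⟪_,_,_,_⟫
  field
    a b c d : 𝔽₂

open R₂

module R₂-ring where

  infixl 6 _⊕_
  infixl 7 _⊗_

  _⊕_ : R₂ → R₂ → R₂
  ⟪ a , b , c , d ⟫ ⊕ ⟪ a′ , b′ , c′ , d′ ⟫ =
    ⟪ a xor a′ , b xor b′ , c xor c′ , d xor d′ ⟫

  _⊗_ : R₂ → R₂ → R₂
  ⟪ a , b , c , d ⟫ ⊗ ⟪ a′ , b′ , c′ , d′ ⟫ =
    ⟪ a ∧ a′
    , (a ∧ b′) xor (b ∧ a′)
    , (a ∧ c′) xor (c ∧ a′)
    , ((a ∧ d′) xor (b ∧ c′)) xor ((c ∧ b′) xor (d ∧ a′))
    ⟫

  -- Characteristic 2.
  ⊖_ : R₂ → R₂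
  ⊖ x = x

  0# 1# u v : R₂
  0# = ⟪ false , false , false , false ⟫
  1# = ⟪ true  , false , false , false ⟫
  u  = ⟪ false , true  , false , false ⟫
  v  = ⟪ false , false , true  , false ⟫

  ι : 𝔽₂ → R₂
  ι a = ⟪ a , false , false , false ⟫

  u²≡0 : u ⊗ u ≡ 0#
  u²≡0 = refl

  v²≡0 : v ⊗ v ≡ 0#
  v²≡0 = refl

  uv≡vu : u ⊗ v ≡ v ⊗ u
  uv≡vu = refl

  open xor-∧-Solver

  private
    ⟪⟫-cong : ∀ {a a′ b b′ c c′ d d′} → a ≡ a′ → b ≡ b′ → c ≡ c′ → d ≡ d′ →
              ⟪ a , b , c , d ⟫ ≡ ⟪ a′ , b′ , c′ , d′ ⟫
    ⟪⟫-cong refl refl refl refl = refl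

  normalForm : ∀ a b c d →
    ⟪ a , b , c , d ⟫ ≡ ι a ⊕ u ⊗ ι b ⊕ v ⊗ ι c ⊕ (u ⊗ v) ⊗ ι d
  normalForm false false false false = refl
  normalForm false false false true  = refl
  normalForm false false true  false = refl
  normalForm false false true  true  = refl
  normalForm false true  false false = refl
  normalForm false true  false true  = refl
  normalForm false true  true  false = refl
  normalForm false true  true  true  = refl
  normalForm true  false false false = refl
  normalForm true  false false true  = refl
  normalForm true  false true  false = refl
  normalForm true  false true  true  = refl
  normalForm true  true  false false = refl
  normalForm true  true  false true  = refl
  normalForm true  true  true  false = refl
  normalForm true  true  true  true  = refl

  private
    ⊕-assoc : ∀ x y z → (x ⊕ y) ⊕ z ≡ x ⊕ (y ⊕ z)
    ⊕-assoc x y z =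
      ⟪⟫-cong (assoc (a x) (a y) (a z)) (assoc (b x) (b y) (b z))
              (assoc (c x) (c y) (c z)) (assoc (d x) (d y) (d z))
      where assoc = Bool.xor-assoc

    ⊕-comm : ∀ x y → x ⊕ y ≡ y ⊕ x
    ⊕-comm x y =
      ⟪⟫-cong (comm (a x) (a y)) (comm (b x) (b y)) (comm (c x) (c y)) (comm (d x) (d y))
      where comm = Bool.xor-comm

    ⊕-identityʳ : ∀ x → x ⊕ 0# ≡ x
    ⊕-identityʳ x = ⟪⟫-cong (idʳ (a x)) (idʳ (b x)) (idʳ (c x)) (idʳ (d x))
      where idʳ = Bool.xor-identityʳ

    ⊖-inverse : ∀ x → x ⊕ x ≡ 0#
    ⊖-inverse x = ⟪⟫-cong (inv (a x)) (inv (b x)) (inv (c x)) (inv (d x))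
      where inv = Bool.xor-same

    ⊗-assoc : ∀ x y z → (x ⊗ y) ⊗ z ≡ x ⊗ (y ⊗ z)
    ⊗-assoc ⟪ a , b , c , d ⟫ ⟪ a′ , b′ , c′ , d′ ⟫ ⟪ a″ , b″ , c″ , d″ ⟫ =
      ⟪⟫-cong
        (Bool.∧-assoc a a′ a″)
        (linear a b a′ b′ a″ b″)
        (linear a c a′ c′ a″ c″)
        (solve 12 (λ a b c d a′ b′ c′ d′ a″ b″ c″ d″ →
          ((a :* a′) :* d″ :+ (a :* b′ :+ b :* a′) :* c″)
            :+ ((a :* c′ :+ c :* a′) :* b″
            :+ ((a :* d′ :+ b :* c′) :+ (c :* b′ :+ d :* a′)) :* a″)
          := (a :* ((a′ :* d″ :+ b′ :* c″) :+ (c′ :* b″ :+ d′ :* a″))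
            :+ b :* (a′ :* c″ :+ c′ :* a″))
            :+ (c :* (a′ :* b″ :+ b′ :* a″) :+ d :* (a′ :* a″)))
          refl a b c d a′ b′ c′ d′ a″ b″ c″ d″)
      where
      linear : ∀ a b a′ b′ a″ b″ →
        ((a ∧ a′) ∧ b″) xor (((a ∧ b′) xor (b ∧ a′)) ∧ a″)
        ≡ (a ∧ ((a′ ∧ b″) xor (b′ ∧ a″))) xor (b ∧ (a′ ∧ a″))
      linear = solve 6 (λ a b a′ b′ a″ b″ →
        (a :* a′) :* b″ :+ (a :* b′ :+ b :* a′) :* a″
        := a :* (a′ :* b″ :+ b′ :* a″) :+ b :* (a′ :* a″)) refl

    ⊗-comm : ∀ x y → x ⊗ y ≡ y ⊗ x
    ⊗-comm ⟪ a , b , c , d ⟫ ⟪ a′ , b′ , c′ , d′ ⟫ =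
      ⟪⟫-cong
        (Bool.∧-comm a a′)
        (linear a b a′ b′)
        (linear a c a′ c′)
        (solve 8 (λ a b c d a′ b′ c′ d′ →
          (a :* d′ :+ b :* c′) :+ (c :* b′ :+ d :* a′)
          := (a′ :* d :+ b′ :* c) :+ (c′ :* b :+ d′ :* a))
          refl a b c d a′ b′ c′ d′)
      where
      linear : ∀ a b a′ b′ →
        (a ∧ b′) xor (b ∧ a′) ≡ (a′ ∧ b) xor (b′ ∧ a)
      linear = solve 4 (λ a b a′ b′ →
        a :* b′ :+ b :* a′ := a′ :* b :+ b′ :* a) refl

    ⊗-identityˡ : ∀ x → 1# ⊗ x ≡ x
    ⊗-identityˡ ⟪ a , b , c , d ⟫ =
      ⟪⟫-cong refl (idʳ b) (idʳ c) (drop d)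
      where
      idʳ = Bool.xor-identityʳ
      drop : ∀ d → (d xor false) xor false ≡ d
      drop false = refl
      drop true  = refl

    ⊗-distribˡ : ∀ x y z → x ⊗ (y ⊕ z) ≡ (x ⊗ y) ⊕ (x ⊗ z)
    ⊗-distribˡ ⟪ a , b , c , d ⟫ ⟪ a′ , b′ , c′ , d′ ⟫ ⟪ a″ , b″ , c″ , d″ ⟫ =
      ⟪⟫-cong
        (solve 3 (λ a a′ a″ → a :* (a′ :+ a″) := a :* a′ :+ a :* a″) refl a a′ a″)
        (linear a b a′ b′ a″ b″)
        (linear a c a′ c′ a″ c″)
        (solve 12 (λ a b c d a′ b′ c′ d′ a″ b″ c″ d″ →
          (a :* (d′ :+ d″) :+ b :* (c′ :+ c″)) :+ (c :* (b′ :+ b″) :+ d :* (a′ :+ a″))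
          := ((a :* d′ :+ b :* c′) :+ (c :* b′ :+ d :* a′))
            :+ ((a :* d″ :+ b :* c″) :+ (c :* b″ :+ d :* a″)))
          refl a b c d a′ b′ c′ d′ a″ b″ c″ d″)
      where
      linear : ∀ a b a′ b′ a″ b″ →
        (a ∧ (b′ xor b″)) xor (b ∧ (a′ xor a″))
        ≡ ((a ∧ b′) xor (b ∧ a′)) xor ((a ∧ b″) xor (b ∧ a″))
      linear = solve 6 (λ a b a′ b′ a″ b″ →
        a :* (b′ :+ b″) :+ b :* (a′ :+ a″)
        := (a :* b′ :+ b :* a′) :+ (a :* b″ :+ b :* a″)) refl

    open import Algebra.Consequences.Propositional
      using (comm∧idˡ⇒id; comm∧idʳ⇒id; comm∧distrˡ⇒distr)

  isCommutativeRing : IsCommutativeRing _≡_ _⊕_ _⊗_ ⊖_ 0# 1#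
  isCommutativeRing = record
    { isRing = record
      { +-isAbelianGroup = record
        { isGroup = record
          { isMonoid = record
            { isSemigroup = record
              { isMagma = record { isEquivalence = isEquivalence ; ∙-cong = cong₂ _⊕_ }
              ; assoc = ⊕-assoc
              }
            ; identity = comm∧idʳ⇒id ⊕-comm ⊕-identityʳ
            }
          ; inverse = ⊖-inverse , ⊖-inverse
          ; ⁻¹-cong = λ { refl → refl }
          }
        ; comm = ⊕-comm
        }
      ; *-cong = cong₂ _⊗_
      ; *-assoc = ⊗-assoc
      ; *-identity = comm∧idˡ⇒id ⊗-comm ⊗-identityˡ
      ; distrib = comm∧distrˡ⇒distr (cong₂ _⊕_) ⊗-comm ⊗-distribˡ
      }
    ; *-comm = ⊗-comm
    }

module OverR₂ = LinearCodes R₂-ring.isCommutativeRing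

φ : ∀ {n} → Vec R₂ n → Vec 𝔽₂ (4 * n)
φ x = concat (d̄ ∷ (c̄ +ⱽ d̄) ∷ (b̄ +ⱽ d̄) ∷ (ā +ⱽ b̄ +ⱽ c̄ +ⱽ d̄) ∷ [])
  where
  open Binary using (_+ⱽ_)
  ā = map a x
  b̄ = map b x
  c̄ = map c x
  d̄ = map d x

π : ∀ {n} → Vec R₂ n → Vec 𝔽₂ n
π = map a

_IsLiftOf_ : ∀ {n} → Code R₂ n → Code 𝔽₂ n → Set
𝓛 IsLiftOf 𝓒 = image π 𝓛 ≐ 𝓒

A₂ : Matrix 𝔽₂ 8 8
A₂ =
  (l ∷ o ∷ o ∷ l ∷ l ∷ l ∷ l ∷ o ∷ []) ∷
  (o ∷ l ∷ o ∷ l ∷ l ∷ l ∷ l ∷ o ∷ []) ∷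
  (o ∷ o ∷ l ∷ l ∷ l ∷ l ∷ l ∷ o ∷ []) ∷
  (o ∷ o ∷ o ∷ l ∷ o ∷ o ∷ l ∷ l ∷ []) ∷
  (o ∷ o ∷ o ∷ o ∷ l ∷ o ∷ l ∷ l ∷ []) ∷
  (o ∷ o ∷ o ∷ o ∷ o ∷ l ∷ l ∷ l ∷ []) ∷
  (l ∷ l ∷ l ∷ l ∷ l ∷ l ∷ o ∷ l ∷ []) ∷
  (l ∷ l ∷ l ∷ o ∷ o ∷ o ∷ l ∷ l ∷ []) ∷ []
  where
  o l : 𝔽₂
  o = false
  l = true

𝓓 : Code 𝔽₂ 16
𝓓 = Binary.rowSpan Binary.[I∣ A₂ ]

LiftExists : (Code 𝔽₂ 64 → Set) → Set₁
LiftExists W =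
  Σ[ 𝓛 ∈ Code R₂ 16 ]
    OverR₂.IsLinear 𝓛
    × (Σ[ L ∈ Matrix R₂ 8 8 ] 𝓛 OverR₂.IsGeneratedBy OverR₂.[I∣ L ])
    × 𝓛 IsLiftOf 𝓓
    × Is[ 64 , 32 , 12 ]Code (image φ 𝓛)
    × IsExtremal (image φ 𝓛)
    × IsTypeI (image φ 𝓛)
    × W (image φ 𝓛)

{-# OPTIONS --safe #-}
-- If S, T, W are symmetric, then L = (I + uS + vT + uv(ST + W)) A₂ satisfies
-- L Lᵀ = I, so that [I | L] generates a self-dual lift of 𝓓; the fifteen matrices
-- L are of this form.  The Gray image C of the lift is self-dual with generator
-- matrices [I | L] and [Lᵀ | I], and a word of weight at most 10 has left weight
-- at most 5 or right weight at most 4, so the minimum distance follows by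
-- enumerating the combinations of few rows of these two matrices.
--
-- The words of weights 12 and 14 are counted without enumerating them.  As the
-- weights 2, 4, …, 10 do not occur, the MacWilliams identities for C and for its
-- shadow, the coset t + C with ⟨ t , c ⟩ = weight c / 2 mod 2 on C, determine
--   A₁₂ = 1312 + 16 (14 B₄ + B₈),   A₁₄ = 23040 − 1920 B₄ − 64 B₈
-- from the numbers B₄, B₈ of words of weights 4 and 8 in the shadow (B₀ = 0).
-- These few words are again found by enumeration: B₄ = 1 leads to W₆₄,₁ with
-- β = 14 + B₈, and B₄ = 0 to W₆₄,₂ with β = B₈.
module Submission where

open import Defs
open import Algebra.Bundles using (AbelianGroup; CommutativeRing; CommutativeSemigroup)
open import Algebra.Structures using (IsCommutativeRing)
import Algebra.Properties.CommutativeSemigroup as CommutativeSemigroupProperties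
import Algebra.Properties.Group as GroupProperties
open import Data.Bool.Base using (true; false; not; _xor_; _∧_; if_then_else_; T)
open import Data.Bool.Properties using (xor-∧-commutativeRing)
import Data.Bool.Properties as Bool
open import Data.Bool.Solver using (module xor-∧-Solver)
open import Data.Empty using (⊥-elim)
import Data.Fin.Properties as Fin
open import Data.Integer.Base as ℤ using (ℤ; +_; -_; 0ℤ; 1ℤ; -1ℤ)
import Data.Integer.Properties as ℤ
open import Data.Integer.Tactic.RingSolver using (solve-∀)
open import Data.List.Base as List using (List; []; _∷_)
import Data.List.Properties as List
open import Data.List.Membership.Propositional as List using (_∈_)
import Data.List.Membership.Propositional.Properties as List
open import Data.List.Relation.Unary.All as ListAll using ([]; _∷_)
open import Data.List.Relation.Unary.Any using (here; there)
open import Data.List.Relation.Unary.AllPairs using ([]; _∷_)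
open import Data.List.Relation.Unary.Unique.Propositional using (Unique)
import Data.List.Relation.Unary.Unique.Propositional.Properties as Unique
open import Data.Maybe.Base using (Maybe; just; nothing)
open import Data.Nat.Base as ℕ using (ℕ; zero; suc; _+_; _*_; _∸_; _^_; _/_; _%_; _≤_; _<_; _≤ᵇ_; _≡ᵇ_; z≤n; s≤s)
open import Data.Nat.Divisibility using (_∣_; _∣?_)
import Data.Nat.Properties as ℕ
import Data.Nat.Tactic.RingSolver as ℕ
open import Data.Product.Base using (_×_; _,_; proj₁; proj₂; ∃-syntax; uncurry; swap)
open import Data.Sum.Base using (_⊎_; inj₁; inj₂)
open import Data.Vec.Base as Vec using (Vec; []; _∷_; _++_; map; zipWith; replicate; tabulate; splitAt)
import Data.Vec.Properties as Vec
open import Data.Vec.Relation.Unary.All as All using (All; []; _∷_)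
open import Function.Base using (_∘_)
open import Function.Bundles using (mk⇔; Equivalence)
open import Relation.Binary.PropositionalEquality hiding ([_])
open import Relation.Nullary.Decidable
  using (Dec; yes; no; does; dec-true; dec-false; True; toWitness; from-yes; from-no; _×-dec_; _⊎-dec_; _→-dec_)
open import Relation.Nullary.Negation using (¬_)
open import Relation.Unary using (_≐_) renaming (_∈_ to _∈ᶜ_)

-- Facts about the concrete codes are settled by evaluation, and 2^32 words are out of reach. So
-- only combinations of at most five of 32 rows are searched, with pruning by weight. Why B₀, B₄, B₈
-- suffice: by Gleason's theorem the weight enumerator of a self-dual code of length 64 has nine
-- coefficients in the Gleason basis. Six are fixed by A₀ = 1 and A₂ = ... = A₁₀ = 0. The weights in
-- the shadow are congruent to 32 modulo 4, and its three lowest coefficients fix the remaining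
-- three. The certificates express the resulting formulas for A₁₂ and A₁₄ as explicit combinations
-- of MacWilliams identities. The form of L: A₂ A₂ᵀ = I, so for L = (I + uS + vT + uvX) A₂ the
-- product L Lᵀ has u-coefficient S + Sᵀ, v-coefficient T + Tᵀ and uv-coefficient X + Xᵀ + ST + TS.
-- All three vanish in characteristic 2 when X = ST + W with S, T, W symmetric.

-- Linear algebra over a commutative ring

module LinearAlgebra
  {A : Set} {_⊕_ _⊗_ : A → A → A} { ⊖_ : A → A} {0# 1# : A}
  (isCommutativeRing : IsCommutativeRing _≡_ _⊕_ _⊗_ ⊖_ 0# 1#)
  where

  open LinearCodes isCommutativeRing public
  open IsCommutativeRing isCommutativeRing
    using ( +-assoc; +-comm; +-identityˡ; +-identityʳ; *-assoc; *-comm; *-identityˡ; *-identityʳ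
          ; zeroˡ; zeroʳ; distribˡ; distribʳ)
  open ≡-Reasoning


  +ⱽ-assoc : ∀ {n} (x y z : Vec A n) → (x +ⱽ y) +ⱽ z ≡ x +ⱽ (y +ⱽ z)
  +ⱽ-assoc = Vec.zipWith-assoc +-assoc

  +ⱽ-comm : ∀ {n} (x y : Vec A n) → x +ⱽ y ≡ y +ⱽ x
  +ⱽ-comm = Vec.zipWith-comm +-comm

  +ⱽ-identityˡ : ∀ {n} (x : Vec A n) → 0ⱽ +ⱽ x ≡ x
  +ⱽ-identityˡ = Vec.zipWith-identityˡ +-identityˡ

  +ⱽ-identityʳ : ∀ {n} (x : Vec A n) → x +ⱽ 0ⱽ ≡ x
  +ⱽ-identityʳ = Vec.zipWith-identityʳ +-identityʳ

  +-commutativeSemigroup : CommutativeSemigroup _ _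
  +-commutativeSemigroup = record
    { isCommutativeSemigroup = record
      { isSemigroup = record
        { isMagma = record { isEquivalence = isEquivalence ; ∙-cong = cong₂ _⊕_ }
        ; assoc = +-assoc }
      ; comm = +-comm } }

  +ⱽ-commutativeSemigroup : ∀ n → CommutativeSemigroup _ _
  +ⱽ-commutativeSemigroup n = record
    { isCommutativeSemigroup = record
      { isSemigroup = record
        { isMagma = record { isEquivalence = isEquivalence {A = Vec A n} ; ∙-cong = cong₂ _+ⱽ_ }
        ; assoc = +ⱽ-assoc }
      ; comm = +ⱽ-comm } }

  open CommutativeSemigroupProperties +-commutativeSemigroup using (interchange)

  +ⱽ-interchange : ∀ {n} (w x y z : Vec A n) → (w +ⱽ x) +ⱽ (y +ⱽ z) ≡ (w +ⱽ y) +ⱽ (x +ⱽ z)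
  +ⱽ-interchange {n} = CommutativeSemigroupProperties.interchange (+ⱽ-commutativeSemigroup n)

  •-zeroˡ : ∀ {n} (x : Vec A n) → 0# • x ≡ 0ⱽ
  •-zeroˡ []      = refl
  •-zeroˡ (a ∷ x) = cong₂ _∷_ (zeroˡ a) (•-zeroˡ x)

  •-zeroʳ : ∀ {n} r → r • 0ⱽ {n} ≡ 0ⱽ
  •-zeroʳ {n} r = trans (Vec.map-replicate _ 0# n) (cong (replicate n) (zeroʳ r))

  •-identity : ∀ {n} (x : Vec A n) → 1# • x ≡ x
  •-identity []      = refl
  •-identity (a ∷ x) = cong₂ _∷_ (*-identityˡ a) (•-identity x)

  •-assoc : ∀ {n} r s (x : Vec A n) → (r ⊗ s) • x ≡ r • (s • x)
  •-assoc r s []      = refl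
  •-assoc r s (a ∷ x) = cong₂ _∷_ (*-assoc r s a) (•-assoc r s x)

  •-distribˡ : ∀ {n} r (x y : Vec A n) → r • (x +ⱽ y) ≡ r • x +ⱽ r • y
  •-distribˡ r []      []      = refl
  •-distribˡ r (a ∷ x) (b ∷ y) = cong₂ _∷_ (distribˡ r a b) (•-distribˡ r x y)

  •-distribʳ : ∀ {n} r s (x : Vec A n) → (r ⊕ s) • x ≡ r • x +ⱽ s • x
  •-distribʳ r s []      = refl
  •-distribʳ r s (a ∷ x) = cong₂ _∷_ (distribʳ a r s) (•-distribʳ r s x)

  ⟨⟩-zeroˡ : ∀ {n} (x : Vec A n) → ⟨ 0ⱽ , x ⟩ ≡ 0#
  ⟨⟩-zeroˡ []      = refl
  ⟨⟩-zeroˡ (a ∷ x) = trans (cong₂ _⊕_ (zeroˡ a) (⟨⟩-zeroˡ x)) (+-identityˡ 0#)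

  ⟨⟩-comm : ∀ {n} (x y : Vec A n) → ⟨ x , y ⟩ ≡ ⟨ y , x ⟩
  ⟨⟩-comm []      []      = refl
  ⟨⟩-comm (a ∷ x) (b ∷ y) = cong₂ _⊕_ (*-comm a b) (⟨⟩-comm x y)

  ⟨⟩-zeroʳ : ∀ {n} (x : Vec A n) → ⟨ x , 0ⱽ ⟩ ≡ 0#
  ⟨⟩-zeroʳ x = trans (⟨⟩-comm x 0ⱽ) (⟨⟩-zeroˡ x)

  ⟨⟩-+ˡ : ∀ {n} (x y z : Vec A n) → ⟨ x +ⱽ y , z ⟩ ≡ ⟨ x , z ⟩ ⊕ ⟨ y , z ⟩
  ⟨⟩-+ˡ []      []      []      = sym (+-identityˡ 0#)
  ⟨⟩-+ˡ (a ∷ x) (b ∷ y) (c ∷ z) =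
    trans (cong₂ _⊕_ (distribʳ c a b) (⟨⟩-+ˡ x y z)) (interchange _ _ _ _)

  ⟨⟩-+ʳ : ∀ {n} (x y z : Vec A n) → ⟨ x , y +ⱽ z ⟩ ≡ ⟨ x , y ⟩ ⊕ ⟨ x , z ⟩
  ⟨⟩-+ʳ x y z = trans (⟨⟩-comm x (y +ⱽ z)) (trans (⟨⟩-+ˡ y z x) (cong₂ _⊕_ (⟨⟩-comm y x) (⟨⟩-comm z x)))

  ⟨⟩-•ˡ : ∀ {n} r (x y : Vec A n) → ⟨ r • x , y ⟩ ≡ r ⊗ ⟨ x , y ⟩
  ⟨⟩-•ˡ r []      []      = sym (zeroʳ r)
  ⟨⟩-•ˡ r (a ∷ x) (b ∷ y) =
    trans (cong₂ _⊕_ (*-assoc r a b) (⟨⟩-•ˡ r x y)) (sym (distribˡ r _ _))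

  ⟨⟩-•ʳ : ∀ {n} r (x y : Vec A n) → ⟨ x , r • y ⟩ ≡ r ⊗ ⟨ x , y ⟩
  ⟨⟩-•ʳ r x y = trans (⟨⟩-comm x (r • y)) (trans (⟨⟩-•ˡ r y x) (cong (r ⊗_) (⟨⟩-comm y x)))

  ⟨⟩-++ : ∀ {m n} (x x′ : Vec A m) (y y′ : Vec A n) →
          ⟨ x ++ y , x′ ++ y′ ⟩ ≡ ⟨ x , x′ ⟩ ⊕ ⟨ y , y′ ⟩
  ⟨⟩-++ []      []        y y′ = sym (+-identityˡ _)
  ⟨⟩-++ (a ∷ x) (a′ ∷ x′) y y′ =
    trans (cong ((a ⊗ a′) ⊕_) (⟨⟩-++ x x′ y y′)) (sym (+-assoc _ _ _))

  ⟨⟩-nondegenerate : ∀ {n} (x : Vec A n) → (∀ y → ⟨ x , y ⟩ ≡ 0#) → x ≡ 0ⱽ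
  ⟨⟩-nondegenerate []      x⊥ = refl
  ⟨⟩-nondegenerate (a ∷ x) x⊥ = cong₂ _∷_ head≡0 (⟨⟩-nondegenerate x tail⊥)
    where
    head≡0 : a ≡ 0#
    head≡0 = begin
      a                         ≡⟨ +-identityʳ a ⟨
      a ⊕ 0#                    ≡⟨ cong₂ _⊕_ (*-identityʳ a) (⟨⟩-zeroʳ x) ⟨
      (a ⊗ 1#) ⊕ ⟨ x , 0ⱽ ⟩     ≡⟨ x⊥ (1# ∷ 0ⱽ) ⟩
      0#                        ∎
    tail⊥ : ∀ y → ⟨ x , y ⟩ ≡ 0#
    tail⊥ y = begin
      ⟨ x , y ⟩                 ≡⟨ +-identityˡ _ ⟨
      0# ⊕ ⟨ x , y ⟩            ≡⟨ cong (_⊕ ⟨ x , y ⟩) (zeroʳ a) ⟨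
      (a ⊗ 0#) ⊕ ⟨ x , y ⟩      ≡⟨ x⊥ (0# ∷ y) ⟩
      0#                        ∎

  ++-+ⱽ : ∀ {m n} (x x′ : Vec A m) (y y′ : Vec A n) →
          (x ++ y) +ⱽ (x′ ++ y′) ≡ (x +ⱽ x′) ++ (y +ⱽ y′)
  ++-+ⱽ []      []        y y′ = refl
  ++-+ⱽ (a ∷ x) (a′ ∷ x′) y y′ = cong (_ ∷_) (++-+ⱽ x x′ y y′)

  0ⱽ-++ : ∀ m {n} → 0ⱽ {m} ++ 0ⱽ {n} ≡ 0ⱽ
  0ⱽ-++ zero    = refl
  0ⱽ-++ (suc m) = cong (0# ∷_) (0ⱽ-++ m)

  ∙ᴹ-zeroˡ : ∀ {k n} (G : Matrix A k n) → 0ⱽ ∙ᴹ G ≡ 0ⱽ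
  ∙ᴹ-zeroˡ []      = refl
  ∙ᴹ-zeroˡ (g ∷ G) = trans (cong₂ _+ⱽ_ (•-zeroˡ g) (∙ᴹ-zeroˡ G)) (+ⱽ-identityˡ 0ⱽ)

  ∙ᴹ-distribʳ : ∀ {k n} (c d : Vec A k) (G : Matrix A k n) → (c +ⱽ d) ∙ᴹ G ≡ c ∙ᴹ G +ⱽ d ∙ᴹ G
  ∙ᴹ-distribʳ []      []      []      = sym (+ⱽ-identityˡ 0ⱽ)
  ∙ᴹ-distribʳ (a ∷ c) (b ∷ d) (g ∷ G) =
    trans (cong₂ _+ⱽ_ (•-distribʳ a b g) (∙ᴹ-distribʳ c d G)) (+ⱽ-interchange _ _ _ _)

  •-∙ᴹ : ∀ {k n} r (c : Vec A k) (G : Matrix A k n) → (r • c) ∙ᴹ G ≡ r • (c ∙ᴹ G)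
  •-∙ᴹ r []      []      = sym (•-zeroʳ r)
  •-∙ᴹ r (a ∷ c) (g ∷ G) =
    trans (cong₂ _+ⱽ_ (•-assoc r a g) (•-∙ᴹ r c G)) (sym (•-distribˡ r (a • g) (c ∙ᴹ G)))

  ∙ᴹ-assoc : ∀ {k l n} (c : Vec A k) (B : Matrix A k l) (G : Matrix A l n) →
             (c ∙ᴹ B) ∙ᴹ G ≡ c ∙ᴹ map (_∙ᴹ G) B
  ∙ᴹ-assoc []      []      G = ∙ᴹ-zeroˡ G
  ∙ᴹ-assoc (a ∷ c) (b ∷ B) G =
    trans (∙ᴹ-distribʳ (a • b) (c ∙ᴹ B) G) (cong₂ _+ⱽ_ (•-∙ᴹ a b G) (∙ᴹ-assoc c B G))

  ⟨∙ᴹ,⟩ : ∀ {k n} (c : Vec A k) (G : Matrix A k n) (x : Vec A n) →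
          ⟨ c ∙ᴹ G , x ⟩ ≡ ⟨ c , map ⟨_, x ⟩ G ⟩
  ⟨∙ᴹ,⟩ []      []      x = ⟨⟩-zeroˡ x
  ⟨∙ᴹ,⟩ (a ∷ c) (g ∷ G) x =
    trans (⟨⟩-+ˡ (a • g) (c ∙ᴹ G) x) (cong₂ _⊕_ (⟨⟩-•ˡ a g x) (⟨∙ᴹ,⟩ c G x))

  ∙ᴹ-++ : ∀ {k m n} (c : Vec A k) (M : Matrix A k m) (N : Matrix A k n) →
          c ∙ᴹ zipWith _++_ M N ≡ c ∙ᴹ M ++ c ∙ᴹ N
  ∙ᴹ-++ {m = m} [] [] []      = sym (0ⱽ-++ m)
  ∙ᴹ-++ (a ∷ c) (x ∷ M) (y ∷ N) =
    trans (cong₂ _+ⱽ_ (Vec.map-++ (a ⊗_) x y) (∙ᴹ-++ c M N)) (++-+ⱽ (a • x) (c ∙ᴹ M) (a • y) (c ∙ᴹ N))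

  ∙ᴹ-map-0∷ : ∀ {k n} (c : Vec A k) (G : Matrix A k n) → c ∙ᴹ map (0# ∷_) G ≡ 0# ∷ c ∙ᴹ G
  ∙ᴹ-map-0∷ []      []      = refl
  ∙ᴹ-map-0∷ (a ∷ c) (g ∷ G) =
    trans (cong (a • (0# ∷ g) +ⱽ_) (∙ᴹ-map-0∷ c G))
          (cong (_∷ a • g +ⱽ c ∙ᴹ G) (trans (cong (_⊕ 0#) (zeroʳ a)) (+-identityˡ 0#)))

  I-suc : ∀ k → I (suc k) ≡ (1# ∷ 0ⱽ) ∷ map (0# ∷_) (I k)
  I-suc k = cong₂ _∷_
    (cong (1# ∷_) (zeros k))
    (Vec.tabulate-∘ (0# ∷_) (λ i → tabulate (λ j → if does (i Fin.≟ j) then 1# else 0#)))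
    where
    zeros : ∀ n → tabulate {n = n} (λ _ → 0#) ≡ 0ⱽ
    zeros zero    = refl
    zeros (suc n) = cong (0# ∷_) (zeros n)

  ∙ᴹ-I : ∀ {k} (c : Vec A k) → c ∙ᴹ I k ≡ c
  ∙ᴹ-I []      = refl
  ∙ᴹ-I {suc k} (a ∷ c) = begin
    (a ∷ c) ∙ᴹ I (suc k)                      ≡⟨ cong ((a ∷ c) ∙ᴹ_) (I-suc k) ⟩
    a • (1# ∷ 0ⱽ) +ⱽ c ∙ᴹ map (0# ∷_) (I k)  ≡⟨ cong₂ _+ⱽ_ (cong₂ _∷_ (*-identityʳ a) (•-zeroʳ a))
                                                           (trans (∙ᴹ-map-0∷ c (I k)) (cong (0# ∷_) (∙ᴹ-I c))) ⟩
    (a ⊕ 0#) ∷ (0ⱽ +ⱽ c)                      ≡⟨ cong₂ _∷_ (+-identityʳ a) (+ⱽ-identityˡ c) ⟩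
    a ∷ c                                     ∎

  rowSpan-linear : ∀ {k n} (G : Matrix A k n) → IsLinear (rowSpan G)
  rowSpan-linear G = record
    { 0-closed = 0ⱽ , sym (∙ᴹ-zeroˡ G)
    ; +-closed = λ { (c , refl) (d , refl) → c +ⱽ d , sym (∙ᴹ-distribʳ c d G) }
    ; •-closed = λ { r (c , refl) → r • c , sym (•-∙ᴹ r c G) }
    }

  ⟨⟩-rowSpan : ∀ {k n} (x : Vec A n) {G : Matrix A k n} →
               All (λ g → ⟨ x , g ⟩ ≡ 0#) G → ∀ c → ⟨ x , c ∙ᴹ G ⟩ ≡ 0#
  ⟨⟩-rowSpan x []         []      = ⟨⟩-zeroʳ x
  ⟨⟩-rowSpan x (p ∷ ps) (a ∷ c) = begin
    ⟨ x , a • _ +ⱽ c ∙ᴹ _ ⟩            ≡⟨ ⟨⟩-+ʳ x _ _ ⟩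
    ⟨ x , a • _ ⟩ ⊕ ⟨ x , c ∙ᴹ _ ⟩     ≡⟨ cong₂ _⊕_ (trans (⟨⟩-•ʳ a x _) (trans (cong (a ⊗_) p) (zeroʳ a)))
                                                    (⟨⟩-rowSpan x ps c) ⟩
    0# ⊕ 0#                            ≡⟨ +-identityˡ 0# ⟩
    0#                                 ∎

  ∙ᴹ-[I∣] : ∀ {k m} (c : Vec A k) (M : Matrix A k m) → c ∙ᴹ [I∣ M ] ≡ c ++ c ∙ᴹ M
  ∙ᴹ-[I∣] {k} c M = trans (∙ᴹ-++ c (I k) M) (cong (_++ c ∙ᴹ M) (∙ᴹ-I c))

  [I∣]-injective : ∀ {k m} (M : Matrix A k m) c d → c ∙ᴹ [I∣ M ] ≡ d ∙ᴹ [I∣ M ] → c ≡ d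
  [I∣]-injective M c d eq =
    Vec.++-injectiveˡ c d (trans (sym (∙ᴹ-[I∣] c M)) (trans eq (∙ᴹ-[I∣] d M)))

  [I∣]-independent : ∀ {k m} (M : Matrix A k m) → LinearlyIndependentRows [I∣ M ]
  [I∣]-independent M c eq = [I∣]-injective M c 0ⱽ (trans eq (sym (∙ᴹ-zeroˡ [I∣ M ])))

  inverse-∙ᴹ : ∀ {k m} {B : Matrix A m k} {M : Matrix A k m} → map (_∙ᴹ M) B ≡ I m →
               ∀ c → (c ∙ᴹ B) ∙ᴹ M ≡ c
  inverse-∙ᴹ {B = B} {M} BM≡I c = trans (∙ᴹ-assoc c B M) (trans (cong (c ∙ᴹ_) BM≡I) (∙ᴹ-I c))

  module _ (char2 : ∀ x → x ⊕ x ≡ 0#) where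

    +ⱽ-self : ∀ {n} (x : Vec A n) → x +ⱽ x ≡ 0ⱽ
    +ⱽ-self []      = refl
    +ⱽ-self (a ∷ x) = cong₂ _∷_ (char2 a) (+ⱽ-self x)

    +ⱽ-cancel : ∀ {n} (x y : Vec A n) → (x +ⱽ y) +ⱽ y ≡ x
    +ⱽ-cancel x y = trans (+ⱽ-assoc x y y) (trans (cong (x +ⱽ_) (+ⱽ-self y)) (+ⱽ-identityʳ x))

    +ⱽ≡0⇒≡ : ∀ {n} (x y : Vec A n) → x +ⱽ y ≡ 0ⱽ → x ≡ y
    +ⱽ≡0⇒≡ x y eq = trans (sym (+ⱽ-cancel x y)) (trans (cong (_+ⱽ y) eq) (+ⱽ-identityˡ y))

    -- If B M = I, the rows of [B | I] lie in the code, so a word of the dual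
    -- that vanishes on the first k coordinates is zero.
    [I∣]-selfDual : ∀ {k m} (M : Matrix A k m) (B : Matrix A m k) →
                    All (λ g → All (λ h → ⟨ g , h ⟩ ≡ 0#) [I∣ M ]) [I∣ M ] →
                    map (_∙ᴹ M) B ≡ I m → IsSelfDual (rowSpan [I∣ M ])
    [I∣]-selfDual {k} {m} M B orth BM≡I = record
      { linear = rowSpan-linear G
      ; C≐dual = (λ { (c , refl) y (d , refl) → orthogonal c d }) , dual⊆
      }
      where
      G : Matrix A k (k + m)
      G = [I∣ M ]
      orthogonal : ∀ c d → ⟨ c ∙ᴹ G , d ∙ᴹ G ⟩ ≡ 0#
      orthogonal c d =
        trans (⟨⟩-comm (c ∙ᴹ G) (d ∙ᴹ G))
              (⟨⟩-rowSpan (d ∙ᴹ G) (All.map (λ {g} ps → trans (⟨⟩-comm (d ∙ᴹ G) g) (⟨⟩-rowSpan g ps d)) orth) c)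
      dual⊆ : ∀ {v} → v ∈ᶜ dual (rowSpan G) → v ∈ᶜ rowSpan G
      dual⊆ {v} v⊥ with splitAt k v
      ... | x , y , refl = x , +ⱽ≡0⇒≡ (x ++ y) (x ∙ᴹ G) (trans sum≡ (trans (cong (0ⱽ ++_) w≡0) (0ⱽ-++ k)))
        where
        w : Vec A m
        w = y +ⱽ x ∙ᴹ M
        sum≡ : (x ++ y) +ⱽ x ∙ᴹ G ≡ 0ⱽ ++ w
        sum≡ = begin
          (x ++ y) +ⱽ x ∙ᴹ G           ≡⟨ cong ((x ++ y) +ⱽ_) (∙ᴹ-[I∣] x M) ⟩
          (x ++ y) +ⱽ (x ++ x ∙ᴹ M)    ≡⟨ ++-+ⱽ x x y (x ∙ᴹ M) ⟩
          (x +ⱽ x) ++ w                ≡⟨ cong (_++ w) (+ⱽ-self x) ⟩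
          0ⱽ ++ w                      ∎
        w≡0 : w ≡ 0ⱽ
        -- The codeword `z ∙ᴹ B ++ z` isolates ⟨ w , z ⟩, because the left half of v + xG is zero;
        -- both v and xG are orthogonal to that codeword.
        w≡0 = ⟨⟩-nondegenerate w λ z → begin
          ⟨ w , z ⟩                                   ≡⟨ +-identityˡ _ ⟨
          0# ⊕ ⟨ w , z ⟩                              ≡⟨ cong (_⊕ ⟨ w , z ⟩) (⟨⟩-zeroˡ (z ∙ᴹ B)) ⟨
          ⟨ 0ⱽ {k} , z ∙ᴹ B ⟩ ⊕ ⟨ w , z ⟩             ≡⟨ ⟨⟩-++ 0ⱽ (z ∙ᴹ B) w z ⟨
          ⟨ 0ⱽ {k} ++ w , z ∙ᴹ B ++ z ⟩               ≡⟨ cong₂ ⟨_,_⟩ (sym sum≡) (sym (word z)) ⟩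
          ⟨ (x ++ y) +ⱽ x ∙ᴹ G , (z ∙ᴹ B) ∙ᴹ G ⟩       ≡⟨ ⟨⟩-+ˡ (x ++ y) (x ∙ᴹ G) _ ⟩
          ⟨ x ++ y , (z ∙ᴹ B) ∙ᴹ G ⟩ ⊕ ⟨ x ∙ᴹ G , (z ∙ᴹ B) ∙ᴹ G ⟩
                                                      ≡⟨ cong₂ _⊕_ (v⊥ _ (z ∙ᴹ B , refl)) (orthogonal x (z ∙ᴹ B)) ⟩
          0# ⊕ 0#                                     ≡⟨ +-identityˡ 0# ⟩
          0#                                          ∎
          where
          word : ∀ z → (z ∙ᴹ B) ∙ᴹ G ≡ z ∙ᴹ B ++ z
          word z = trans (∙ᴹ-[I∣] (z ∙ᴹ B) M) (cong (z ∙ᴹ B ++_) (inverse-∙ᴹ BM≡I z))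

-- Sums over all binary vectors

module 𝔹 = LinearAlgebra (CommutativeRing.isCommutativeRing xor-∧-commutativeRing)
open 𝔹 using (⟨_,_⟩; _+ⱽ_; 0ⱽ; _∙ᴹ_; rowSpan)

infix 4 _≟ⱽ_

_≟ⱽ_ : ∀ {n} (x y : Vec 𝔽₂ n) → Dec (x ≡ y)
_≟ⱽ_ = Vec.≡-dec Bool._≟_

-- Recursion on the coordinates suits the inductions below. The sums over 2^32 messages and 2^64
-- vectors are only transformed, never evaluated.
∑ : ∀ {n} → (Vec 𝔽₂ n → ℤ) → ℤ
∑ {zero}  f = f []
∑ {suc n} f = ∑ (λ x → f (false ∷ x)) ℤ.+ ∑ (λ x → f (true ∷ x))

∑-cong : ∀ {n} {f g : Vec 𝔽₂ n → ℤ} → (∀ x → f x ≡ g x) → ∑ f ≡ ∑ g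
∑-cong {zero}  f≗g = f≗g []
∑-cong {suc n} f≗g = cong₂ ℤ._+_ (∑-cong (λ x → f≗g (false ∷ x))) (∑-cong (λ x → f≗g (true ∷ x)))

+-interchange : ∀ a b c d → (a ℤ.+ b) ℤ.+ (c ℤ.+ d) ≡ (a ℤ.+ c) ℤ.+ (b ℤ.+ d)
+-interchange = solve-∀

∑-+ : ∀ {n} (f g : Vec 𝔽₂ n → ℤ) → ∑ (λ x → f x ℤ.+ g x) ≡ ∑ f ℤ.+ ∑ g
∑-+ {zero}  f g = refl
∑-+ {suc n} f g =
  trans (cong₂ ℤ._+_ (∑-+ (λ x → f (false ∷ x)) (λ x → g (false ∷ x)))
                     (∑-+ (λ x → f (true ∷ x)) (λ x → g (true ∷ x))))
        (+-interchange (∑ (λ x → f (false ∷ x))) (∑ (λ x → g (false ∷ x)))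
                       (∑ (λ x → f (true ∷ x))) (∑ (λ x → g (true ∷ x))))

∑-*ˡ : ∀ {n} a (f : Vec 𝔽₂ n → ℤ) → ∑ (λ x → a ℤ.* f x) ≡ a ℤ.* ∑ f
∑-*ˡ {zero}  a f = refl
∑-*ˡ {suc n} a f =
  trans (cong₂ ℤ._+_ (∑-*ˡ a (λ x → f (false ∷ x))) (∑-*ˡ a (λ x → f (true ∷ x))))
        (sym (ℤ.*-distribˡ-+ a _ _))

∑-zero : ∀ {n} {f : Vec 𝔽₂ n → ℤ} → (∀ x → f x ≡ 0ℤ) → ∑ f ≡ 0ℤ
∑-zero {zero}  f≡0 = f≡0 []
∑-zero {suc n} f≡0 = cong₂ ℤ._+_ (∑-zero (λ x → f≡0 (false ∷ x))) (∑-zero (λ x → f≡0 (true ∷ x)))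

∑-swap : ∀ {m n} (f : Vec 𝔽₂ m → Vec 𝔽₂ n → ℤ) →
         ∑ (λ x → ∑ (λ y → f x y)) ≡ ∑ (λ y → ∑ (λ x → f x y))
∑-swap {zero}  f = refl
∑-swap {suc m} f =
  trans (cong₂ ℤ._+_ (∑-swap (λ x → f (false ∷ x))) (∑-swap (λ x → f (true ∷ x))))
        (sym (∑-+ (λ y → ∑ (λ x → f (false ∷ x) y)) (λ y → ∑ (λ x → f (true ∷ x) y))))

∑-single : ∀ {n} (f : Vec 𝔽₂ n → ℤ) x → (∀ y → y ≢ x → f y ≡ 0ℤ) → ∑ f ≡ f x
∑-single f []          f≡0 = refl
∑-single f (false ∷ x) f≡0 =
  trans (cong₂ ℤ._+_ (∑-single (λ y → f (false ∷ y)) x (λ y y≢x → f≡0 (false ∷ y) (y≢x ∘ Vec.∷-injectiveʳ)))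
                     (∑-zero (λ y → f≡0 (true ∷ y) (λ ()))))
        (ℤ.+-identityʳ _)
∑-single f (true ∷ x)  f≡0 =
  trans (cong₂ ℤ._+_ (∑-zero (λ y → f≡0 (false ∷ y) (λ ())))
                     (∑-single (λ y → f (true ∷ y)) x (λ y y≢x → f≡0 (true ∷ y) (y≢x ∘ Vec.∷-injectiveʳ))))
        (ℤ.+-identityˡ _)

𝟙[_] : ∀ {P : Set} → Dec P → ℤ
𝟙[ P? ] = if does P? then 1ℤ else 0ℤ

𝟙-true : ∀ {P : Set} (P? : Dec P) → P → 𝟙[ P? ] ≡ 1ℤ
𝟙-true P? p = cong (if_then 1ℤ else 0ℤ) (dec-true P? p)

𝟙-false : ∀ {P : Set} (P? : Dec P) → ¬ P → 𝟙[ P? ] ≡ 0ℤ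
𝟙-false P? ¬p = cong (if_then 1ℤ else 0ℤ) (dec-false P? ¬p)

-- Inserting the indicator of `to x ≡ y` gives a double sum that collapses to one side or the other
-- according to the order of summation, so no list of vectors has to be permuted.
∑-reindex : ∀ {m n} (to : Vec 𝔽₂ m → Vec 𝔽₂ n) (from : Vec 𝔽₂ n → Vec 𝔽₂ m) →
            (∀ x → from (to x) ≡ x) → (∀ y → to (from y) ≡ y) →
            ∀ (f : Vec 𝔽₂ m → ℤ) → ∑ f ≡ ∑ (λ y → f (from y))
∑-reindex to from from-to to-from f = begin
  ∑ f                                             ≡⟨ ∑-cong expand ⟩
  ∑ (λ x → ∑ (λ y → 𝟙[ to x ≟ⱽ y ] ℤ.* f (from y))) ≡⟨ ∑-swap (λ x y → 𝟙[ to x ≟ⱽ y ] ℤ.* f (from y)) ⟩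
  ∑ (λ y → ∑ (λ x → 𝟙[ to x ≟ⱽ y ] ℤ.* f (from y))) ≡⟨ ∑-cong contract ⟩
  ∑ (λ y → f (from y))                            ∎
  where
  open ≡-Reasoning
  picked : ∀ {P : Set} (P? : Dec P) z → P → 𝟙[ P? ] ℤ.* z ≡ z
  picked P? z p = trans (cong (ℤ._* z) (𝟙-true P? p)) (ℤ.*-identityˡ z)
  dropped : ∀ {P : Set} (P? : Dec P) z → ¬ P → 𝟙[ P? ] ℤ.* z ≡ 0ℤ
  dropped P? z ¬p = trans (cong (ℤ._* z) (𝟙-false P? ¬p)) (ℤ.*-zeroˡ z)
  expand : ∀ x → f x ≡ ∑ (λ y → 𝟙[ to x ≟ⱽ y ] ℤ.* f (from y))
  expand x = sym (trans
    (∑-single (λ y → 𝟙[ to x ≟ⱽ y ] ℤ.* f (from y)) (to x) (λ y y≢ → dropped (to x ≟ⱽ y) _ (y≢ ∘ sym)))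
    (trans (picked (to x ≟ⱽ to x) _ refl) (cong f (from-to x))))
  contract : ∀ y → ∑ (λ x → 𝟙[ to x ≟ⱽ y ] ℤ.* f (from y)) ≡ f (from y)
  contract y = trans
    (∑-single (λ x → 𝟙[ to x ≟ⱽ y ] ℤ.* f (from y)) (from y)
      (λ x x≢ → dropped (to x ≟ⱽ y) _ (λ eq → x≢ (trans (sym (from-to x)) (cong from eq)))))
    (picked (to (from y) ≟ⱽ y) _ (to-from y))

-- Poisson summation

χ : 𝔽₂ → ℤ
χ false = 1ℤ
χ true  = -1ℤ

χ-xor : ∀ a b → χ (a xor b) ≡ χ a ℤ.* χ b
χ-xor false b     = sym (ℤ.*-identityˡ (χ b))
χ-xor true  false = refl
χ-xor true  true  = refl

2^ : ℕ → ℤ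
2^ k = + (2 ^ k)

2^-suc : ∀ k → 2^ k ℤ.+ 2^ k ≡ 2^ (suc k)
2^-suc k = cong (λ z → + (2 ^ k + z)) (sym (ℕ.+-identityʳ (2 ^ k)))

∑-χ-zero : ∀ k → ∑ {k} (λ m → χ ⟨ m , 0ⱽ ⟩) ≡ 2^ k
∑-χ-zero zero    = refl
∑-χ-zero (suc k) = trans (cong₂ ℤ._+_ (∑-χ-zero k) (∑-χ-zero k)) (2^-suc k)

-- Flipping m at a coordinate where h is 1 changes the sign of the term, so the terms cancel in
-- pairs.
∑-χ-nonzero : ∀ {k} (h : Vec 𝔽₂ k) → h ≢ 0ⱽ → ∑ (λ m → χ ⟨ m , h ⟩) ≡ 0ℤ
∑-χ-nonzero []          h≢0 = ⊥-elim (h≢0 refl)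
∑-χ-nonzero (false ∷ h) h≢0 = cong₂ ℤ._+_ zeros zeros
  where
  zeros : ∑ (λ m → χ ⟨ m , h ⟩) ≡ 0ℤ
  zeros = ∑-χ-nonzero h (h≢0 ∘ cong (false ∷_))
∑-χ-nonzero (true ∷ h)  h≢0 =
  trans (sym (∑-+ (λ m → χ ⟨ m , h ⟩) (λ m → χ (not ⟨ m , h ⟩)))) (∑-zero (λ m → cancel ⟨ m , h ⟩))
  where
  cancel : ∀ b → χ b ℤ.+ χ (not b) ≡ 0ℤ
  cancel false = refl
  cancel true  = refl

xor-self : ∀ b → b xor b ≡ false
xor-self = Bool.xor-same

module SelfDualCode {k n} (G : Matrix 𝔽₂ k n) (selfDual : 𝔹.IsSelfDual (rowSpan G))
                    (independent : 𝔹.LinearlyIndependentRows G) where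

  enc : Vec 𝔽₂ k → Vec 𝔽₂ n
  enc m = m ∙ᴹ G

  enc-injective : ∀ c d → enc c ≡ enc d → c ≡ d
  enc-injective c d eq = 𝔹.+ⱽ≡0⇒≡ xor-self c d (independent (c +ⱽ d) (begin
    enc (c +ⱽ d)     ≡⟨ 𝔹.∙ᴹ-distribʳ c d G ⟩
    enc c +ⱽ enc d   ≡⟨ cong (_+ⱽ enc d) eq ⟩
    enc d +ⱽ enc d   ≡⟨ 𝔹.+ⱽ-self xor-self (enc d) ⟩
    0ⱽ               ∎))
    where open ≡-Reasoning

  -- By self-duality the generator matrix is also a parity check matrix: the code is the kernel of
  -- this map.
  syndrome : Vec 𝔽₂ n → Vec 𝔽₂ k
  syndrome v = map ⟨_, v ⟩ G

  ⟨enc,⟩ : ∀ m v → ⟨ m , syndrome v ⟩ ≡ ⟨ v , enc m ⟩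
  ⟨enc,⟩ m v = trans (sym (𝔹.⟨∙ᴹ,⟩ m G v)) (𝔹.⟨⟩-comm (enc m) v)

  orthogonal : ∀ c d → ⟨ enc c , enc d ⟩ ≡ false
  orthogonal c d = proj₁ (𝔹.IsSelfDual.C≐dual selfDual) (c , refl) (enc d) (d , refl)

  syndrome≡0⇒∈ : ∀ v → syndrome v ≡ 0ⱽ → v ∈ᶜ rowSpan G
  syndrome≡0⇒∈ v Hv≡0 = proj₂ (𝔹.IsSelfDual.C≐dual selfDual) λ { _ (m , refl) →
    trans (sym (⟨enc,⟩ m v)) (trans (cong ⟨ m ,_⟩ Hv≡0) (𝔹.⟨⟩-zeroʳ m)) }

  ∈⇒syndrome≡0 : ∀ c → syndrome (enc c) ≡ 0ⱽ
  ∈⇒syndrome≡0 c = 𝔹.⟨⟩-nondegenerate _ λ m →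
    trans (𝔹.⟨⟩-comm _ m) (trans (⟨enc,⟩ m (enc c)) (orthogonal c m))

  swapped : ∀ {n} {t v c : Vec 𝔽₂ n} → v ≡ t +ⱽ c → t +ⱽ v ≡ c
  swapped {t = t} {c = c} refl = begin
    t +ⱽ (t +ⱽ c)   ≡⟨ 𝔹.+ⱽ-assoc t t c ⟨
    (t +ⱽ t) +ⱽ c   ≡⟨ cong (_+ⱽ c) (𝔹.+ⱽ-self xor-self t) ⟩
    0ⱽ +ⱽ c         ≡⟨ 𝔹.+ⱽ-identityˡ c ⟩
    c               ∎
    where open ≡-Reasoning

  -- Orthogonality of characters: the left side is 2^k or 0 according to whether t + v lies in the
  -- code. If it does, independence of the rows leaves exactly one m with v = t + enc m.
  ∑-χ-syndrome : ∀ t v → ∑ (λ m → χ ⟨ m , syndrome (t +ⱽ v) ⟩) ≡ 2^ k ℤ.* ∑ (λ m → 𝟙[ v ≟ⱽ (t +ⱽ enc m) ])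
  ∑-χ-syndrome t v with syndrome (t +ⱽ v) ≟ⱽ 0ⱽ
  ... | yes H≡0 with syndrome≡0⇒∈ (t +ⱽ v) H≡0
  ...   | m₀ , t+v≡ = begin
    ∑ (λ m → χ ⟨ m , syndrome (t +ⱽ v) ⟩)       ≡⟨ cong (λ h → ∑ (λ m → χ ⟨ m , h ⟩)) H≡0 ⟩
    ∑ {k} (λ m → χ ⟨ m , 0ⱽ ⟩)                  ≡⟨ ∑-χ-zero k ⟩
    2^ k                                        ≡⟨ ℤ.*-identityʳ (2^ k) ⟨
    2^ k ℤ.* 1ℤ                                 ≡⟨ cong (2^ k ℤ.*_) (sym (trans single here≡)) ⟩
    2^ k ℤ.* ∑ (λ m → 𝟙[ v ≟ⱽ (t +ⱽ enc m) ])    ∎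
    where
    open ≡-Reasoning
    here≡ : 𝟙[ v ≟ⱽ (t +ⱽ enc m₀) ] ≡ 1ℤ
    here≡ = 𝟙-true (v ≟ⱽ (t +ⱽ enc m₀)) (sym (swapped (sym t+v≡)))
    single : ∑ (λ m → 𝟙[ v ≟ⱽ (t +ⱽ enc m) ]) ≡ 𝟙[ v ≟ⱽ (t +ⱽ enc m₀) ]
    single = ∑-single _ m₀ λ m m≢ → 𝟙-false (v ≟ⱽ (t +ⱽ enc m)) λ eq →
      m≢ (enc-injective m m₀ (trans (sym (swapped eq)) t+v≡))
  ∑-χ-syndrome t v | no H≢0 = begin
    ∑ (λ m → χ ⟨ m , syndrome (t +ⱽ v) ⟩)       ≡⟨ ∑-χ-nonzero _ H≢0 ⟩
    0ℤ                                          ≡⟨ ℤ.*-zeroʳ (2^ k) ⟨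
    2^ k ℤ.* 0ℤ                                 ≡⟨ cong (2^ k ℤ.*_) (sym (∑-zero λ m →
                                                     𝟙-false (v ≟ⱽ (t +ⱽ enc m)) λ eq →
                                                     H≢0 (trans (cong syndrome (swapped eq)) (∈⇒syndrome≡0 m)))) ⟩
    2^ k ℤ.* ∑ (λ m → 𝟙[ v ≟ⱽ (t +ⱽ enc m) ])    ∎
    where open ≡-Reasoning

  -- Poisson summation for the coset t + C. The transform of g, twisted by the character of t, is
  -- summed over C; after the sums are exchanged, the inner sum over C selects the v in t + C, since
  -- C is its own dual.
  poisson : ∀ (t : Vec 𝔽₂ n) (g : Vec 𝔽₂ n → ℤ) →
            ∑ (λ m → χ ⟨ t , enc m ⟩ ℤ.* ∑ (λ v → χ ⟨ v , enc m ⟩ ℤ.* g v))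
            ≡ 2^ k ℤ.* ∑ (λ m → g (t +ⱽ enc m))
  poisson t g = begin
    ∑ (λ m → χ ⟨ t , enc m ⟩ ℤ.* ∑ (λ v → χ ⟨ v , enc m ⟩ ℤ.* g v))
      ≡⟨ ∑-cong (λ m → trans (sym (∑-*ˡ (χ ⟨ t , enc m ⟩) (λ v → χ ⟨ v , enc m ⟩ ℤ.* g v)))
                             (∑-cong (λ v → character m v))) ⟩
    ∑ (λ m → ∑ (λ v → g v ℤ.* χ ⟨ m , syndrome (t +ⱽ v) ⟩))
      ≡⟨ ∑-swap (λ m v → g v ℤ.* χ ⟨ m , syndrome (t +ⱽ v) ⟩) ⟩
    ∑ (λ v → ∑ (λ m → g v ℤ.* χ ⟨ m , syndrome (t +ⱽ v) ⟩))
      ≡⟨ ∑-cong (λ v → trans (∑-*ˡ (g v) (λ m → χ ⟨ m , syndrome (t +ⱽ v) ⟩))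
                             (trans (cong (g v ℤ.*_) (∑-χ-syndrome t v)) (out v))) ⟩
    ∑ (λ v → 2^ k ℤ.* ∑ (λ m → g v ℤ.* 𝟙[ v ≟ⱽ (t +ⱽ enc m) ]))
      ≡⟨ ∑-*ˡ (2^ k) (λ v → ∑ (λ m → g v ℤ.* 𝟙[ v ≟ⱽ (t +ⱽ enc m) ])) ⟩
    2^ k ℤ.* ∑ (λ v → ∑ (λ m → g v ℤ.* 𝟙[ v ≟ⱽ (t +ⱽ enc m) ]))
      ≡⟨ cong (2^ k ℤ.*_) (∑-swap (λ v m → g v ℤ.* 𝟙[ v ≟ⱽ (t +ⱽ enc m) ])) ⟩
    2^ k ℤ.* ∑ (λ m → ∑ (λ v → g v ℤ.* 𝟙[ v ≟ⱽ (t +ⱽ enc m) ]))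
      ≡⟨ cong (2^ k ℤ.*_) (∑-cong pick) ⟩
    2^ k ℤ.* ∑ (λ m → g (t +ⱽ enc m))  ∎
    where
    open ≡-Reasoning
    rearrange : ∀ a b c → a ℤ.* (b ℤ.* c) ≡ c ℤ.* (a ℤ.* b)
    rearrange = solve-∀
    exchange : ∀ a b c → a ℤ.* (b ℤ.* c) ≡ b ℤ.* (a ℤ.* c)
    exchange = solve-∀
    character : ∀ m v → χ ⟨ t , enc m ⟩ ℤ.* (χ ⟨ v , enc m ⟩ ℤ.* g v)
                      ≡ g v ℤ.* χ ⟨ m , syndrome (t +ⱽ v) ⟩
    character m v = trans (rearrange (χ ⟨ t , enc m ⟩) (χ ⟨ v , enc m ⟩) (g v)) (cong (g v ℤ.*_) (begin
      χ ⟨ t , enc m ⟩ ℤ.* χ ⟨ v , enc m ⟩       ≡⟨ χ-xor ⟨ t , enc m ⟩ ⟨ v , enc m ⟩ ⟨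
      χ (⟨ t , enc m ⟩ xor ⟨ v , enc m ⟩)       ≡⟨ cong χ (𝔹.⟨⟩-+ˡ t v (enc m)) ⟨
      χ ⟨ t +ⱽ v , enc m ⟩                      ≡⟨ cong χ (⟨enc,⟩ m (t +ⱽ v)) ⟨
      χ ⟨ m , syndrome (t +ⱽ v) ⟩               ∎))
    out : ∀ v → g v ℤ.* (2^ k ℤ.* ∑ (λ m → 𝟙[ v ≟ⱽ (t +ⱽ enc m) ]))
              ≡ 2^ k ℤ.* ∑ (λ m → g v ℤ.* 𝟙[ v ≟ⱽ (t +ⱽ enc m) ])
    out v = trans (exchange (g v) (2^ k) _)
                  (cong (2^ k ℤ.*_) (sym (∑-*ˡ (g v) (λ m → 𝟙[ v ≟ⱽ (t +ⱽ enc m) ]))))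
    pick : ∀ m → ∑ (λ v → g v ℤ.* 𝟙[ v ≟ⱽ (t +ⱽ enc m) ]) ≡ g (t +ⱽ enc m)
    pick m = trans
      (∑-single (λ v → g v ℤ.* 𝟙[ v ≟ⱽ (t +ⱽ enc m) ]) (t +ⱽ enc m) λ v v≢ →
        trans (cong (g v ℤ.*_) (𝟙-false (v ≟ⱽ (t +ⱽ enc m)) v≢)) (ℤ.*-zeroʳ (g v)))
      (trans (cong (g (t +ⱽ enc m) ℤ.*_) (𝟙-true ((t +ⱽ enc m) ≟ⱽ (t +ⱽ enc m)) refl)) (ℤ.*-identityʳ _))

-- Krawtchouk transforms

-- A list represents the function on weights that vanishes beyond its length.
at : List ℤ → ℕ → ℤ
at []      w       = 0ℤ
at (a ∷ l) zero    = a
at (a ∷ l) (suc w) = at l w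

-- Multiplication by `χ b` in a form that evaluates without a product; the certificates apply it to
-- integers of up to 23 digits.
signed : 𝔽₂ → ℤ → ℤ
signed false a = a
signed true  a = - a

-- Sums out one coordinate against a character whose value there is determined by `b`: a function f
-- of the weight becomes f(w) + χ(b) f(w + 1). The last entry is kept because f vanishes beyond it.
step : 𝔽₂ → List ℤ → List ℤ
step b []          = []
step b (x ∷ [])    = x ∷ []
step b (x ∷ y ∷ l) = x ℤ.+ signed b y ∷ step b (y ∷ l)

signed-χ : ∀ b a → signed b a ≡ χ b ℤ.* a
signed-χ false a = sym (ℤ.*-identityˡ a)
signed-χ true  a = sym (ℤ.-1*i≡-i a)

at-step : ∀ b l w → at (step b l) w ≡ at l w ℤ.+ χ b ℤ.* at l (suc w)
at-step b []          w       = sym (trans (ℤ.+-identityˡ _) (ℤ.*-zeroʳ (χ b)))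
at-step b (x ∷ [])    zero    = sym (trans (cong (λ z → x ℤ.+ z) (ℤ.*-zeroʳ (χ b))) (ℤ.+-identityʳ x))
at-step b (x ∷ [])    (suc w) = sym (trans (ℤ.+-identityˡ _) (ℤ.*-zeroʳ (χ b)))
at-step b (x ∷ y ∷ l) zero    = cong (λ z → x ℤ.+ z) (signed-χ b y)
at-step b (x ∷ y ∷ l) (suc w) = at-step b (y ∷ l) w

-- Makes the transform depend only on how many ones c has, not on where they are.
step-comm : ∀ a b l → step a (step b l) ≡ step b (step a l)
step-comm a b []              = refl
step-comm a b (x ∷ [])        = refl
step-comm a b (x ∷ y ∷ [])    = cong (_∷ y ∷ []) (begin
  (x ℤ.+ signed b y) ℤ.+ signed a y   ≡⟨ ℤ.+-assoc x _ _ ⟩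
  x ℤ.+ (signed b y ℤ.+ signed a y)   ≡⟨ cong (λ z → x ℤ.+ z) (ℤ.+-comm (signed b y) (signed a y)) ⟩
  x ℤ.+ (signed a y ℤ.+ signed b y)   ≡⟨ ℤ.+-assoc x _ _ ⟨
  (x ℤ.+ signed a y) ℤ.+ signed b y   ∎)
  where open ≡-Reasoning
step-comm a b (x ∷ y ∷ z ∷ l) = cong₂ _∷_ head≡ (step-comm a b (y ∷ z ∷ l))
  where
  open ≡-Reasoning
  expand : ∀ x y z p q → (x ℤ.+ p ℤ.* y) ℤ.+ q ℤ.* (y ℤ.+ p ℤ.* z) ≡ (x ℤ.+ q ℤ.* y) ℤ.+ p ℤ.* (y ℤ.+ q ℤ.* z)
  expand = solve-∀
  unfold : ∀ a b → (x ℤ.+ signed b y) ℤ.+ signed a (y ℤ.+ signed b z)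
                   ≡ (x ℤ.+ χ b ℤ.* y) ℤ.+ χ a ℤ.* (y ℤ.+ χ b ℤ.* z)
  unfold a b = cong₂ (λ p q → (x ℤ.+ p) ℤ.+ q) (signed-χ b y)
    (trans (signed-χ a _) (cong (λ p → χ a ℤ.* (y ℤ.+ p)) (signed-χ b z)))
  head≡ : (x ℤ.+ signed b y) ℤ.+ signed a (y ℤ.+ signed b z) ≡ (x ℤ.+ signed a y) ℤ.+ signed b (y ℤ.+ signed a z)
  head≡ = trans (unfold a b) (trans (expand x y z (χ b) (χ a)) (sym (unfold b a)))

steps : 𝔽₂ → ℕ → List ℤ → List ℤ
steps b zero    l = l
steps b (suc n) l = steps b n (step b l)

-- krawtchouk n l w is Σ_j K_j(w) l_j for length n.
krawtchouk : ℕ → List ℤ → ℕ → ℤ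
krawtchouk n l w = at (steps false (n ∸ w) (steps true w l)) 0

steps-step : ∀ a b n l → steps a n (step b l) ≡ step b (steps a n l)
steps-step a b zero    l = refl
steps-step a b (suc n) l = trans (cong (steps a n) (step-comm a b l)) (steps-step a b n (step a l))

weight≤n : ∀ {n} (c : Vec 𝔽₂ n) → weight c ≤ n
weight≤n = Vec.count≤n (Bool._≟ true)

-- The transform of a function of the weight is again a function of the weight. Summing out the
-- first coordinate of v costs one `step`, with sign given by the first bit of c.
∑-weight : ∀ {n} (c : Vec 𝔽₂ n) l → ∑ (λ v → χ ⟨ v , c ⟩ ℤ.* at l (weight v)) ≡ krawtchouk n l (weight c)
∑-weight []              l = ℤ.*-identityˡ (at l 0)
∑-weight {suc n} (b ∷ c) l = begin
  ∑ (λ v → χ ⟨ v , c ⟩ ℤ.* at l (weight v)) ℤ.+ ∑ (λ v → χ (b xor ⟨ v , c ⟩) ℤ.* at l (suc (weight v)))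
    ≡⟨ ∑-+ (λ v → χ ⟨ v , c ⟩ ℤ.* at l (weight v)) (λ v → χ (b xor ⟨ v , c ⟩) ℤ.* at l (suc (weight v))) ⟨
  ∑ (λ v → χ ⟨ v , c ⟩ ℤ.* at l (weight v) ℤ.+ χ (b xor ⟨ v , c ⟩) ℤ.* at l (suc (weight v)))
    ≡⟨ ∑-cong (λ v → trans (factor v) (cong (χ ⟨ v , c ⟩ ℤ.*_) (sym (at-step b l (weight v))))) ⟩
  ∑ (λ v → χ ⟨ v , c ⟩ ℤ.* at (step b l) (weight v))
    ≡⟨ ∑-weight c (step b l) ⟩
  krawtchouk n (step b l) (weight c)
    ≡⟨ move b ⟩
  krawtchouk (suc n) l (weight (b ∷ c)) ∎
  where
  open ≡-Reasoning
  collect : ∀ p q s t → p ℤ.* s ℤ.+ (q ℤ.* p) ℤ.* t ≡ p ℤ.* (s ℤ.+ q ℤ.* t)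
  collect = solve-∀
  factor : ∀ v → χ ⟨ v , c ⟩ ℤ.* at l (weight v) ℤ.+ χ (b xor ⟨ v , c ⟩) ℤ.* at l (suc (weight v))
               ≡ χ ⟨ v , c ⟩ ℤ.* (at l (weight v) ℤ.+ χ b ℤ.* at l (suc (weight v)))
  factor v = trans (cong (λ z → χ ⟨ v , c ⟩ ℤ.* at l (weight v) ℤ.+ z ℤ.* at l (suc (weight v)))
                         (χ-xor b ⟨ v , c ⟩))
                   (collect (χ ⟨ v , c ⟩) (χ b) _ _)
  move : ∀ b → krawtchouk n (step b l) (weight c) ≡ krawtchouk (suc n) l (weight (b ∷ c))
  move true  = refl
  -- `krawtchouk` performs the steps for the ones before those for the zeros, so the step of a
  -- leading zero has to pass all of the former.
  move false = begin
    at (steps false (n ∸ weight c) (steps true (weight c) (step false l))) 0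
      ≡⟨ cong (λ s → at (steps false (n ∸ weight c) s) 0) (steps-step true false (weight c) l) ⟩
    at (steps false (suc (n ∸ weight c)) (steps true (weight c) l)) 0
      ≡⟨ cong (λ j → at (steps false j (steps true (weight c) l)) 0) (ℕ.+-∸-assoc 1 (weight≤n c)) ⟨
    at (steps false (suc n ∸ weight c) (steps true (weight c) l)) 0 ∎

-- Weights in self-orthogonal codes

odd : ℕ → 𝔽₂
odd zero    = false
odd (suc n) = not (odd n)

even⇒double : ∀ n → odd n ≡ false → ∃[ j ] n ≡ j + j
even⇒double zero          _ = 0 , refl
even⇒double (suc (suc n)) p with even⇒double n (trans (sym (Bool.not-involutive (odd n))) p)
... | j , refl = suc j , cong suc (sym (ℕ.+-suc j j))

odd-weight : ∀ {n} (x : Vec 𝔽₂ n) → odd (weight x) ≡ Vec.foldr′ _xor_ false x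
odd-weight []          = refl
odd-weight (false ∷ x) = odd-weight x
odd-weight (true ∷ x)  = cong not (odd-weight x)

selfOrthogonal⇒even : ∀ {n} (x : Vec 𝔽₂ n) → ⟨ x , x ⟩ ≡ false → odd (weight x) ≡ false
selfOrthogonal⇒even x x⊥x =
  trans (odd-weight x) (trans (cong (Vec.foldr′ _xor_ false) (sym (Vec.zipWith-idem Bool.∧-idem x))) x⊥x)

weight-+ⱽ : ∀ {n} (x y : Vec 𝔽₂ n) →
            weight (x +ⱽ y) + (weight (zipWith _∧_ x y) + weight (zipWith _∧_ x y)) ≡ weight x + weight y
weight-+ⱽ []          []          = refl
weight-+ⱽ (false ∷ x) (false ∷ y) = weight-+ⱽ x y
weight-+ⱽ (false ∷ x) (true ∷ y)  = trans (cong suc (weight-+ⱽ x y)) (sym (ℕ.+-suc _ _))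
weight-+ⱽ (true ∷ x)  (false ∷ y) = cong suc (weight-+ⱽ x y)
weight-+ⱽ (true ∷ x)  (true ∷ y)  = trans (shift _ (weight (zipWith _∧_ x y)))
                                          (cong suc (trans (cong suc (weight-+ⱽ x y)) (sym (ℕ.+-suc _ _))))
  where
  shift : ∀ a b → a + (suc b + suc b) ≡ suc (suc (a + (b + b)))
  shift = ℕ.solve-∀

-- ε w = (-1)^(w/2) for even w; the values at odd w are irrelevant.
ε : ℕ → ℤ
ε zero          = 1ℤ
ε (suc zero)    = 1ℤ
ε (suc (suc w)) = - ε w

ε-+ : ∀ i b → ε ((i + i) + b) ≡ ε (i + i) ℤ.* ε b
ε-+ zero    b = sym (ℤ.*-identityˡ (ε b))
ε-+ (suc i) b rewrite ℕ.+-suc i i = trans (cong -_ (ε-+ i b)) (ℤ.neg-distribˡ-* (ε (i + i)) (ε b))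

ε-double² : ∀ i → ε (i + i) ℤ.* ε (i + i) ≡ 1ℤ
ε-double² zero    = refl
ε-double² (suc i) rewrite ℕ.+-suc i i = trans (neg² (ε (i + i))) (ε-double² i)
  where
  neg² : ∀ a → (- a) ℤ.* (- a) ≡ a ℤ.* a
  neg² = solve-∀

-- The weight of x + y is the sum of the two weights minus twice the overlap. Orthogonality makes
-- the overlap an even number 2j, so the correction 4j does not affect ε; evenness of the weight of
-- x makes ε multiplicative on the sum.
ε-weight-+ⱽ : ∀ {n} (x y : Vec 𝔽₂ n) → ⟨ x , x ⟩ ≡ false → ⟨ x , y ⟩ ≡ false →
              ε (weight (x +ⱽ y)) ≡ ε (weight x) ℤ.* ε (weight y)
ε-weight-+ⱽ x y x⊥x x⊥y
  with even⇒double (weight x) (selfOrthogonal⇒even x x⊥x)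
     | even⇒double (weight (zipWith _∧_ x y)) (trans (odd-weight (zipWith _∧_ x y)) x⊥y)
... | i , wx≡ | j , wxy≡ = begin
  ε (weight (x +ⱽ y))                                      ≡⟨ ℤ.*-identityˡ _ ⟨
  1ℤ ℤ.* ε (weight (x +ⱽ y))                               ≡⟨ cong (ℤ._* ε (weight (x +ⱽ y))) (ε-double² j) ⟨
  (ε (j + j) ℤ.* ε (j + j)) ℤ.* ε (weight (x +ⱽ y))         ≡⟨ cong (ℤ._* ε (weight (x +ⱽ y))) (ε-+ j (j + j)) ⟨
  ε ((j + j) + (j + j)) ℤ.* ε (weight (x +ⱽ y))             ≡⟨ ε-+ (j + j) (weight (x +ⱽ y)) ⟨
  ε (((j + j) + (j + j)) + weight (x +ⱽ y))                 ≡⟨ cong ε (ℕ.+-comm ((j + j) + (j + j)) _) ⟩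
  ε (weight (x +ⱽ y) + ((j + j) + (j + j)))                 ≡⟨ cong (λ o → ε (weight (x +ⱽ y) + (o + o))) wxy≡ ⟨
  ε (weight (x +ⱽ y) + (weight (zipWith _∧_ x y) + weight (zipWith _∧_ x y)))
                                                           ≡⟨ cong ε (weight-+ⱽ x y) ⟩
  ε (weight x + weight y)                                  ≡⟨ cong (λ w → ε (w + weight y)) wx≡ ⟩
  ε ((i + i) + weight y)                                   ≡⟨ ε-+ i (weight y) ⟩
  ε (i + i) ℤ.* ε (weight y)                               ≡⟨ cong (λ w → ε w ℤ.* ε (weight y)) wx≡ ⟨
  ε (weight x) ℤ.* ε (weight y)                            ∎
  where open ≡-Reasoning

false•+ⱽ : ∀ {n} (g x : Vec 𝔽₂ n) → false 𝔹.• g +ⱽ x ≡ x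
false•+ⱽ g x = trans (cong (_+ⱽ x) (𝔹.•-zeroˡ g)) (𝔹.+ⱽ-identityˡ x)

true•+ⱽ : ∀ {n} (g x : Vec 𝔽₂ n) → true 𝔹.• g +ⱽ x ≡ g +ⱽ x
true•+ⱽ g x = cong (_+ⱽ x) (𝔹.•-identity g)

-- On a self-orthogonal code ε of the weight is multiplicative, so agreement with the character of t
-- on the rows extends to all words. This is how membership of t in the shadow is reduced to a check
-- of the generators.
ε-rowSpan : ∀ {k n} (t : Vec 𝔽₂ n) (G : Matrix 𝔽₂ k n) →
            (∀ c d → ⟨ c ∙ᴹ G , d ∙ᴹ G ⟩ ≡ false) →
            All (λ g → ε (weight g) ≡ χ ⟨ t , g ⟩) G →
            ∀ m → ε (weight (m ∙ᴹ G)) ≡ χ ⟨ t , m ∙ᴹ G ⟩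
ε-rowSpan {n = n} t [] orth [] [] = trans (cong ε (weight-0 n)) (cong χ (sym (𝔹.⟨⟩-zeroʳ t)))
  where
  weight-0 : ∀ n → weight (0ⱽ {n}) ≡ 0
  weight-0 zero    = refl
  weight-0 (suc n) = weight-0 n
ε-rowSpan t (g ∷ G) orth (p ∷ ps) (b ∷ m) = case b
  where
  open ≡-Reasoning
  drop : ∀ c → (false ∷ c) ∙ᴹ (g ∷ G) ≡ c ∙ᴹ G
  drop c = false•+ⱽ g (c ∙ᴹ G)
  head : (true ∷ 0ⱽ) ∙ᴹ (g ∷ G) ≡ g
  head = trans (true•+ⱽ g (0ⱽ ∙ᴹ G)) (trans (cong (g +ⱽ_) (𝔹.∙ᴹ-zeroˡ G)) (𝔹.+ⱽ-identityʳ g))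
  rest : ε (weight (m ∙ᴹ G)) ≡ χ ⟨ t , m ∙ᴹ G ⟩
  rest = ε-rowSpan t G (λ c d → trans (cong₂ ⟨_,_⟩ (sym (drop c)) (sym (drop d))) (orth (false ∷ c) (false ∷ d))) ps m
  case : ∀ b → ε (weight ((b ∷ m) ∙ᴹ (g ∷ G))) ≡ χ ⟨ t , (b ∷ m) ∙ᴹ (g ∷ G) ⟩
  case false = trans (cong (ε ∘ weight) (drop m)) (trans rest (cong (χ ∘ ⟨ t ,_⟩) (sym (drop m))))
  case true  = begin
    ε (weight ((true ∷ m) ∙ᴹ (g ∷ G)))          ≡⟨ cong (ε ∘ weight) (true•+ⱽ g (m ∙ᴹ G)) ⟩
    ε (weight (g +ⱽ m ∙ᴹ G))                    ≡⟨ ε-weight-+ⱽ g (m ∙ᴹ G)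
                                                     (trans (cong₂ ⟨_,_⟩ (sym head) (sym head)) (orth (true ∷ 0ⱽ) (true ∷ 0ⱽ)))
                                                     (trans (cong₂ ⟨_,_⟩ (sym head) (sym (drop m))) (orth (true ∷ 0ⱽ) (false ∷ m))) ⟩
    ε (weight g) ℤ.* ε (weight (m ∙ᴹ G))        ≡⟨ cong₂ ℤ._*_ p rest ⟩
    χ ⟨ t , g ⟩ ℤ.* χ ⟨ t , m ∙ᴹ G ⟩            ≡⟨ χ-xor ⟨ t , g ⟩ ⟨ t , m ∙ᴹ G ⟩ ⟨
    χ (⟨ t , g ⟩ xor ⟨ t , m ∙ᴹ G ⟩)            ≡⟨ cong χ (𝔹.⟨⟩-+ʳ t g (m ∙ᴹ G)) ⟨
    χ ⟨ t , g +ⱽ m ∙ᴹ G ⟩                       ≡⟨ cong (χ ∘ ⟨ t ,_⟩) (true•+ⱽ g (m ∙ᴹ G)) ⟨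
    χ ⟨ t , (true ∷ m) ∙ᴹ (g ∷ G) ⟩             ∎

-- Counting the words of a given weight

all2ⁿ : ∀ n → List (Vec 𝔽₂ n)
all2ⁿ zero    = [] ∷ []
all2ⁿ (suc n) = List.map (false ∷_) (all2ⁿ n) List.++ List.map (true ∷_) (all2ⁿ n)

∈-all2ⁿ : ∀ {n} (x : Vec 𝔽₂ n) → x List.∈ all2ⁿ n
∈-all2ⁿ []          = here refl
∈-all2ⁿ (false ∷ x) = List.∈-++⁺ˡ (List.∈-map⁺ (false ∷_) (∈-all2ⁿ x))
∈-all2ⁿ (true ∷ x)  = List.∈-++⁺ʳ (List.map (false ∷_) (all2ⁿ _)) (List.∈-map⁺ (true ∷_) (∈-all2ⁿ x))

all2ⁿ-unique : ∀ n → Unique (all2ⁿ n)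
all2ⁿ-unique zero    = [] ∷ []
all2ⁿ-unique (suc n) =
  Unique.++⁺ (Unique.map⁺ Vec.∷-injectiveʳ (all2ⁿ-unique n)) (Unique.map⁺ Vec.∷-injectiveʳ (all2ⁿ-unique n)) disjoint
  where
  disjoint : ∀ {x} → ¬ (x List.∈ List.map (false ∷_) (all2ⁿ n) × x List.∈ List.map (true ∷_) (all2ⁿ n))
  disjoint (p , q) with List.∈-map⁻ (false ∷_) p | List.∈-map⁻ (true ∷_) q
  ... | _ , _ , refl | _ , _ , ()

∑ˡ : ∀ {A : Set} → (A → ℤ) → List A → ℤ
∑ˡ f []       = 0ℤ
∑ˡ f (x ∷ xs) = f x ℤ.+ ∑ˡ f xs

∑ˡ-++ : ∀ {A : Set} (f : A → ℤ) xs ys → ∑ˡ f (xs List.++ ys) ≡ ∑ˡ f xs ℤ.+ ∑ˡ f ys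
∑ˡ-++ f []       ys = sym (ℤ.+-identityˡ _)
∑ˡ-++ f (x ∷ xs) ys = trans (cong (λ z → f x ℤ.+ z) (∑ˡ-++ f xs ys)) (sym (ℤ.+-assoc (f x) _ _))

∑ˡ-map : ∀ {A B : Set} (f : B → ℤ) (g : A → B) xs → ∑ˡ f (List.map g xs) ≡ ∑ˡ (f ∘ g) xs
∑ˡ-map f g []       = refl
∑ˡ-map f g (x ∷ xs) = cong (λ z → f (g x) ℤ.+ z) (∑ˡ-map f g xs)

∑ˡ-all2ⁿ : ∀ {n} (f : Vec 𝔽₂ n → ℤ) → ∑ˡ f (all2ⁿ n) ≡ ∑ f
∑ˡ-all2ⁿ {zero}  f = ℤ.+-identityʳ (f [])
∑ˡ-all2ⁿ {suc n} f = trans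
  (∑ˡ-++ f (List.map (false ∷_) (all2ⁿ n)) (List.map (true ∷_) (all2ⁿ n)))
  (cong₂ ℤ._+_ (trans (∑ˡ-map f (false ∷_) (all2ⁿ n)) (∑ˡ-all2ⁿ (λ x → f (false ∷ x))))
               (trans (∑ˡ-map f (true ∷_) (all2ⁿ n)) (∑ˡ-all2ⁿ (λ x → f (true ∷ x)))))

length-filter : ∀ {A : Set} {P : A → Set} (P? : ∀ x → Dec (P x)) xs →
                + List.length (List.filter P? xs) ≡ ∑ˡ (λ x → 𝟙[ P? x ]) xs
length-filter P? []       = refl
length-filter P? (x ∷ xs) with does (P? x)
... | true  = cong (λ z → 1ℤ ℤ.+ z) (length-filter P? xs)
... | false = trans (length-filter P? xs) (sym (ℤ.+-identityˡ _))

weight≡0⇒≡0ⱽ : ∀ {n} (x : Vec 𝔽₂ n) → weight x ≡ 0 → x ≡ 0ⱽ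
weight≡0⇒≡0ⱽ []          _ = refl
weight≡0⇒≡0ⱽ (false ∷ x) p = cong (false ∷_) (weight≡0⇒≡0ⱽ x p)

weight-0ⱽ : ∀ n → weight (0ⱽ {n}) ≡ 0
weight-0ⱽ zero    = refl
weight-0ⱽ (suc n) = weight-0ⱽ n

-- A linear combination of MacWilliams identities, with coefficients g for a
-- self-dual [n,k] code and h for its shadow, that isolates the words of
-- weight w₀ as soon as the code only has words of admissible weights.
record Certificate (n k w₀ : ℕ) (Admissible : ℕ → Set) : Set where
  field
    g h   : List ℤ
    N M   : ℤ
    valid : ∀ w → Admissible w → w ≤ n →
            (krawtchouk n g w ℤ.- 2^ k ℤ.* at g w) ℤ.+ ε w ℤ.* krawtchouk n h w
            ≡ N ℤ.* 𝟙[ w ℕ.≟ w₀ ] ℤ.+ M ℤ.* 𝟙[ w ℕ.≟ 0 ]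

module WeightEnumerator {k n} (G : Matrix 𝔽₂ k n) (selfDual : 𝔹.IsSelfDual (rowSpan G))
                        (independent : 𝔹.LinearlyIndependentRows G) where

  open SelfDualCode G selfDual independent

  hasWeight? : ∀ w m → Dec (weight (enc m) ≡ w)
  hasWeight? w m = weight (enc m) ℕ.≟ w

  -- The list that witnesses `NumberOfWordsOfWeight`. It filters 2^k messages and serves only as an
  -- abstract list; its length is obtained from `certified`.
  wordsOfWeight : ℕ → List (Vec 𝔽₂ n)
  wordsOfWeight w = List.map enc (List.filter (hasWeight? w) (all2ⁿ k))

  wordsOfWeight-unique : ∀ w → Unique (wordsOfWeight w)
  wordsOfWeight-unique w =
    Unique.map⁺ (enc-injective _ _) (Unique.filter⁺ (hasWeight? w) (all2ⁿ-unique k))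

  length-wordsOfWeight : ∀ w → + List.length (wordsOfWeight w) ≡ ∑ (λ m → 𝟙[ hasWeight? w m ])
  length-wordsOfWeight w = trans
    (cong +_ (List.length-map enc (List.filter (hasWeight? w) (all2ⁿ k))))
    (trans (length-filter (hasWeight? w) (all2ⁿ k)) (∑ˡ-all2ⁿ (λ m → 𝟙[ hasWeight? w m ])))

  numberOfWords : ∀ w N → List.length (wordsOfWeight w) ≡ N → NumberOfWordsOfWeight (rowSpan G) w N
  numberOfWords w N length≡ = wordsOfWeight w , wordsOfWeight-unique w , length≡ , λ x → mk⇔ to from
    where
    to : ∀ {x} → x List.∈ wordsOfWeight w → x ∈ᶜ rowSpan G × weight x ≡ w
    to x∈ with List.∈-map⁻ enc x∈
    ... | m , m∈ , refl = (m , refl) , proj₂ (List.∈-filter⁻ (hasWeight? w) {xs = all2ⁿ k} m∈)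
    from : ∀ {x} → x ∈ᶜ rowSpan G × weight x ≡ w → x List.∈ wordsOfWeight w
    from ((m , refl) , p) = List.∈-map⁺ enc (List.∈-filter⁺ (hasWeight? w) (∈-all2ⁿ m) p)

  -- The MacWilliams identity of the self-dual code for t = 0; for t in the shadow, where the
  -- character of t is ε of the weight, the identity between the code and its shadow.
  macWilliams : ∀ t l → ∑ (λ m → χ ⟨ t , enc m ⟩ ℤ.* krawtchouk n l (weight (enc m)))
                        ≡ 2^ k ℤ.* ∑ (λ m → at l (weight (t +ⱽ enc m)))
  macWilliams t l = trans
    (∑-cong (λ m → cong (χ ⟨ t , enc m ⟩ ℤ.*_) (sym (∑-weight (enc m) l))))
    (poisson t (λ v → at l (weight v)))

  -- Sum `valid` over the code. The terms in g cancel, since the code is its own dual; the terms in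
  -- h turn into a sum over the shadow. The right side leaves N times the wanted count, plus M for
  -- the one word of weight 0.
  certified : ∀ {w₀ Admissible} (certificate : Certificate n k w₀ Admissible) →
              (∀ m → Admissible (weight (enc m))) →
              ∀ t → All (λ r → ε (weight r) ≡ χ ⟨ t , r ⟩) G →
              let open Certificate certificate in
              N ℤ.* + List.length (wordsOfWeight w₀) ℤ.+ M ≡ 2^ k ℤ.* ∑ (λ m → at h (weight (t +ⱽ enc m)))
  certified {w₀} certificate admissible t shadow = begin
    N ℤ.* + List.length (wordsOfWeight w₀) ℤ.+ M
      ≡⟨ cong₂ (λ a b → N ℤ.* a ℤ.+ b) (length-wordsOfWeight w₀)
               (sym (trans (cong (M ℤ.*_) zeroWord) (ℤ.*-identityʳ M))) ⟩
    N ℤ.* ∑ (λ m → 𝟙[ hasWeight? w₀ m ]) ℤ.+ M ℤ.* ∑ (λ m → 𝟙[ hasWeight? 0 m ])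
      ≡⟨ cong₂ ℤ._+_ (∑-*ˡ N (λ m → 𝟙[ hasWeight? w₀ m ])) (∑-*ˡ M (λ m → 𝟙[ hasWeight? 0 m ])) ⟨
    ∑ (λ m → N ℤ.* 𝟙[ hasWeight? w₀ m ]) ℤ.+ ∑ (λ m → M ℤ.* 𝟙[ hasWeight? 0 m ])
      ≡⟨ ∑-+ (λ m → N ℤ.* 𝟙[ hasWeight? w₀ m ]) (λ m → M ℤ.* 𝟙[ hasWeight? 0 m ]) ⟨
    ∑ (λ m → N ℤ.* 𝟙[ hasWeight? w₀ m ] ℤ.+ M ℤ.* 𝟙[ hasWeight? 0 m ])
      ≡⟨ ∑-cong (λ m → sym (valid (weight (enc m)) (admissible m) (weight≤n (enc m)))) ⟩
    ∑ (λ m → (K g m ℤ.- 2^ k ℤ.* at g (weight (enc m))) ℤ.+ ε (weight (enc m)) ℤ.* K h m)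
      -- The trivial character is inserted in the first part and ε is replaced by the character of t
      -- in the second, so that `macWilliams` applies to both.
      ≡⟨ ∑-cong (λ m → cong₂ ℤ._+_ (unshifted m)
                                   (cong (ℤ._* K h m) (ε-rowSpan t G orthogonal shadow m))) ⟩
    ∑ (λ m → (χ ⟨ 0ⱽ , enc m ⟩ ℤ.* K g m ℤ.+ - 2^ k ℤ.* at g (weight (enc m))) ℤ.+ χ ⟨ t , enc m ⟩ ℤ.* K h m)
      ≡⟨ ∑-+ (λ m → χ ⟨ 0ⱽ , enc m ⟩ ℤ.* K g m ℤ.+ - 2^ k ℤ.* at g (weight (enc m))) (λ m → χ ⟨ t , enc m ⟩ ℤ.* K h m) ⟩
    ∑ (λ m → χ ⟨ 0ⱽ , enc m ⟩ ℤ.* K g m ℤ.+ - 2^ k ℤ.* at g (weight (enc m))) ℤ.+ ∑ (λ m → χ ⟨ t , enc m ⟩ ℤ.* K h m)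
      ≡⟨ cong₂ ℤ._+_ cancel (macWilliams t h) ⟩
    0ℤ ℤ.+ 2^ k ℤ.* ∑ (λ m → at h (weight (t +ⱽ enc m)))
      ≡⟨ ℤ.+-identityˡ _ ⟩
    2^ k ℤ.* ∑ (λ m → at h (weight (t +ⱽ enc m))) ∎
    where
    open ≡-Reasoning
    open Certificate certificate
    K : List ℤ → Vec 𝔽₂ k → ℤ
    K l m = krawtchouk n l (weight (enc m))
    first : ∀ a b c → a ℤ.- b ℤ.* c ≡ 1ℤ ℤ.* a ℤ.+ - b ℤ.* c
    first = solve-∀
    unshifted : ∀ m → K g m ℤ.- 2^ k ℤ.* at g (weight (enc m))
                      ≡ χ ⟨ 0ⱽ , enc m ⟩ ℤ.* K g m ℤ.+ - 2^ k ℤ.* at g (weight (enc m))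
    unshifted m = trans (first (K g m) (2^ k) _)
      (cong (λ b → χ b ℤ.* K g m ℤ.+ - 2^ k ℤ.* at g (weight (enc m))) (sym (𝔹.⟨⟩-zeroˡ (enc m))))
    zeroWord : ∑ (λ m → 𝟙[ hasWeight? 0 m ]) ≡ 1ℤ
    zeroWord = trans
      (∑-single (λ m → 𝟙[ hasWeight? 0 m ]) 0ⱽ λ m m≢0 →
        𝟙-false (hasWeight? 0 m) (m≢0 ∘ independent m ∘ weight≡0⇒≡0ⱽ (enc m)))
      (𝟙-true (hasWeight? 0 0ⱽ) (trans (cong weight (𝔹.∙ᴹ-zeroˡ G)) (weight-0ⱽ n)))
    cancel : ∑ (λ m → χ ⟨ 0ⱽ , enc m ⟩ ℤ.* K g m ℤ.+ - 2^ k ℤ.* at g (weight (enc m))) ≡ 0ℤ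
    cancel = begin
      ∑ (λ m → χ ⟨ 0ⱽ , enc m ⟩ ℤ.* K g m ℤ.+ - 2^ k ℤ.* at g (weight (enc m)))
        ≡⟨ ∑-+ (λ m → χ ⟨ 0ⱽ , enc m ⟩ ℤ.* K g m) (λ m → - 2^ k ℤ.* at g (weight (enc m))) ⟩
      ∑ (λ m → χ ⟨ 0ⱽ , enc m ⟩ ℤ.* K g m) ℤ.+ ∑ (λ m → - 2^ k ℤ.* at g (weight (enc m)))
        ≡⟨ cong₂ ℤ._+_ (trans (macWilliams 0ⱽ g) (cong (2^ k ℤ.*_)
                         (∑-cong (λ m → cong (at g ∘ weight) (𝔹.+ⱽ-identityˡ (enc m))))))
                       (∑-*ˡ (- 2^ k) (λ m → at g (weight (enc m)))) ⟩
      2^ k ℤ.* S ℤ.+ - 2^ k ℤ.* S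
        ≡⟨ annihilate (2^ k) S ⟩
      0ℤ ∎
      where
      S : ℤ
      S = ∑ (λ m → at g (weight (enc m)))
      annihilate : ∀ a b → a ℤ.* b ℤ.+ - a ℤ.* b ≡ 0ℤ
      annihilate = solve-∀

-- The certificates for extremal codes of length 64

Admissible : ℕ → Set
Admissible w = odd w ≡ false × (w ≡ 0 ⊎ 12 ≤ w)

admissible? : ∀ w → Dec (Admissible w)
admissible? w = (odd w Bool.≟ false) ×-dec ((w ℕ.≟ 0) ⊎-dec (12 ℕ.≤? w))

-- The equations of Certificate.valid are linear in g, h, N and M; these are
-- solutions with g supported on the weights below 24 and h on 0, 4 and 8.
g₁₂ h₁₂ : List ℤ
g₁₂ =
  + 2827801276256811745280 ∷ + 1514594819445547856770 ∷ + 795745502437706629120 ∷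
  + 409542638746342697650 ∷ + 206167668205395886080 ∷ + 101346441656738509290 ∷
  + 48555618628652728320 ∷ + 22624496549468092090 ∷ + 10227250185870049280 ∷
  + 4472494599701259805 ∷ + 1885923391546654720 ∷ + 763849226148664565 ∷
  + 295812342535290880 ∷ + 108935022855447945 ∷ + 37892913059921920 ∷ + 12347716695765425 ∷
  + 3729851194212352 ∷ + 1030245319207611 ∷ + 255484006170624 ∷ + 55434906258563 ∷
  + 10129328979968 ∷ + 1464998627079 ∷ + 149415428096 ∷ + 8072118847 ∷ []
h₁₂ =
  + 2363972648960 ∷ + 0 ∷ + 0 ∷ + 0 ∷ + 318227087360 ∷ + 0 ∷ + 0 ∷ + 0 ∷ + 22730506240 ∷ []
-- The admissible weights give 28 equations for 29 unknowns: 24 entries of g, 3 of h, N and M. Here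
-- `M₁₂` is -1312 `N₁₂`, and the entries of `h₁₂` are 1664, 224 and 16 times `N₁₂` / 2^32, so the
-- certificate says A₁₂ = 1312 + 1664 B₀ + 224 B₄ + 16 B₈.
N₁₂ M₁₂ : ℤ
N₁₂ = + 6101673807645245440
M₁₂ = - + 8005396035630562017280

certificate₁₂ : Certificate 64 32 12 Admissible
certificate₁₂ = record
  { g = g₁₂ ; h = h₁₂ ; N = N₁₂ ; M = M₁₂
  ; valid = λ w admissible w≤64 → toWitness {a? = ℕ.allUpTo? check₁₂ 65} _ (ℕ.s≤s w≤64) admissible
  }
  where
  check₁₂ : ∀ w → Dec (Admissible w →
    (krawtchouk 64 g₁₂ w ℤ.- 2^ 32 ℤ.* at g₁₂ w) ℤ.+ ε w ℤ.* krawtchouk 64 h₁₂ w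
    ≡ N₁₂ ℤ.* 𝟙[ w ℕ.≟ 12 ] ℤ.+ M₁₂ ℤ.* 𝟙[ w ℕ.≟ 0 ])
  check₁₂ w = admissible? w →-dec (_ ℤ.≟ _)


g₁₄ h₁₄ : List ℤ
g₁₄ =
  - + 30468072275837662003200 ∷ - + 16319768812516162317870 ∷ - + 8574576538251831910400 ∷
  - + 4413243319681793161230 ∷ - + 2221767570923205427200 ∷ - + 1092206191576977906550 ∷
  - + 523301588900399063040 ∷ - + 243840484622410377750 ∷ - + 110229389220535336960 ∷
  - + 48205494540891636075 ∷ - + 20327061136424140800 ∷ - + 8232968679965075995 ∷
  - + 3188278955940249600 ∷ - + 1174058452856926455 ∷ - + 408367117016268800 ∷
  - + 133056179850867975 ∷ - + 40186120218083328 ∷ - + 11097775036977005 ∷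
  - + 2751287447642112 ∷ - + 596743294243005 ∷ - + 108982421422080 ∷ - + 15750844536297 ∷
  - + 1604901396480 ∷ - + 86596411993 ∷ []
h₁₄ =
  - + 81829822464000 ∷ + 0 ∷ + 0 ∷ + 0 ∷ - + 6819151872000 ∷ + 0 ∷ + 0 ∷ + 0 ∷
  - + 227305062400 ∷ []
-- In the same way these encode A₁₄ = 23040 - 23040 B₀ - 1920 B₄ - 64 B₈.
N₁₄ M₁₄ : ℤ
N₁₄ = + 15254184519113113600
M₁₄ = - + 351456411320366137344000

certificate₁₄ : Certificate 64 32 14 Admissible
certificate₁₄ = record
  { g = g₁₄ ; h = h₁₄ ; N = N₁₄ ; M = M₁₄
  ; valid = λ w admissible w≤64 → toWitness {a? = ℕ.allUpTo? check₁₄ 65} _ (ℕ.s≤s w≤64) admissible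
  }
  where
  check₁₄ : ∀ w → Dec (Admissible w →
    (krawtchouk 64 g₁₄ w ℤ.- 2^ 32 ℤ.* at g₁₄ w) ℤ.+ ε w ℤ.* krawtchouk 64 h₁₄ w
    ≡ N₁₄ ℤ.* 𝟙[ w ℕ.≟ 14 ] ℤ.+ M₁₄ ℤ.* 𝟙[ w ℕ.≟ 0 ])
  check₁₄ w = admissible? w →-dec (_ ℤ.≟ _)

-- The Gray map

module 𝓡 = LinearAlgebra R₂-ring.isCommutativeRing
open R₂ using (a; b; c; d)
open R₂-ring using (0#; 1#; _⊕_; _⊗_; ι)

-- `R₂` is the group algebra over `𝔽₂` of the Klein four-group of units 1, 1+u, 1+v, (1+u)(1+v). The
-- coordinates of r on these four are `γ₃`, `γ₂`, `γ₁`, `γ₀`, and they are what the Gray map writes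
-- down.
γ₀ γ₁ γ₂ γ₃ : R₂ → 𝔽₂
γ₀ r = d r
γ₁ r = c r xor d r
γ₂ r = b r xor d r
γ₃ r = ((a r xor b r) xor c r) xor d r

ungray : 𝔽₂ → 𝔽₂ → 𝔽₂ → 𝔽₂ → R₂
ungray p q s t = ⟪ ((t xor s) xor q) xor p , s xor p , q xor p , p ⟫

ungray-γ : ∀ r → ungray (γ₀ r) (γ₁ r) (γ₂ r) (γ₃ r) ≡ r
ungray-γ ⟪ a , b , c , d ⟫ = cong₃
  (solve 4 (λ a b c d → (((((a :+ b) :+ c) :+ d) :+ (b :+ d)) :+ (c :+ d)) :+ d := a) refl a b c d)
  (solve 2 (λ b d → (b :+ d) :+ d := b) refl b d)
  (solve 2 (λ c d → (c :+ d) :+ d := c) refl c d)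
  where
  open xor-∧-Solver
  cong₃ : ∀ {a a′ b b′ c c′} → a ≡ a′ → b ≡ b′ → c ≡ c′ → ⟪ a , b , c , d ⟫ ≡ ⟪ a′ , b′ , c′ , d ⟫
  cong₃ refl refl refl = refl

γ₁-ungray : ∀ p q s t → γ₁ (ungray p q s t) ≡ q
γ₁-ungray p q s t = solve 2 (λ p q → (q :+ p) :+ p := q) refl p q
  where open xor-∧-Solver

γ₂-ungray : ∀ p q s t → γ₂ (ungray p q s t) ≡ s
γ₂-ungray p q s t = γ₁-ungray p s q t

γ₃-ungray : ∀ p q s t → γ₃ (ungray p q s t) ≡ t
γ₃-ungray p q s t =
  solve 4 (λ p q s t → (((((t :+ s) :+ q) :+ p) :+ (s :+ p)) :+ (q :+ p)) :+ p := t) refl p q s t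
  where open xor-∧-Solver

γ₀-⊕ : ∀ r s → γ₀ (r ⊕ s) ≡ γ₀ r xor γ₀ s
γ₀-⊕ r s = refl

γ₁-⊕ : ∀ r s → γ₁ (r ⊕ s) ≡ γ₁ r xor γ₁ s
γ₁-⊕ ⟪ _ , _ , c , d ⟫ ⟪ _ , _ , c′ , d′ ⟫ =
  solve 4 (λ c d c′ d′ → (c :+ c′) :+ (d :+ d′) := (c :+ d) :+ (c′ :+ d′)) refl c d c′ d′
  where open xor-∧-Solver

γ₂-⊕ : ∀ r s → γ₂ (r ⊕ s) ≡ γ₂ r xor γ₂ s
γ₂-⊕ ⟪ _ , b , _ , d ⟫ ⟪ _ , b′ , _ , d′ ⟫ = γ₁-⊕ ⟪ false , false , b , d ⟫ ⟪ false , false , b′ , d′ ⟫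

γ₃-⊕ : ∀ r s → γ₃ (r ⊕ s) ≡ γ₃ r xor γ₃ s
γ₃-⊕ ⟪ a , b , c , d ⟫ ⟪ a′ , b′ , c′ , d′ ⟫ =
  solve 8 (λ a b c d a′ b′ c′ d′ →
    (((a :+ a′) :+ (b :+ b′)) :+ (c :+ c′)) :+ (d :+ d′) := (((a :+ b) :+ c) :+ d) :+ (((a′ :+ b′) :+ c′) :+ d′))
    refl a b c d a′ b′ c′ d′
  where open xor-∧-Solver

blocks : ∀ {n} → Vec 𝔽₂ n → Vec 𝔽₂ n → Vec 𝔽₂ n → Vec 𝔽₂ n → Vec 𝔽₂ (4 * n)
blocks p q s t = p ++ (q ++ (s ++ (t ++ [])))

map-xor : ∀ {n} (f g : R₂ → 𝔽₂) (x : Vec R₂ n) → map f x +ⱽ map g x ≡ map (λ r → f r xor g r) x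
map-xor f g []      = refl
map-xor f g (r ∷ x) = cong (_ ∷_) (map-xor f g x)

φ-blocks : ∀ {n} (x : Vec R₂ n) → φ x ≡ blocks (map γ₀ x) (map γ₁ x) (map γ₂ x) (map γ₃ x)
φ-blocks x = cong₃ (map-xor c d x) (map-xor b d x)
  (trans (cong (_+ⱽ map d x) (trans (cong (_+ⱽ map c x) (map-xor a b x)) (map-xor (λ r → a r xor b r) c x)))
         (map-xor (λ r → (a r xor b r) xor c r) d x))
  where
  cong₃ : ∀ {q q′ s s′ t t′} → q ≡ q′ → s ≡ s′ → t ≡ t′ →
          blocks (map γ₀ x) q s t ≡ blocks (map γ₀ x) q′ s′ t′
  cong₃ refl refl refl = refl

blocks-cong : ∀ {n} {p p′ q q′ s s′ t t′ : Vec 𝔽₂ n} → p ≡ p′ → q ≡ q′ → s ≡ s′ → t ≡ t′ →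
              blocks p q s t ≡ blocks p′ q′ s′ t′
blocks-cong refl refl refl refl = refl

blocks-+ⱽ : ∀ {n} (p p′ q q′ s s′ t t′ : Vec 𝔽₂ n) →
            blocks p q s t +ⱽ blocks p′ q′ s′ t′ ≡ blocks (p +ⱽ p′) (q +ⱽ q′) (s +ⱽ s′) (t +ⱽ t′)
blocks-+ⱽ p p′ q q′ s s′ t t′ =
  trans (𝔹.++-+ⱽ p p′ (q ++ (s ++ (t ++ []))) (q′ ++ (s′ ++ (t′ ++ [])))) (cong ((p +ⱽ p′) ++_)
  (trans (𝔹.++-+ⱽ q q′ (s ++ (t ++ [])) (s′ ++ (t′ ++ []))) (cong ((q +ⱽ q′) ++_)
  (trans (𝔹.++-+ⱽ s s′ (t ++ []) (t′ ++ [])) (cong ((s +ⱽ s′) ++_) (𝔹.++-+ⱽ t t′ [] []))))))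

map-additive : ∀ {f : R₂ → 𝔽₂} → (∀ r s → f (r ⊕ s) ≡ f r xor f s) →
               ∀ {n} (x y : Vec R₂ n) → map f (x 𝓡.+ⱽ y) ≡ map f x +ⱽ map f y
map-additive f-⊕ []      []      = refl
map-additive f-⊕ (r ∷ x) (s ∷ y) = cong₂ _∷_ (f-⊕ r s) (map-additive f-⊕ x y)

φ-+ⱽ : ∀ {n} (x y : Vec R₂ n) → φ (x 𝓡.+ⱽ y) ≡ φ x +ⱽ φ y
φ-+ⱽ x y = begin
  φ (x 𝓡.+ⱽ y)                           ≡⟨ φ-blocks (x 𝓡.+ⱽ y) ⟩
  blocks (map γ₀ (x 𝓡.+ⱽ y)) (map γ₁ (x 𝓡.+ⱽ y)) (map γ₂ (x 𝓡.+ⱽ y)) (map γ₃ (x 𝓡.+ⱽ y))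
                                         ≡⟨ blocks-cong (map-additive γ₀-⊕ x y) (map-additive γ₁-⊕ x y)
                                                        (map-additive γ₂-⊕ x y) (map-additive γ₃-⊕ x y) ⟩
  blocks (map γ₀ x +ⱽ map γ₀ y) (map γ₁ x +ⱽ map γ₁ y) (map γ₂ x +ⱽ map γ₂ y) (map γ₃ x +ⱽ map γ₃ y)
                                         ≡⟨ blocks-+ⱽ (map γ₀ x) (map γ₀ y) (map γ₁ x) (map γ₁ y)
                                                      (map γ₂ x) (map γ₂ y) (map γ₃ x) (map γ₃ y) ⟨
  blocks (map γ₀ x) (map γ₁ x) (map γ₂ x) (map γ₃ x) +ⱽ blocks (map γ₀ y) (map γ₁ y) (map γ₂ y) (map γ₃ y)
                                         ≡⟨ cong₂ _+ⱽ_ (φ-blocks x) (φ-blocks y) ⟨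
  φ x +ⱽ φ y                             ∎
  where open ≡-Reasoning

φ-0ⱽ : ∀ n → φ (𝓡.0ⱽ {n}) ≡ 0ⱽ
φ-0ⱽ n = begin
  z                  ≡⟨ 𝔹.+ⱽ-cancel xor-self z z ⟨
  (z +ⱽ z) +ⱽ z      ≡⟨ cong (_+ⱽ z) (trans (sym (φ-+ⱽ (𝓡.0ⱽ {n}) (𝓡.0ⱽ {n}))) (cong (φ {n}) (𝓡.+ⱽ-identityˡ (𝓡.0ⱽ {n})))) ⟩
  z +ⱽ z             ≡⟨ 𝔹.+ⱽ-self xor-self z ⟩
  0ⱽ                 ∎
  where
  open ≡-Reasoning
  z : Vec 𝔽₂ (4 * n)
  z = φ (𝓡.0ⱽ {n})

-- The Gray map turns the inner product over R₂ into the binary one by way of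
-- the coefficient of 1 on the group basis 1, 1+u, 1+v, (1+u)(1+v) of R₂.
τ : R₂ → 𝔽₂
τ = γ₃

-- Every element of the Klein four-group is its own inverse, so only products of equal group
-- elements contribute to the coefficient of 1.
τ-⊗ : ∀ r s → τ (r ⊗ s) ≡
      (γ₀ r ∧ γ₀ s) xor ((γ₁ r ∧ γ₁ s) xor ((γ₂ r ∧ γ₂ s) xor (γ₃ r ∧ γ₃ s)))
τ-⊗ ⟪ a , b , c , d ⟫ ⟪ a′ , b′ , c′ , d′ ⟫ =
  solve 8 (λ a b c d a′ b′ c′ d′ →
    (((a :* a′) :+ (a :* b′ :+ b :* a′)) :+ (a :* c′ :+ c :* a′))
      :+ ((a :* d′ :+ b :* c′) :+ (c :* b′ :+ d :* a′))
    := d :* d′ :+ ((c :+ d) :* (c′ :+ d′) :+ ((b :+ d) :* (b′ :+ d′)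
      :+ (((a :+ b) :+ c) :+ d) :* (((a′ :+ b′) :+ c′) :+ d′))))
    refl a b c d a′ b′ c′ d′
  where open xor-∧-Solver

⟨φ,φ⟩ : ∀ {n} (x y : Vec R₂ n) → ⟨ φ x , φ y ⟩ ≡ τ 𝓡.⟨ x , y ⟩
⟨φ,φ⟩ x y = begin
  ⟨ φ x , φ y ⟩
    ≡⟨ cong₂ ⟨_,_⟩ (φ-blocks x) (φ-blocks y) ⟩
  ⟨ blocks (map γ₀ x) (map γ₁ x) (map γ₂ x) (map γ₃ x) , blocks (map γ₀ y) (map γ₁ y) (map γ₂ y) (map γ₃ y) ⟩
    ≡⟨ trans (𝔹.⟨⟩-++ (map γ₀ x) (map γ₀ y) _ _) (cong (D γ₀ x y xor_)
       (trans (𝔹.⟨⟩-++ (map γ₁ x) (map γ₁ y) _ _) (cong (D γ₁ x y xor_)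
       (trans (𝔹.⟨⟩-++ (map γ₂ x) (map γ₂ y) _ _) (cong (D γ₂ x y xor_)
       (trans (𝔹.⟨⟩-++ (map γ₃ x) (map γ₃ y) [] []) (Bool.xor-identityʳ (D γ₃ x y)))))))) ⟩
  D γ₀ x y xor (D γ₁ x y xor (D γ₂ x y xor D γ₃ x y))
    ≡⟨ coordinatewise x y ⟩
  τ 𝓡.⟨ x , y ⟩ ∎
  where
  open ≡-Reasoning
  open xor-∧-Solver
  D : (R₂ → 𝔽₂) → ∀ {n} → Vec R₂ n → Vec R₂ n → 𝔽₂
  D f x y = ⟨ map f x , map f y ⟩
  coordinatewise : ∀ {n} (x y : Vec R₂ n) → D γ₀ x y xor (D γ₁ x y xor (D γ₂ x y xor D γ₃ x y)) ≡ τ 𝓡.⟨ x , y ⟩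
  coordinatewise []      []      = refl
  coordinatewise (r ∷ x) (s ∷ y) = begin
    ((γ₀ r ∧ γ₀ s) xor D γ₀ x y) xor (((γ₁ r ∧ γ₁ s) xor D γ₁ x y) xor
      (((γ₂ r ∧ γ₂ s) xor D γ₂ x y) xor ((γ₃ r ∧ γ₃ s) xor D γ₃ x y)))
      ≡⟨ solve 8 (λ a b c d a′ b′ c′ d′ → (a :+ a′) :+ ((b :+ b′) :+ ((c :+ c′) :+ (d :+ d′)))
           := (a :+ (b :+ (c :+ d))) :+ (a′ :+ (b′ :+ (c′ :+ d′)))) refl
           (γ₀ r ∧ γ₀ s) (γ₁ r ∧ γ₁ s) (γ₂ r ∧ γ₂ s) (γ₃ r ∧ γ₃ s) (D γ₀ x y) (D γ₁ x y) (D γ₂ x y) (D γ₃ x y) ⟩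
    ((γ₀ r ∧ γ₀ s) xor ((γ₁ r ∧ γ₁ s) xor ((γ₂ r ∧ γ₂ s) xor (γ₃ r ∧ γ₃ s)))) xor
      (D γ₀ x y xor (D γ₁ x y xor (D γ₂ x y xor D γ₃ x y)))
      ≡⟨ cong₂ _xor_ (sym (τ-⊗ r s)) (coordinatewise x y) ⟩
    τ (r ⊗ s) xor τ 𝓡.⟨ x , y ⟩                           ≡⟨ γ₃-⊕ (r ⊗ s) 𝓡.⟨ x , y ⟩ ⟨
    τ ((r ⊗ s) ⊕ 𝓡.⟨ x , y ⟩)                             ∎

-- By `τ-⊗`, taking for s the four group elements reads off the four coordinates of r. This is what
-- turns binary orthogonality to a submodule into orthogonality over `R₂`.
τ-generating : ∀ r → (∀ s → τ (s ⊗ r) ≡ false) → r ≡ 0#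
τ-generating r τ≡0 = trans (sym (ungray-γ r)) (cong₄ p₀ p₁ p₂ p₃)
  where
  cong₄ : ∀ {p p′ q q′ s s′ t t′} → p ≡ p′ → q ≡ q′ → s ≡ s′ → t ≡ t′ → ungray p q s t ≡ ungray p′ q′ s′ t′
  cong₄ refl refl refl refl = refl
  at-basis : ∀ s {z} → (γ₀ s ∧ γ₀ r) xor ((γ₁ s ∧ γ₁ r) xor ((γ₂ s ∧ γ₂ r) xor (γ₃ s ∧ γ₃ r))) ≡ z → z ≡ false
  at-basis s eq = trans (sym eq) (trans (sym (τ-⊗ s r)) (τ≡0 s))
  p₀ : γ₀ r ≡ false
  p₀ = at-basis (ungray true false false false) (Bool.xor-identityʳ _)
  p₁ : γ₁ r ≡ false
  p₁ = at-basis (ungray false true false false) (Bool.xor-identityʳ _)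
  p₂ : γ₂ r ≡ false
  p₂ = at-basis (ungray false false true false) (Bool.xor-identityʳ _)
  p₃ : γ₃ r ≡ false
  p₃ = at-basis (ungray false false false true) refl

⊕-self : ∀ r → r ⊕ r ≡ 0#
⊕-self ⟪ a , b , c , d ⟫ rewrite xor-self a | xor-self b | xor-self c | xor-self d = refl

-- By `⟨φ,φ⟩` a vector with zero image has τ ⟨ x , z ⟩ = 0 for all z, including all multiples s z,
-- and the pairing over `R₂` is nondegenerate.
φ-injective : ∀ {n} (x y : Vec R₂ n) → φ x ≡ φ y → x ≡ y
φ-injective x y eq = 𝓡.+ⱽ≡0⇒≡ ⊕-self x y (𝓡.⟨⟩-nondegenerate (x 𝓡.+ⱽ y) λ z →
  τ-generating _ λ s → begin
    τ (s ⊗ 𝓡.⟨ x 𝓡.+ⱽ y , z ⟩)          ≡⟨ cong τ (𝓡.⟨⟩-•ʳ s (x 𝓡.+ⱽ y) z) ⟨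
    τ 𝓡.⟨ x 𝓡.+ⱽ y , s 𝓡.• z ⟩          ≡⟨ ⟨φ,φ⟩ (x 𝓡.+ⱽ y) (s 𝓡.• z) ⟨
    ⟨ φ (x 𝓡.+ⱽ y) , φ (s 𝓡.• z) ⟩      ≡⟨ cong ⟨_, φ (s 𝓡.• z) ⟩ φ-sum≡0 ⟩
    ⟨ 0ⱽ , φ (s 𝓡.• z) ⟩                ≡⟨ 𝔹.⟨⟩-zeroˡ (φ (s 𝓡.• z)) ⟩
    false                               ∎)
  where
  open ≡-Reasoning
  φ-sum≡0 : φ (x 𝓡.+ⱽ y) ≡ 0ⱽ
  φ-sum≡0 = trans (φ-+ⱽ x y) (trans (cong (_+ⱽ φ y) eq) (𝔹.+ⱽ-self xor-self (φ y)))

φ-surjective : ∀ {n} (z : Vec 𝔽₂ (4 * n)) → ∃[ x ] φ {n} x ≡ z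
φ-surjective {n} z with Vec.splitAt n z
... | p , z₁ , refl with Vec.splitAt n z₁
... | q , z₂ , refl with Vec.splitAt n z₂
... | s , z₃ , refl with Vec.splitAt n z₃
... | t , [] , refl = x p q s t , trans (φ-blocks (x p q s t))
  (blocks-cong (eq₀ p q s t) (eq₁ p q s t) (eq₂ p q s t) (eq₃ p q s t))
  where
  x : ∀ {n} → Vec 𝔽₂ n → Vec 𝔽₂ n → Vec 𝔽₂ n → Vec 𝔽₂ n → Vec R₂ n
  x []      []      []      []      = []
  x (p ∷ P) (q ∷ Q) (s ∷ S) (t ∷ T) = ungray p q s t ∷ x P Q S T
  eq₀ : ∀ {n} (p q s t : Vec 𝔽₂ n) → map γ₀ (x p q s t) ≡ p
  eq₀ []      []      []      []      = refl
  eq₀ (p ∷ P) (q ∷ Q) (s ∷ S) (t ∷ T) = cong (p ∷_) (eq₀ P Q S T)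
  eq₁ : ∀ {n} (p q s t : Vec 𝔽₂ n) → map γ₁ (x p q s t) ≡ q
  eq₁ []      []      []      []      = refl
  eq₁ (p ∷ P) (q ∷ Q) (s ∷ S) (t ∷ T) = cong₂ _∷_ (γ₁-ungray p q s t) (eq₁ P Q S T)
  eq₂ : ∀ {n} (p q s t : Vec 𝔽₂ n) → map γ₂ (x p q s t) ≡ s
  eq₂ []      []      []      []      = refl
  eq₂ (p ∷ P) (q ∷ Q) (s ∷ S) (t ∷ T) = cong₂ _∷_ (γ₂-ungray p q s t) (eq₂ P Q S T)
  eq₃ : ∀ {n} (p q s t : Vec 𝔽₂ n) → map γ₃ (x p q s t) ≡ t
  eq₃ []      []      []      []      = refl
  eq₃ (p ∷ P) (q ∷ Q) (s ∷ S) (t ∷ T) = cong₂ _∷_ (γ₃-ungray p q s t) (eq₃ P Q S T)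

-- Words of quaternary digits

-- Pairs of bits, two for each symbol of a word over R₂: lists of these normalise
-- much faster than vectors of bits.
data Quat : Set where
  q0 q1 q2 q3 : Quat

infixl 6 _⊞_ _⊞ⱽ_

_⊞_ : Quat → Quat → Quat
q0 ⊞ y  = y
q1 ⊞ q0 = q1
q1 ⊞ q1 = q0
q1 ⊞ q2 = q3
q1 ⊞ q3 = q2
q2 ⊞ q0 = q2
q2 ⊞ q1 = q3
q2 ⊞ q2 = q0
q2 ⊞ q3 = q1
q3 ⊞ q0 = q3
q3 ⊞ q1 = q2
q3 ⊞ q2 = q1
q3 ⊞ q3 = q0

quat : 𝔽₂ → 𝔽₂ → Quat
quat false false = q0
quat false true  = q1
quat true  false = q2
quat true  true  = q3

quat-xor : ∀ p q p′ q′ → quat (p xor p′) (q xor q′) ≡ quat p q ⊞ quat p′ q′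
quat-xor false false p′    q′    = refl
quat-xor false true  false false = refl
quat-xor false true  false true  = refl
quat-xor false true  true  false = refl
quat-xor false true  true  true  = refl
quat-xor true  false false false = refl
quat-xor true  false false true  = refl
quat-xor true  false true  false = refl
quat-xor true  false true  true  = refl
quat-xor true  true  false false = refl
quat-xor true  true  false true  = refl
quat-xor true  true  true  false = refl
quat-xor true  true  true  true  = refl

_⊞ⱽ_ : List Quat → List Quat → List Quat
(x ∷ xs) ⊞ⱽ (y ∷ ys) = (x ⊞ y) ∷ (xs ⊞ⱽ ys)
_        ⊞ⱽ _        = []

-- The same bits as in `φ`, but symbol by symbol instead of in four blocks. This permutation of the
-- coordinates keeps weights and lets a vector be processed in one pass.
word : ∀ {n} → Vec R₂ n → List Quat
word []      = []
word (r ∷ x) = quat (γ₀ r) (γ₁ r) ∷ quat (γ₂ r) (γ₃ r) ∷ word x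

word-+ⱽ : ∀ {n} (x y : Vec R₂ n) → word (x 𝓡.+ⱽ y) ≡ word x ⊞ⱽ word y
word-+ⱽ []      []      = refl
word-+ⱽ (r ∷ x) (s ∷ y) = cong₂ _∷_
  (trans (cong₂ quat (γ₀-⊕ r s) (γ₁-⊕ r s)) (quat-xor (γ₀ r) (γ₁ r) (γ₀ s) (γ₁ s)))
  (cong₂ _∷_
    (trans (cong₂ quat (γ₂-⊕ r s) (γ₃-⊕ r s)) (quat-xor (γ₂ r) (γ₃ r) (γ₂ s) (γ₃ s)))
    (word-+ⱽ x y))

digitWeight : Quat → ℕ
digitWeight q0 = 0
digitWeight q1 = 1
digitWeight q2 = 1
digitWeight q3 = 2

wordWeight : List Quat → ℕ
wordWeight []       = 0
wordWeight (q ∷ qs) = digitWeight q + wordWeight qs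

bit : 𝔽₂ → ℕ
bit b = if b then 1 else 0

weight-∷ : ∀ {n} b (x : Vec 𝔽₂ n) → weight (b ∷ x) ≡ bit b + weight x
weight-∷ false x = refl
weight-∷ true  x = refl

digitWeight-quat : ∀ p q → digitWeight (quat p q) ≡ bit p + bit q
digitWeight-quat false false = refl
digitWeight-quat false true  = refl
digitWeight-quat true  false = refl
digitWeight-quat true  true  = refl

weight-++ : ∀ {m n} (x : Vec 𝔽₂ m) (y : Vec 𝔽₂ n) → weight (x ++ y) ≡ weight x + weight y
weight-++ []          y = refl
weight-++ (false ∷ x) y = weight-++ x y
weight-++ (true ∷ x)  y = cong suc (weight-++ x y)

grayWeight : ∀ {n} → Vec R₂ n → ℕ
grayWeight x = wordWeight (word x)

private
  shuffle : ∀ p q s t P Q S T →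
            (p + P) + ((q + Q) + ((s + S) + (t + T))) ≡ (p + q) + ((s + t) + (P + (Q + (S + T))))
  shuffle = ℕ.solve-∀

weight-φ : ∀ {n} (x : Vec R₂ n) → weight (φ x) ≡ grayWeight x
weight-φ x = trans (cong weight (φ-blocks x)) (trans
  (trans (weight-++ (map γ₀ x) _) (cong (ℕ._+_ (weight (map γ₀ x)))
  (trans (weight-++ (map γ₁ x) _) (cong (ℕ._+_ (weight (map γ₁ x)))
  (trans (weight-++ (map γ₂ x) _) (cong (ℕ._+_ (weight (map γ₂ x)))
  (trans (weight-++ (map γ₃ x) []) (ℕ.+-identityʳ (weight (map γ₃ x))))))))))
  (digitwise x))
  where
  digitwise : ∀ {n} (x : Vec R₂ n) →
    weight (map γ₀ x) + (weight (map γ₁ x) + (weight (map γ₂ x) + weight (map γ₃ x))) ≡ grayWeight x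
  digitwise []      = refl
  digitwise (r ∷ x)
    rewrite weight-∷ (γ₀ r) (map γ₀ x) | weight-∷ (γ₁ r) (map γ₁ x)
          | weight-∷ (γ₂ r) (map γ₂ x) | weight-∷ (γ₃ r) (map γ₃ x)
          | digitWeight-quat (γ₀ r) (γ₁ r) | digitWeight-quat (γ₂ r) (γ₃ r)
          | sym (digitwise x)
    = shuffle (bit (γ₀ r)) (bit (γ₁ r)) (bit (γ₂ r)) (bit (γ₃ r)) _ _ _ _

grayWeight-++ : ∀ {m n} (x : Vec R₂ m) (y : Vec R₂ n) → grayWeight (x ++ y) ≡ grayWeight x + grayWeight y
grayWeight-++ []      y = refl
grayWeight-++ (r ∷ x) y = begin
  p + (q + grayWeight (x ++ y))            ≡⟨ cong (λ w → p + (q + w)) (grayWeight-++ x y) ⟩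
  p + (q + (grayWeight x + grayWeight y))  ≡⟨ assoc p q _ _ ⟩
  (p + (q + grayWeight x)) + grayWeight y  ∎
  where
  open ≡-Reasoning
  p q : ℕ
  p = digitWeight (quat (γ₀ r) (γ₁ r))
  q = digitWeight (quat (γ₂ r) (γ₃ r))
  assoc : ∀ p q x y → p + (q + (x + y)) ≡ (p + (q + x)) + y
  assoc = ℕ.solve-∀

-- Binary combinations of the multiples of the rows by the group basis

unbits : ∀ {k} → Vec 𝔽₂ (k * 4) → Vec R₂ k
unbits {zero}  []                  = []
unbits {suc k} (p ∷ q ∷ s ∷ t ∷ m) = ungray p q s t ∷ unbits m

bits : ∀ {k} → Vec R₂ k → Vec 𝔽₂ (k * 4)
bits []      = []
bits (r ∷ x) = γ₀ r ∷ γ₁ r ∷ γ₂ r ∷ γ₃ r ∷ bits x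

unbits-bits : ∀ {k} (x : Vec R₂ k) → unbits (bits x) ≡ x
unbits-bits []      = refl
unbits-bits (r ∷ x) = cong₂ _∷_ (ungray-γ r) (unbits-bits x)

bits-unbits : ∀ k (m : Vec 𝔽₂ (k * 4)) → bits (unbits {k} m) ≡ m
bits-unbits zero    []                  = refl
bits-unbits (suc k) (p ∷ q ∷ s ∷ t ∷ m) = cong (p ∷_)
  (cong₂ _∷_ (γ₁-ungray p q s t) (cong₂ _∷_ (γ₂-ungray p q s t) (cong₂ _∷_ (γ₃-ungray p q s t) (bits-unbits k m))))

unbits-0ⱽ : ∀ k → unbits {k} 0ⱽ ≡ 𝓡.0ⱽ
unbits-0ⱽ zero    = refl
unbits-0ⱽ (suc k) = cong (0# ∷_) (unbits-0ⱽ k)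

weight-bits : ∀ {k} (x : Vec R₂ k) → weight (bits x) ≡ grayWeight x
weight-bits []      = refl
weight-bits (r ∷ x)
  rewrite weight-∷ (γ₀ r) (γ₁ r ∷ γ₂ r ∷ γ₃ r ∷ bits x) | weight-∷ (γ₁ r) (γ₂ r ∷ γ₃ r ∷ bits x)
        | weight-∷ (γ₂ r) (γ₃ r ∷ bits x) | weight-∷ (γ₃ r) (bits x)
        | digitWeight-quat (γ₀ r) (γ₁ r) | digitWeight-quat (γ₂ r) (γ₃ r)
        | weight-bits x
  = assoc (bit (γ₀ r)) (bit (γ₁ r)) (bit (γ₂ r)) (bit (γ₃ r)) _
  where
  assoc : ∀ p q s t w → p + (q + (s + (t + w))) ≡ (p + q) + ((s + t) + w)
  assoc = ℕ.solve-∀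

grayWeight-unbits : ∀ k (m : Vec 𝔽₂ (k * 4)) → grayWeight (unbits {k} m) ≡ weight m
grayWeight-unbits k m = trans (sym (weight-bits (unbits {k} m))) (cong weight (bits-unbits k m))

-- The multiples by the group basis, rather than by 1, u, v, uv: then the number of binary rows
-- chosen equals the Gray weight of the coefficient vector (`grayWeight-unbits`), so a search by
-- number of rows is a search by weight of one half.
expand : ∀ {k n} → Matrix R₂ k n → Matrix R₂ (k * 4) n
expand []      = []
expand (r ∷ M) =
  ungray true false false false 𝓡.• r ∷ ungray false true false false 𝓡.• r ∷
  ungray false false true false 𝓡.• r ∷ ungray false false false true 𝓡.• r ∷ expand M

select : ∀ {k n} → Vec 𝔽₂ k → Matrix R₂ k n → Vec R₂ n
select []          []      = 𝓡.0ⱽ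
select (false ∷ m) (r ∷ M) = select m M
select (true ∷ m)  (r ∷ M) = r 𝓡.+ⱽ select m M

select-0ⱽ : ∀ {k n} (M : Matrix R₂ k n) → select 0ⱽ M ≡ 𝓡.0ⱽ
select-0ⱽ []      = refl
select-0ⱽ (r ∷ M) = select-0ⱽ M

select-∷ : ∀ {k n} b (m : Vec 𝔽₂ k) r (M : Matrix R₂ k n) →
           select (b ∷ m) (r ∷ M) ≡ ι b 𝓡.• r 𝓡.+ⱽ select m M
select-∷ false m r M = sym (trans (cong (𝓡._+ⱽ select m M) (𝓡.•-zeroˡ r)) (𝓡.+ⱽ-identityˡ (select m M)))
select-∷ true  m r M = cong (𝓡._+ⱽ select m M) (sym (𝓡.•-identity r))

select-expand : ∀ {k n} (m : Vec 𝔽₂ (k * 4)) (M : Matrix R₂ k n) → select m (expand M) ≡ unbits m 𝓡.∙ᴹ M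
select-expand []                  []      = refl
select-expand (p ∷ q ∷ s ∷ t ∷ m) (r ∷ M) = begin
  select (p ∷ q ∷ s ∷ t ∷ m) (expand (r ∷ M))
    ≡⟨ trans (select-∷ p _ _ _) (cong (ι p 𝓡.• (e₀ 𝓡.• r) 𝓡.+ⱽ_)
      (trans (select-∷ q _ _ _) (cong (ι q 𝓡.• (e₁ 𝓡.• r) 𝓡.+ⱽ_)
      (trans (select-∷ s _ _ _) (cong (ι s 𝓡.• (e₂ 𝓡.• r) 𝓡.+ⱽ_)
             (select-∷ t _ _ _)))))) ⟩
  ι p 𝓡.• (e₀ 𝓡.• r) 𝓡.+ⱽ (ι q 𝓡.• (e₁ 𝓡.• r) 𝓡.+ⱽ (ι s 𝓡.• (e₂ 𝓡.• r) 𝓡.+ⱽ (ι t 𝓡.• (e₃ 𝓡.• r) 𝓡.+ⱽ z)))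
    ≡⟨ merge (ι p) e₀ _ z (merge (ι q) e₁ _ z (merge (ι s) e₂ _ z (cong (𝓡._+ⱽ z) (sym (𝓡.•-assoc (ι t) e₃ r))))) ⟩
  (ι p ⊗ e₀ ⊕ (ι q ⊗ e₁ ⊕ (ι s ⊗ e₂ ⊕ ι t ⊗ e₃))) 𝓡.• r 𝓡.+ⱽ z
    ≡⟨ cong₂ (λ x y → x 𝓡.• r 𝓡.+ⱽ y) (combine p q s t) (select-expand m M) ⟩
  ungray p q s t 𝓡.• r 𝓡.+ⱽ unbits m 𝓡.∙ᴹ M ∎
  where
  open ≡-Reasoning
  e₀ e₁ e₂ e₃ : R₂
  e₀ = ungray true false false false
  e₁ = ungray false true false false
  e₂ = ungray false false true false
  e₃ = ungray false false false true
  z = select m (expand M)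
  merge : ∀ x e {y} w z → y ≡ w 𝓡.• r 𝓡.+ⱽ z →
          x 𝓡.• (e 𝓡.• r) 𝓡.+ⱽ y ≡ (x ⊗ e ⊕ w) 𝓡.• r 𝓡.+ⱽ z
  merge x e {y} w z eq = begin
    x 𝓡.• (e 𝓡.• r) 𝓡.+ⱽ y                    ≡⟨ cong₂ 𝓡._+ⱽ_ (sym (𝓡.•-assoc x e r)) eq ⟩
    (x ⊗ e) 𝓡.• r 𝓡.+ⱽ (w 𝓡.• r 𝓡.+ⱽ z)       ≡⟨ 𝓡.+ⱽ-assoc ((x ⊗ e) 𝓡.• r) (w 𝓡.• r) z ⟨
    ((x ⊗ e) 𝓡.• r 𝓡.+ⱽ w 𝓡.• r) 𝓡.+ⱽ z       ≡⟨ cong (𝓡._+ⱽ z) (𝓡.•-distribʳ (x ⊗ e) w r) ⟨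
    (x ⊗ e ⊕ w) 𝓡.• r 𝓡.+ⱽ z                  ∎
  combine : ∀ p q s t → ι p ⊗ e₀ ⊕ (ι q ⊗ e₁ ⊕ (ι s ⊗ e₂ ⊕ ι t ⊗ e₃)) ≡ ungray p q s t
  combine false false false false = refl
  combine false false false true  = refl
  combine false false true  false = refl
  combine false false true  true  = refl
  combine false true  false false = refl
  combine false true  false true  = refl
  combine false true  true  false = refl
  combine false true  true  true  = refl
  combine true  false false false = refl
  combine true  false false true  = refl
  combine true  false true  false = refl
  combine true  false true  true  = refl
  combine true  true  false false = refl
  combine true  true  false true  = refl
  combine true  true  true  false = refl
  combine true  true  true  true  = refl

∙ᴹ-φ : ∀ {k n} (m : Vec 𝔽₂ k) (M : Matrix R₂ k n) → m ∙ᴹ map φ M ≡ φ (select m M)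
∙ᴹ-φ {n = n} []          []      = sym (φ-0ⱽ n)
∙ᴹ-φ         (false ∷ m) (r ∷ M) = trans (false•+ⱽ (φ r) (m ∙ᴹ map φ M)) (∙ᴹ-φ m M)
∙ᴹ-φ         (true ∷ m)  (r ∷ M) = trans (true•+ⱽ (φ r) (m ∙ᴹ map φ M))
  (trans (cong (φ r +ⱽ_) (∙ᴹ-φ m M)) (sym (φ-+ⱽ r (select m M))))

-- Enumerating the light words

-- `t` is the weight still allowed and `j` the weight counted so far. Stopping when the allowance is
-- exceeded makes the many heavy words cheap.
weigh : ℕ → ℕ → List Quat → Maybe ℕ
weigh t             j []        = just j
weigh t             j (q0 ∷ qs) = weigh t j qs
weigh zero          j (q1 ∷ qs) = nothing
weigh zero          j (q2 ∷ qs) = nothing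
weigh zero          j (q3 ∷ qs) = nothing
weigh (suc t)       j (q1 ∷ qs) = weigh t (suc j) qs
weigh (suc t)       j (q2 ∷ qs) = weigh t (suc j) qs
weigh (suc zero)    j (q3 ∷ qs) = nothing
weigh (suc (suc t)) j (q3 ∷ qs) = weigh t (suc (suc j)) qs

cons? : ℕ → Maybe ℕ → List (ℕ × ℕ) → List (ℕ × ℕ)
cons? i nothing  rest = rest
cons? i (just j) rest = (i , j) ∷ rest

-- Prepends to rest the pairs (i + weight of m , weight of x + m rows) over all
-- binary m of weight at most bound for which the weights of m and of x + m rows
-- add up to at most total; i is the number of rows already added to x.
light : ∀ {k} (bound total i : ℕ) → List Quat → Vec (List Quat) k → List (ℕ × ℕ) → List (ℕ × ℕ)
light zero        total       i x rows       rest = cons? i (weigh total 0 x) rest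
light (suc bound) total       i x []         rest = cons? i (weigh total 0 x) rest
light (suc bound) zero        i x (r ∷ rows) rest = cons? i (weigh zero 0 x) rest
light (suc bound) (suc total) i x (r ∷ rows) rest =
  light bound total (suc i) (x ⊞ⱽ r) rows (light (suc bound) (suc total) i x rows rest)

weigh-≤ : ∀ t j qs → wordWeight qs ≤ t → weigh t j qs ≡ just (j + wordWeight qs)
weigh-≤ t             j []        p             = cong just (sym (ℕ.+-identityʳ j))
weigh-≤ t             j (q0 ∷ qs) p             = weigh-≤ t j qs p
weigh-≤ (suc t)       j (q1 ∷ qs) (s≤s p)       = trans (weigh-≤ t (suc j) qs p) (cong just (sym (ℕ.+-suc j _)))
weigh-≤ (suc t)       j (q2 ∷ qs) (s≤s p)       = trans (weigh-≤ t (suc j) qs p) (cong just (sym (ℕ.+-suc j _)))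
weigh-≤ (suc (suc t)) j (q3 ∷ qs) (s≤s (s≤s p)) = trans (weigh-≤ t (suc (suc j)) qs p)
  (cong just (sym (trans (ℕ.+-suc j _) (cong suc (ℕ.+-suc j _)))))

weigh-> : ∀ t j qs → t < wordWeight qs → weigh t j qs ≡ nothing
weigh-> t             j (q0 ∷ qs) p             = weigh-> t j qs p
weigh-> zero          j (q1 ∷ qs) p             = refl
weigh-> zero          j (q2 ∷ qs) p             = refl
weigh-> zero          j (q3 ∷ qs) p             = refl
weigh-> (suc t)       j (q1 ∷ qs) (s≤s p)       = weigh-> t (suc j) qs p
weigh-> (suc t)       j (q2 ∷ qs) (s≤s p)       = weigh-> t (suc j) qs p
weigh-> (suc zero)    j (q3 ∷ qs) p             = refl
weigh-> (suc (suc t)) j (q3 ∷ qs) (s≤s (s≤s p)) = weigh-> t (suc (suc j)) qs p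

rest⊆cons? : ∀ {z} i w rest → z List.∈ rest → z List.∈ cons? i w rest
rest⊆cons? i nothing  rest z∈ = z∈
rest⊆cons? i (just j) rest z∈ = there z∈

rest⊆light : ∀ {k z} bound total i x (rows : Vec (List Quat) k) rest →
             z List.∈ rest → z List.∈ light bound total i x rows rest
rest⊆light zero        total       i x rows       rest z∈ = rest⊆cons? i (weigh total 0 x) rest z∈
rest⊆light (suc bound) total       i x []         rest z∈ = rest⊆cons? i (weigh total 0 x) rest z∈
rest⊆light (suc bound) zero        i x (r ∷ rows) rest z∈ = rest⊆cons? i (weigh zero 0 x) rest z∈
rest⊆light (suc bound) (suc total) i x (r ∷ rows) rest z∈ =
  rest⊆light bound total (suc i) (x ⊞ⱽ r) rows _ (rest⊆light (suc bound) (suc total) i x rows rest z∈)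

weight≤0⇒≡0ⱽ : ∀ {n} (x : Vec 𝔽₂ n) → weight x ≤ 0 → x ≡ 0ⱽ
weight≤0⇒≡0ⱽ x p = weight≡0⇒≡0ⱽ x (ℕ.n≤0⇒n≡0 p)

+ⱽ-select-0ⱽ : ∀ {k n} (x : Vec R₂ n) (M : Matrix R₂ k n) → x 𝓡.+ⱽ select 0ⱽ M ≡ x
+ⱽ-select-0ⱽ x M = trans (cong (x 𝓡.+ⱽ_) (select-0ⱽ M)) (𝓡.+ⱽ-identityʳ x)

-- Completeness of the search without multiplicities, which is enough to exclude words of small
-- weight.
∈-light : ∀ {k n} bound total i (x : Vec R₂ n) (M : Matrix R₂ k n) rest (m : Vec 𝔽₂ k) →
          weight m ≤ bound → weight m + grayWeight (x 𝓡.+ⱽ select m M) ≤ total →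
          (i + weight m , grayWeight (x 𝓡.+ⱽ select m M)) List.∈ light bound total i (word x) (map word M) rest
∈-light {k} {n} bound total i x M rest m m≤ total≥ = go bound total M m m≤ total≥
  where
  now : ∀ {k} total (M : Matrix R₂ k n) m → m ≡ 0ⱽ → weight m + grayWeight (x 𝓡.+ⱽ select m M) ≤ total →
        (i + weight m , grayWeight (x 𝓡.+ⱽ select m M)) List.∈ cons? i (weigh total 0 (word x)) rest
  now {k} total M .0ⱽ refl p
    rewrite +ⱽ-select-0ⱽ x M | weight-0ⱽ k | ℕ.+-identityʳ i | weigh-≤ total 0 (word x) p = here refl
  go : ∀ {k} bound total (M : Matrix R₂ k n) m → weight m ≤ bound → weight m + grayWeight (x 𝓡.+ⱽ select m M) ≤ total →
       (i + weight m , grayWeight (x 𝓡.+ⱽ select m M)) List.∈ light bound total i (word x) (map word M) rest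
  go zero        total       M       m           p q = now total M m (weight≤0⇒≡0ⱽ m p) q
  go (suc bound) total       []      []          p q = now total [] [] refl q
  go (suc bound) zero        (r ∷ M) m           p q = now zero (r ∷ M) m (weight≤0⇒≡0ⱽ m (ℕ.m+n≤o⇒m≤o (weight m) q)) q
  go (suc bound) (suc total) (r ∷ M) (false ∷ m) p q =
    rest⊆light bound total (suc i) _ (map word M) _ (go (suc bound) (suc total) M m p q)
  go (suc bound) (suc total) (r ∷ M) (true ∷ m)  (s≤s p) (s≤s q)
    rewrite sym (𝓡.+ⱽ-assoc x r (select m M)) | sym (word-+ⱽ x r) | ℕ.+-suc i (weight m) =
    ∈-light bound total (suc i) (x 𝓡.+ⱽ r) M _ m p q

Vanishes : (ℕ → ℕ → ℤ) → ℕ → ℕ → Set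
Vanishes f bound total = ∀ x y → bound < x ⊎ total < x + y → f x y ≡ 0ℤ

-- Completeness with multiplicities, needed for counting: each m within the bounds is visited
-- exactly once, and by `Vanishes` the others contribute zero.
∑ˡ-light : ∀ {k n} (f : ℕ → ℕ → ℤ) bound total i (x : Vec R₂ n) (M : Matrix R₂ k n) rest →
           Vanishes f (i + bound) (i + total) →
           ∑ˡ (uncurry f) (light bound total i (word x) (map word M) rest)
           ≡ ∑ (λ m → f (i + weight m) (grayWeight (x 𝓡.+ⱽ select m M))) ℤ.+ ∑ˡ (uncurry f) rest
∑ˡ-light {n = n} f bound total i x M rest = go bound total M
  where
  open ≡-Reasoning
  collected : ∀ total → (∀ y → total < y → f i y ≡ 0ℤ) →
              ∑ˡ (uncurry f) (cons? i (weigh total 0 (word x)) rest) ≡ f i (grayWeight x) ℤ.+ ∑ˡ (uncurry f) rest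
  collected total vanish with ℕ.≤-<-connex (grayWeight x) total
  ... | inj₁ p rewrite weigh-≤ total 0 (word x) p = refl
  ... | inj₂ p rewrite weigh-> total 0 (word x) p =
    sym (trans (cong (ℤ._+ ∑ˡ (uncurry f) rest) (vanish _ p)) (ℤ.+-identityˡ _))
  -- The leaves of the search: every nonzero m exceeds one of the bounds, so the sum reduces to its
  -- term at zero.
  now : ∀ {k} bound total (M : Matrix R₂ k n) → Vanishes f (i + bound) (i + total) →
        (∀ m → m ≢ 0ⱽ → i + bound < i + weight m ⊎ i + total < i + weight m + grayWeight (x 𝓡.+ⱽ select m M)) →
        ∑ˡ (uncurry f) (cons? i (weigh total 0 (word x)) rest)
        ≡ ∑ {k} (λ m → f (i + weight m) (grayWeight (x 𝓡.+ⱽ select m M))) ℤ.+ ∑ˡ (uncurry f) rest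
  now {k} bound total M vanish heavy = trans
    (collected total (λ y p → vanish i y (inj₂ (ℕ.+-monoʳ-< i p))))
    (cong (ℤ._+ ∑ˡ (uncurry f) rest) (sym (begin
      ∑ {k} (λ m → f (i + weight m) (grayWeight (x 𝓡.+ⱽ select m M)))
        ≡⟨ ∑-single _ 0ⱽ (λ m m≢0 → vanish _ _ (heavy m m≢0)) ⟩
      f (i + weight (0ⱽ {k})) (grayWeight (x 𝓡.+ⱽ select 0ⱽ M))
        ≡⟨ cong₂ f (trans (cong (ℕ._+_ i) (weight-0ⱽ k)) (ℕ.+-identityʳ i)) (cong grayWeight (+ⱽ-select-0ⱽ x M)) ⟩
      f i (grayWeight x) ∎)))
  positive : ∀ {k} (m : Vec 𝔽₂ k) → m ≢ 0ⱽ → i + 0 < i + weight m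
  positive m m≢0 = ℕ.+-monoʳ-< i (ℕ.n≢0⇒n>0 (m≢0 ∘ weight≡0⇒≡0ⱽ m))
  go : ∀ {k} bound total (M : Matrix R₂ k n) → Vanishes f (i + bound) (i + total) →
       ∑ˡ (uncurry f) (light bound total i (word x) (map word M) rest)
       ≡ ∑ (λ m → f (i + weight m) (grayWeight (x 𝓡.+ⱽ select m M))) ℤ.+ ∑ˡ (uncurry f) rest
  go zero        total       M       vanish = now zero total M vanish (λ m m≢0 → inj₁ (positive m m≢0))
  go (suc bound) total       []      vanish = now (suc bound) total [] vanish (λ { [] []≢[] → ⊥-elim ([]≢[] refl) })
  go (suc bound) zero        (r ∷ M) vanish = now (suc bound) zero (r ∷ M) vanish
    (λ m m≢0 → inj₂ (ℕ.<-≤-trans (positive m m≢0) (ℕ.m≤m+n (i + weight m) _)))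
  go (suc bound) (suc total) (r ∷ M) vanish = begin
    ∑ˡ (uncurry f) (light bound total (suc i) (word x ⊞ⱽ word r) (map word M) others)
      ≡⟨ cong (λ w → ∑ˡ (uncurry f) (light bound total (suc i) w (map word M) others)) (word-+ⱽ x r) ⟨
    ∑ˡ (uncurry f) (light bound total (suc i) (word (x 𝓡.+ⱽ r)) (map word M) others)
      ≡⟨ ∑ˡ-light f bound total (suc i) (x 𝓡.+ⱽ r) M others
           (subst₂ (Vanishes f) (ℕ.+-suc i bound) (ℕ.+-suc i total) vanish) ⟩
    ∑ (λ m → f (suc i + weight m) (grayWeight ((x 𝓡.+ⱽ r) 𝓡.+ⱽ select m M))) ℤ.+ ∑ˡ (uncurry f) others
      ≡⟨ cong₂ ℤ._+_
           (∑-cong (λ m → cong₂ f (sym (ℕ.+-suc i (weight m))) (cong grayWeight (𝓡.+ⱽ-assoc x r (select m M)))))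
           (go (suc bound) (suc total) M vanish) ⟩
    ∑₁ ℤ.+ (∑₀ ℤ.+ ∑ˡ (uncurry f) rest)
      ≡⟨ exchange ∑₁ ∑₀ (∑ˡ (uncurry f) rest) ⟩
    (∑₀ ℤ.+ ∑₁) ℤ.+ ∑ˡ (uncurry f) rest ∎
    where
    exchange : ∀ p q r → p ℤ.+ (q ℤ.+ r) ≡ (q ℤ.+ p) ℤ.+ r
    exchange = solve-∀
    others : List (ℕ × ℕ)
    others = light (suc bound) (suc total) i (word x) (map word M) rest
    ∑₀ ∑₁ : ℤ
    ∑₀ = ∑ (λ m → f (i + weight m) (grayWeight (x 𝓡.+ⱽ select m M)))
    ∑₁ = ∑ (λ m → f (i + suc (weight m)) (grayWeight (x 𝓡.+ⱽ (r 𝓡.+ⱽ select m M))))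

-- Extremal lifts

distance≡weight : ∀ {n} (x y : Vec 𝔽₂ n) → distance x y ≡ weight (x +ⱽ y)
distance≡weight []          []          = refl
distance≡weight (false ∷ x) (false ∷ y) = distance≡weight x y
distance≡weight (false ∷ x) (true ∷ y)  = cong suc (distance≡weight x y)
distance≡weight (true ∷ x)  (false ∷ y) = cong suc (distance≡weight x y)
distance≡weight (true ∷ x)  (true ∷ y)  = distance≡weight x y

minimumDistance : ∀ {n d} {C : Code 𝔽₂ n} → 𝔹.IsLinear C → 0 < d →
                  ∃[ x ] x ∈ᶜ C × weight x ≡ d → (∀ x → x ∈ᶜ C → x ≢ 0ⱽ → d ≤ weight x) →
                  HasMinimumDistance C d
minimumDistance {n} {d} {C} linear 0<d (x , x∈C , wx≡d) lower = record
  { attained   = x , 0ⱽ , x∈C , 0-closed , x≢0 , trans (distance≡weight x 0ⱽ) (trans (cong weight (𝔹.+ⱽ-identityʳ x)) wx≡d)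
  ; lowerBound = λ y z y∈C z∈C y≢z → subst (d ≤_) (sym (distance≡weight y z))
      (lower (y +ⱽ z) (+-closed y∈C z∈C) (y≢z ∘ 𝔹.+ⱽ≡0⇒≡ xor-self y z))
  }
  where
  open 𝔹.IsLinear linear
  x≢0 : x ≢ 0ⱽ
  x≢0 refl = ℕ.<⇒≢ 0<d (trans (sym (weight-0ⱽ n)) wx≡d)

numberOfWords-resp : ∀ {n w N} {C D : Code 𝔽₂ n} → C ≐ D → NumberOfWordsOfWeight C w N → NumberOfWordsOfWeight D w N
numberOfWords-resp (C⊆D , D⊆C) (xs , unique , length≡ , char) = xs , unique , length≡ , λ x → mk⇔
  (λ x∈xs → let (x∈C , wx≡) = Equivalence.to (char x) x∈xs in C⊆D x∈C , wx≡)
  (λ (x∈D , wx≡) → Equivalence.from (char x) (D⊆C x∈D , wx≡))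

wordOfWeight : ∀ {n w N} {C : Code 𝔽₂ n} → NumberOfWordsOfWeight C w (suc N) → ∃[ x ] x ∈ᶜ C × weight x ≡ w
wordOfWeight (x ∷ xs , _ , _ , char) = x , Equivalence.to (char x) (here refl)

selfDual-resp : ∀ {n} {C D : Code 𝔽₂ n} → C ≐ D → 𝔹.IsSelfDual C → 𝔹.IsSelfDual D
selfDual-resp (C⊆D , D⊆C) selfDual = record
  { linear = record
    { 0-closed = C⊆D 0-closed
    ; +-closed = λ x∈D y∈D → C⊆D (+-closed (D⊆C x∈D) (D⊆C y∈D))
    ; •-closed = λ r x∈D → C⊆D (•-closed r (D⊆C x∈D))
    }
  ; C≐dual = (λ x∈D y y∈D → proj₁ C≐dual (D⊆C x∈D) y (D⊆C y∈D))
           , (λ x⊥ → C⊆D (proj₂ C≐dual (λ y y∈C → x⊥ y (C⊆D y∈C))))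
  }
  where
  open 𝔹.IsSelfDual selfDual
  open 𝔹.IsLinear linear

-- The Gray map carries the inner product to its image under τ. For the inclusion of the dual,
-- closure of the code under scalars gives τ (s ⟨ x , y ⟩) = 0 for every s, whence ⟨ x , y ⟩ = 0 by
-- `τ-generating`.
φ-selfDual : ∀ {n} {𝓛 : Code R₂ n} → 𝓡.IsSelfDual 𝓛 → 𝔹.IsSelfDual (image φ 𝓛)
φ-selfDual {n} {𝓛} selfDual = record { linear = φ-linear ; C≐dual = ⊆dual , dual⊆ }
  where
  open ≡-Reasoning
  open 𝓡.IsSelfDual selfDual
  open 𝓡.IsLinear linear
  φ-linear : 𝔹.IsLinear (image φ 𝓛)
  φ-linear = record
    { 0-closed = 𝓡.0ⱽ , 0-closed , φ-0ⱽ n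
    ; +-closed = λ { (x , x∈ , refl) (y , y∈ , refl) → x 𝓡.+ⱽ y , +-closed x∈ y∈ , φ-+ⱽ x y }
    ; •-closed = λ { false (x , x∈ , refl) → 𝓡.0ⱽ , 0-closed , trans (φ-0ⱽ n) (sym (𝔹.•-zeroˡ (φ x)))
                   ; true  (x , x∈ , refl) → x , x∈ , sym (𝔹.•-identity (φ x)) }
    }
  ⊆dual : ∀ {z} → z ∈ᶜ image φ 𝓛 → z ∈ᶜ 𝔹.dual (image φ 𝓛)
  ⊆dual (x , x∈ , refl) _ (y , y∈ , refl) = trans (⟨φ,φ⟩ x y) (cong τ (proj₁ C≐dual x∈ y y∈))
  dual⊆ : ∀ {z} → z ∈ᶜ 𝔹.dual (image φ 𝓛) → z ∈ᶜ image φ 𝓛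
  dual⊆ {z} z⊥ with φ-surjective {n} z
  ... | x , refl = x , proj₂ C≐dual (λ y y∈ → τ-generating 𝓡.⟨ x , y ⟩ λ s → begin
    τ (s ⊗ 𝓡.⟨ x , y ⟩)        ≡⟨ cong τ (𝓡.⟨⟩-•ʳ s x y) ⟨
    τ 𝓡.⟨ x , s 𝓡.• y ⟩        ≡⟨ ⟨φ,φ⟩ x (s 𝓡.• y) ⟨
    ⟨ φ x , φ (s 𝓡.• y) ⟩      ≡⟨ z⊥ _ (s 𝓡.• y , •-closed s y∈ , refl) ⟩
    false                      ∎) , refl

binaryGenerator : ∀ {k n} → Matrix R₂ k n → Matrix 𝔽₂ (k * 4) (4 * n)
binaryGenerator G = map φ (expand G)

∙ᴹ-binaryGenerator : ∀ {k n} (m : Vec 𝔽₂ (k * 4)) (G : Matrix R₂ k n) →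
                     m ∙ᴹ binaryGenerator G ≡ φ (unbits m 𝓡.∙ᴹ G)
∙ᴹ-binaryGenerator m G = trans (∙ᴹ-φ m (expand G)) (cong φ (select-expand m G))

φ-rowSpan : ∀ {k n} (G : Matrix R₂ k n) → image φ (𝓡.rowSpan G) ≐ rowSpan (binaryGenerator G)
φ-rowSpan G =
  (λ { (_ , (c , refl) , refl) →
       bits c , sym (trans (∙ᴹ-binaryGenerator (bits c) G) (cong (λ x → φ (x 𝓡.∙ᴹ G)) (unbits-bits c))) }) ,
  (λ { (m , refl) → unbits m 𝓡.∙ᴹ G , (unbits m , refl) , sym (∙ᴹ-binaryGenerator m G) })

binaryGenerator-independent : ∀ {k n} (G : Matrix R₂ k n) → 𝓡.LinearlyIndependentRows G →
                              𝔹.LinearlyIndependentRows (binaryGenerator G)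
binaryGenerator-independent {k} {n} G independent m eq = begin
  m                     ≡⟨ bits-unbits k m ⟨
  bits (unbits {k} m)   ≡⟨ cong bits (independent (unbits m) (φ-injective _ _
                             (trans (sym (∙ᴹ-binaryGenerator m G)) (trans eq (sym (φ-0ⱽ n)))))) ⟩
  bits (𝓡.0ⱽ {k})       ≡⟨ cong bits (unbits-0ⱽ k) ⟨
  bits (unbits {k} 0ⱽ)  ≡⟨ bits-unbits k 0ⱽ ⟩
  0ⱽ                    ∎
  where open ≡-Reasoning

lightPairs : ∀ {k n} (bound total : ℕ) → Vec R₂ n → Matrix R₂ k n → List (ℕ × ℕ)
lightPairs bound total x M = light bound total 0 (word x) (map word (expand M)) []

-- The words of weight at most 8 in the shadow are those with left weight at
-- most 4, found from the left, and those with left weight above 4, hence right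
-- weight at most 3, found from the right.
fromLeft fromRight : List ℤ → ℕ → ℕ → ℤ
fromLeft  h x y = if x ℕ.≤ᵇ 4 then at h (x + y) else 0ℤ
fromRight h y x = if x ℕ.≤ᵇ 4 then 0ℤ else at h (x + y)

-- A pair lists first the weight of the half that selects the rows, so left weights come first in
-- `left` and right weights first in `right`.
shadowSum : List ℤ → List (ℕ × ℕ) → List (ℕ × ℕ) → ℤ
shadowSum h left right = ∑ˡ (uncurry (fromLeft h)) left ℤ.+ ∑ˡ (uncurry (fromRight h)) right

-- Systematic codes in which either half of a word determines the other

module SystematicCode {k} (L Lᵀ : Matrix R₂ k k)
                      (LLᵀ≡I : map (𝓡._∙ᴹ Lᵀ) L ≡ 𝓡.I k) (LᵀL≡I : map (𝓡._∙ᴹ L) Lᵀ ≡ 𝓡.I k) where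

  open ≡-Reasoning

  G : Matrix R₂ k (k + k)
  G = 𝓡.[I∣ L ]

  Gᵇ : Matrix 𝔽₂ (k * 4) (4 * (k + k))
  Gᵇ = binaryGenerator G

  private
    right-part : Vec 𝔽₂ (k * 4) → Vec R₂ k
    right-part m = unbits {k} m 𝓡.∙ᴹ L

    codeword : ∀ m → m ∙ᴹ Gᵇ ≡ φ (unbits {k} m ++ right-part m)
    codeword m = trans (∙ᴹ-binaryGenerator {k} m G) (cong φ (𝓡.∙ᴹ-[I∣] (unbits {k} m) L))

  weight-codeword : ∀ m → weight (m ∙ᴹ Gᵇ) ≡ weight m + grayWeight (right-part m)
  weight-codeword m = begin
    weight (m ∙ᴹ Gᵇ)                                   ≡⟨ cong weight (codeword m) ⟩
    weight (φ (unbits {k} m ++ right-part m))          ≡⟨ weight-φ (unbits {k} m ++ right-part m) ⟩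
    grayWeight (unbits {k} m ++ right-part m)          ≡⟨ grayWeight-++ (unbits {k} m) (right-part m) ⟩
    grayWeight (unbits {k} m) + grayWeight (right-part m) ≡⟨ cong (λ w → w + grayWeight (right-part m)) (grayWeight-unbits k m) ⟩
    weight m + grayWeight (right-part m)               ∎

  private
    only-zero : ∀ {i j pairs} → pairs ≡ (0 , 0) ∷ [] → (i , j) List.∈ pairs → i ≡ 0 × j ≡ 0
    only-zero refl (here refl) = refl , refl

    select-L : ∀ x m → x 𝓡.+ⱽ select m (expand L) ≡ x 𝓡.+ⱽ right-part m
    select-L x m = cong (x 𝓡.+ⱽ_) (select-expand m L)

  light⇒zero : lightPairs 5 10 𝓡.0ⱽ L ≡ (0 , 0) ∷ [] →
               lightPairs 4 10 𝓡.0ⱽ Lᵀ ≡ (0 , 0) ∷ [] →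
               ∀ m → weight m + grayWeight (right-part m) ≤ 10 → m ≡ 0ⱽ
  light⇒zero lightFromLeft lightFromRight m p with ℕ.≤-<-connex (weight m) 5
  ... | inj₁ w≤5 = weight≡0⇒≡0ⱽ m (proj₁ (only-zero lightFromLeft
            (∈-light 5 10 0 0ʳ (expand L) [] m w≤5 (subst (λ w → weight m + w ≤ 10) (sym weight≡) p))))
      where
      0ʳ : Vec R₂ k
      0ʳ = 𝓡.0ⱽ
      weight≡ : grayWeight (0ʳ 𝓡.+ⱽ select m (expand L)) ≡ grayWeight (right-part m)
      weight≡ = cong grayWeight (trans (select-L 0ʳ m) (𝓡.+ⱽ-identityˡ (right-part m)))
  -- A left weight of at least 6 leaves at most 4 for the right half. The bits of the right half now
  -- select the rows of `Lᵀ`, and L Lᵀ = I recovers the left half from them.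
  ... | inj₂ w>5 = weight≡0⇒≡0ⱽ m (trans (sym weight≡) (proj₂ (only-zero lightFromRight
            (∈-light 4 10 0 0ʳ (expand Lᵀ) [] y
              (subst (_≤ 4) (sym weight-y) (ℕ.+-cancelˡ-≤ 6 _ 4 (ℕ.≤-trans (ℕ.+-monoˡ-≤ (grayWeight (right-part m)) w>5) p)))
              (subst₂ (λ v w → v + w ≤ 10) (sym weight-y) (sym weight≡) (subst (_≤ 10) (ℕ.+-comm (weight m) _) p))))))
      where
      0ʳ : Vec R₂ k
      0ʳ = 𝓡.0ⱽ
      y : Vec 𝔽₂ (k * 4)
      y = bits (right-part m)
      weight-y : weight y ≡ grayWeight (right-part m)
      weight-y = weight-bits (right-part m)
      weight≡ : grayWeight (0ʳ 𝓡.+ⱽ select y (expand Lᵀ)) ≡ weight m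
      weight≡ = begin
        grayWeight (0ʳ 𝓡.+ⱽ select y (expand Lᵀ))  ≡⟨ cong grayWeight (trans (𝓡.+ⱽ-identityˡ _) (select-expand y Lᵀ)) ⟩
        grayWeight (unbits {k} y 𝓡.∙ᴹ Lᵀ)          ≡⟨ cong (λ z → grayWeight (z 𝓡.∙ᴹ Lᵀ)) (unbits-bits (right-part m)) ⟩
        grayWeight (right-part m 𝓡.∙ᴹ Lᵀ)          ≡⟨ cong grayWeight (𝓡.inverse-∙ᴹ LLᵀ≡I (unbits {k} m)) ⟩
        grayWeight (unbits {k} m)                  ≡⟨ grayWeight-unbits k m ⟩
        weight m                                   ∎

  -- As the code is systematic, every coset has a representative with zero left half; with it, the
  -- halves of a shadow word are m and t + mL. Read from the right, the right half is y and the left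
  -- half is tLᵀ + yLᵀ, which explains the starting vector of the second search. The length bound
  -- confines `h` to weights up to 8.
  shadowEnumerator : ∀ t h → List.length h ≤ 9 →
                     ∑ (λ m → at h (weight (φ (𝓡.0ⱽ {k} ++ t) +ⱽ m ∙ᴹ Gᵇ)))
                     ≡ shadowSum h (lightPairs 4 8 t L) (lightPairs 3 8 (t 𝓡.∙ᴹ Lᵀ) Lᵀ)
  shadowEnumerator t h length≤9 = begin
    ∑ (λ m → at h (weight (φ (𝓡.0ⱽ {k} ++ t) +ⱽ m ∙ᴹ Gᵇ)))
      ≡⟨ ∑-cong (λ m → trans (cong (at h) (shadow-weight m)) (split (weight m) (grayWeight (shifted m)))) ⟩
    ∑ (λ m → fromLeft h (weight m) (grayWeight (shifted m)) ℤ.+ fromRight h (grayWeight (shifted m)) (weight m))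
      ≡⟨ ∑-+ (λ m → fromLeft h (weight m) (grayWeight (shifted m))) (λ m → fromRight h (grayWeight (shifted m)) (weight m)) ⟩
    ∑ (λ m → fromLeft h (weight m) (grayWeight (shifted m))) ℤ.+ ∑ (λ m → fromRight h (grayWeight (shifted m)) (weight m))
      ≡⟨ cong₂ ℤ._+_ leftSum rightSum ⟩
    shadowSum h (lightPairs 4 8 t L) (lightPairs 3 8 (t 𝓡.∙ᴹ Lᵀ) Lᵀ) ∎
    where
    shifted : Vec 𝔽₂ (k * 4) → Vec R₂ k
    shifted m = t 𝓡.+ⱽ right-part m
    shadow-weight : ∀ m → weight (φ (𝓡.0ⱽ {k} ++ t) +ⱽ m ∙ᴹ Gᵇ) ≡ weight m + grayWeight (shifted m)
    shadow-weight m = begin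
      weight (φ (𝓡.0ⱽ {k} ++ t) +ⱽ m ∙ᴹ Gᵇ)
        ≡⟨ cong (λ z → weight (φ (𝓡.0ⱽ {k} ++ t) +ⱽ z)) (codeword m) ⟩
      weight (φ (𝓡.0ⱽ {k} ++ t) +ⱽ φ (unbits {k} m ++ right-part m))
        ≡⟨ cong weight (φ-+ⱽ (𝓡.0ⱽ {k} ++ t) (unbits {k} m ++ right-part m)) ⟨
      weight (φ ((𝓡.0ⱽ {k} ++ t) 𝓡.+ⱽ (unbits {k} m ++ right-part m)))
        ≡⟨ cong (λ z → weight (φ z)) (trans (𝓡.++-+ⱽ 𝓡.0ⱽ (unbits {k} m) t (right-part m))
             (cong (_++ shifted m) (𝓡.+ⱽ-identityˡ (unbits {k} m)))) ⟩
      weight (φ (unbits {k} m ++ shifted m))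
        ≡⟨ weight-φ (unbits {k} m ++ shifted m) ⟩
      grayWeight (unbits {k} m ++ shifted m)
        ≡⟨ grayWeight-++ (unbits {k} m) (shifted m) ⟩
      grayWeight (unbits {k} m) + grayWeight (shifted m)
        ≡⟨ cong (λ w → w + grayWeight (shifted m)) (grayWeight-unbits k m) ⟩
      weight m + grayWeight (shifted m) ∎
    split : ∀ x y → at h (x + y) ≡ fromLeft h x y ℤ.+ fromRight h y x
    split x y with x ℕ.≤ᵇ 4
    ... | true  = sym (ℤ.+-identityʳ _)
    ... | false = sym (ℤ.+-identityˡ _)
    at-beyond : ∀ l w → List.length l ≤ w → at l w ≡ 0ℤ
    at-beyond []      w       p       = refl
    at-beyond (_ ∷ l) (suc w) (s≤s p) = at-beyond l w p
    fromLeft-vanishes : Vanishes (fromLeft h) 4 8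
    fromLeft-vanishes x y p with x ℕ.≤ᵇ 4 in x≤ᵇ4
    ... | false = refl
    ... | true with p
    ...   | inj₁ 4<x   = ⊥-elim (ℕ.<⇒≱ 4<x (ℕ.≤ᵇ⇒≤ x 4 (subst T (sym x≤ᵇ4) _)))
    ...   | inj₂ 8<x+y = at-beyond h (x + y) (ℕ.≤-trans length≤9 8<x+y)
    fromRight-vanishes : Vanishes (fromRight h) 3 8
    fromRight-vanishes y x p with x ℕ.≤ᵇ 4 in x≤ᵇ4
    ... | true  = refl
    ... | false = at-beyond h (x + y) (ℕ.≤-trans length≤9 (9≤ p))
      where
      5≤x : 5 ≤ x
      5≤x = ℕ.≰⇒> λ x≤4 → subst T x≤ᵇ4 (ℕ.≤⇒≤ᵇ x≤4)
      9≤ : 3 < y ⊎ 8 < y + x → 9 ≤ x + y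
      9≤ (inj₁ 4≤y) = ℕ.+-mono-≤ 5≤x 4≤y
      9≤ (inj₂ q)   = subst (9 ≤_) (ℕ.+-comm y x) q
    enumerated : ∀ {k n} (f : ℕ → ℕ → ℤ) bound total x (M : Matrix R₂ k n) → Vanishes f bound total →
                 ∑ (λ m → f (weight m) (grayWeight (x 𝓡.+ⱽ unbits {k} m 𝓡.∙ᴹ M))) ≡ ∑ˡ (uncurry f) (lightPairs bound total x M)
    enumerated f bound total x M vanishes = begin
      ∑ (λ m → f (weight m) (grayWeight (x 𝓡.+ⱽ unbits m 𝓡.∙ᴹ M)))
        ≡⟨ ∑-cong (λ m → cong (λ z → f (weight m) (grayWeight (x 𝓡.+ⱽ z))) (sym (select-expand m M))) ⟩
      ∑ (λ m → f (weight m) (grayWeight (x 𝓡.+ⱽ select m (expand M))))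
        ≡⟨ ℤ.+-identityʳ _ ⟨
      ∑ (λ m → f (weight m) (grayWeight (x 𝓡.+ⱽ select m (expand M)))) ℤ.+ 0ℤ
        ≡⟨ ∑ˡ-light f bound total 0 x (expand M) [] vanishes ⟨
      ∑ˡ (uncurry f) (lightPairs bound total x M) ∎
    leftSum : ∑ (λ m → fromLeft h (weight m) (grayWeight (shifted m))) ≡ ∑ˡ (uncurry (fromLeft h)) (lightPairs 4 8 t L)
    leftSum = enumerated (fromLeft h) 4 8 t L fromLeft-vanishes
    -- The change of variable y = t + mL, with inverse m = (t + y)Lᵀ.
    to from : Vec 𝔽₂ (k * 4) → Vec 𝔽₂ (k * 4)
    to m   = bits (shifted m)
    from y = bits ((t 𝓡.+ⱽ unbits {k} y) 𝓡.∙ᴹ Lᵀ)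
    t+t+ : ∀ x → t 𝓡.+ⱽ (t 𝓡.+ⱽ x) ≡ x
    t+t+ x = trans (sym (𝓡.+ⱽ-assoc t t x)) (trans (cong (𝓡._+ⱽ x) (𝓡.+ⱽ-self ⊕-self t)) (𝓡.+ⱽ-identityˡ x))
    from-to : ∀ m → from (to m) ≡ m
    from-to m = begin
      bits ((t 𝓡.+ⱽ unbits {k} (bits (shifted m))) 𝓡.∙ᴹ Lᵀ)  ≡⟨ cong (λ z → bits ((t 𝓡.+ⱽ z) 𝓡.∙ᴹ Lᵀ)) (unbits-bits (shifted m)) ⟩
      bits ((t 𝓡.+ⱽ (t 𝓡.+ⱽ right-part m)) 𝓡.∙ᴹ Lᵀ)          ≡⟨ cong (λ z → bits (z 𝓡.∙ᴹ Lᵀ)) (t+t+ (right-part m)) ⟩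
      bits (right-part m 𝓡.∙ᴹ Lᵀ)                            ≡⟨ cong bits (𝓡.inverse-∙ᴹ LLᵀ≡I (unbits {k} m)) ⟩
      bits (unbits {k} m)                                    ≡⟨ bits-unbits k m ⟩
      m                                                      ∎
    to-from : ∀ y → to (from y) ≡ y
    to-from y = begin
      bits (t 𝓡.+ⱽ unbits {k} (bits ((t 𝓡.+ⱽ unbits {k} y) 𝓡.∙ᴹ Lᵀ)) 𝓡.∙ᴹ L)
        ≡⟨ cong (λ z → bits (t 𝓡.+ⱽ z 𝓡.∙ᴹ L)) (unbits-bits ((t 𝓡.+ⱽ unbits {k} y) 𝓡.∙ᴹ Lᵀ)) ⟩
      bits (t 𝓡.+ⱽ ((t 𝓡.+ⱽ unbits {k} y) 𝓡.∙ᴹ Lᵀ) 𝓡.∙ᴹ L)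
        ≡⟨ cong (λ z → bits (t 𝓡.+ⱽ z)) (𝓡.inverse-∙ᴹ LᵀL≡I (t 𝓡.+ⱽ unbits {k} y)) ⟩
      bits (t 𝓡.+ⱽ (t 𝓡.+ⱽ unbits {k} y))   ≡⟨ cong bits (t+t+ (unbits {k} y)) ⟩
      bits (unbits {k} y)                   ≡⟨ bits-unbits k y ⟩
      y                                     ∎
    rightSum : ∑ (λ m → fromRight h (grayWeight (shifted m)) (weight m)) ≡ ∑ˡ (uncurry (fromRight h)) (lightPairs 3 8 (t 𝓡.∙ᴹ Lᵀ) Lᵀ)
    rightSum = begin
      ∑ (λ m → fromRight h (grayWeight (shifted m)) (weight m))
        ≡⟨ ∑-cong (λ m → cong (λ w → fromRight h w (weight m)) (sym (weight-bits (shifted m)))) ⟩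
      ∑ (λ m → fromRight h (weight (to m)) (weight m))
        ≡⟨ ∑-reindex to from from-to to-from (λ m → fromRight h (weight (to m)) (weight m)) ⟩
      ∑ (λ y → fromRight h (weight (to (from y))) (weight (from y)))
        ≡⟨ ∑-cong (λ y → cong₂ (fromRight h) (cong weight (to-from y))
             (trans (weight-bits ((t 𝓡.+ⱽ unbits {k} y) 𝓡.∙ᴹ Lᵀ)) (cong grayWeight (𝓡.∙ᴹ-distribʳ t (unbits {k} y) Lᵀ)))) ⟩
      ∑ (λ y → fromRight h (weight y) (grayWeight (t 𝓡.∙ᴹ Lᵀ 𝓡.+ⱽ unbits {k} y 𝓡.∙ᴹ Lᵀ)))
        ≡⟨ enumerated (fromRight h) 3 8 (t 𝓡.∙ᴹ Lᵀ) Lᵀ fromRight-vanishes ⟩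
      ∑ˡ (uncurry (fromRight h)) (lightPairs 3 8 (t 𝓡.∙ᴹ Lᵀ) Lᵀ) ∎

-- Certified lifts

_≟ᴿ_ : ∀ (r s : R₂) → Dec (r ≡ s)
⟪ a , b , c , d ⟫ ≟ᴿ ⟪ a′ , b′ , c′ , d′ ⟫ with a Bool.≟ a′ | b Bool.≟ b′ | c Bool.≟ c′ | d Bool.≟ d′
... | yes refl | yes refl | yes refl | yes refl = yes refl
... | no  a≢a′ | _        | _        | _        = no λ { refl → a≢a′ refl }
... | _        | no  b≢b′ | _        | _        = no λ { refl → b≢b′ refl }
... | _        | _        | no  c≢c′ | _        = no λ { refl → c≢c′ refl }
... | _        | _        | _        | no  d≢d′ = no λ { refl → d≢d′ refl }

orthogonalRows? : ∀ {k n} (G : Matrix R₂ k n) → Dec (All (λ g → All (λ h → 𝓡.⟨ g , h ⟩ ≡ 0#) G) G)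
orthogonalRows? G = All.all? (λ g → All.all? (λ h → 𝓡.⟨ g , h ⟩ ≟ᴿ 0#) G) G

inShadow? : ∀ {k n} (t : Vec 𝔽₂ n) (G : Matrix 𝔽₂ k n) → Dec (All (λ r → ε (weight r) ≡ χ ⟨ t , r ⟩) G)
inShadow? t = All.all? (λ r → ε (weight r) ℤ.≟ χ ⟨ t , r ⟩)

-- Refers only to the recorded lists, so checking a count repeats no search. The claimed `A` is
-- confirmed by multiplication; `countWords` then cancels M and the nonzero N.
record Determines {n k w₀ Admissible} (certificate : Certificate n k w₀ Admissible)
                  (left right : List (ℕ × ℕ)) (A : ℕ) : Set where
  constructor determined
  open Certificate certificate
  field
    arithmetic : 2^ k ℤ.* shadowSum h left right ≡ N ℤ.* + A ℤ.+ M

-- `t` is the right half of a shadow vector whose left half is zero. The results of the shadow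
-- searches are kept as the literal lists `left` and `right`, from which both A₁₂ and A₁₄ are
-- computed.
record CertifiedLift : Set where
  field
    L : Matrix R₂ 8 8
    t : Vec R₂ 8

  Lᵀ : Matrix R₂ 8 8
  Lᵀ = Vec.transpose L

  field
    lifts           : map π L ≡ A₂
    orthogonalRows  : True (orthogonalRows? 𝓡.[I∣ L ])
    LLᵀ≡I           : map (𝓡._∙ᴹ Lᵀ) L ≡ 𝓡.I 8
    LᵀL≡I           : map (𝓡._∙ᴹ L) Lᵀ ≡ 𝓡.I 8
    lightFromLeft   : lightPairs 5 10 𝓡.0ⱽ L ≡ (0 , 0) ∷ []
    lightFromRight  : lightPairs 4 10 𝓡.0ⱽ Lᵀ ≡ (0 , 0) ∷ []
    inShadow        : True (inShadow? (φ (𝓡.0ⱽ {8} ++ t)) (binaryGenerator 𝓡.[I∣ L ]))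
    left right      : List (ℕ × ℕ)
    shadowFromLeft  : lightPairs 4 8 t L ≡ left
    shadowFromRight : lightPairs 3 8 (t 𝓡.∙ᴹ Lᵀ) Lᵀ ≡ right

π-∙ᴹ : ∀ {k n} (c : Vec R₂ k) (G : Matrix R₂ k n) → π (c 𝓡.∙ᴹ G) ≡ π c ∙ᴹ map π G
π-∙ᴹ {n = n} []      []      = Vec.map-replicate a 0# n
π-∙ᴹ         (r ∷ c) (g ∷ G) =
  trans (map-additive (λ _ _ → refl) (r 𝓡.• g) (c 𝓡.∙ᴹ G)) (cong₂ _+ⱽ_ (π-• r g) (π-∙ᴹ c G))
  where
  π-• : ∀ r {n} (x : Vec R₂ n) → π (r 𝓡.• x) ≡ a r 𝔹.• π x
  π-• r []      = refl
  π-• r (s ∷ x) = cong (_ ∷_) (π-• r x)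

π-zipWith-++ : ∀ {k m n} (M : Matrix R₂ k m) (N : Matrix R₂ k n) →
               map π (zipWith _++_ M N) ≡ zipWith _++_ (map π M) (map π N)
π-zipWith-++ []      []      = refl
π-zipWith-++ (x ∷ M) (y ∷ N) = cong₂ _∷_ (Vec.map-++ a x y) (π-zipWith-++ M N)

π-rowSpan : ∀ {k n} (G : Matrix R₂ k n) → image π (𝓡.rowSpan G) ≐ rowSpan (map π G)
π-rowSpan G =
  (λ { (_ , (c , refl) , refl) → π c , π-∙ᴹ c G }) ,
  (λ { (c , refl) → map ι c 𝓡.∙ᴹ G , (map ι c , refl) ,
       trans (π-∙ᴹ (map ι c) G) (cong (_∙ᴹ map π G) (trans (sym (Vec.map-∘ a ι c)) (Vec.map-id c))) })

-- Self-dual codes over `R₂` and the parameters of their Gray images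

module SelfDualLift {k} (L Lᵀ : Matrix R₂ k k)
                    (LLᵀ≡I : map (𝓡._∙ᴹ Lᵀ) L ≡ 𝓡.I k) (LᵀL≡I : map (𝓡._∙ᴹ L) Lᵀ ≡ 𝓡.I k)
                    (orthogonalRows : All (λ g → All (λ h → 𝓡.⟨ g , h ⟩ ≡ 0#) 𝓡.[I∣ L ]) 𝓡.[I∣ L ]) where

  open SystematicCode L Lᵀ LLᵀ≡I LᵀL≡I public

  𝓛 : Code R₂ (k + k)
  𝓛 = 𝓡.rowSpan G

  C : Code 𝔽₂ (4 * (k + k))
  C = image φ 𝓛

  C-selfDual : 𝔹.IsSelfDual C
  C-selfDual = φ-selfDual (𝓡.[I∣]-selfDual ⊕-self L Lᵀ orthogonalRows LᵀL≡I)

  Gᵇ-selfDual : 𝔹.IsSelfDual (rowSpan Gᵇ)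
  Gᵇ-selfDual = selfDual-resp (φ-rowSpan G) C-selfDual

  Gᵇ-independent : 𝔹.LinearlyIndependentRows Gᵇ
  Gᵇ-independent = binaryGenerator-independent G (𝓡.[I∣]-independent L)

  open WeightEnumerator Gᵇ Gᵇ-selfDual Gᵇ-independent

  dimension : 𝔹.HasDimension C (k * 4)
  dimension = Gᵇ , φ-rowSpan G , Gᵇ-independent

  even-weight : ∀ m → odd (weight (m ∙ᴹ Gᵇ)) ≡ false
  even-weight m = selfOrthogonal⇒even (m ∙ᴹ Gᵇ) (SelfDualCode.orthogonal Gᵇ Gᵇ-selfDual Gᵇ-independent m m)

  module _ (lightFromLeft  : lightPairs 5 10 𝓡.0ⱽ L ≡ (0 , 0) ∷ [])
           (lightFromRight : lightPairs 4 10 𝓡.0ⱽ Lᵀ ≡ (0 , 0) ∷ []) where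

    nonzero⇒12≤weight : ∀ m → m ≢ 0ⱽ → 12 ≤ weight (m ∙ᴹ Gᵇ)
    -- A weight below 12 is at most 11, and parity rules out 11; what is left lies within the total
    -- 10 of the searches.
    nonzero⇒12≤weight m m≢0 = ℕ.≮⇒≥ λ w<12 →
      m≢0 (light⇒zero lightFromLeft lightFromRight m
        (subst (_≤ 10) (weight-codeword m) (ℕ.≤-pred (ℕ.≤∧≢⇒< (ℕ.≤-pred w<12) λ w≡11 →
          true≢false (trans (cong odd (sym w≡11)) (even-weight m))))))
      where
      true≢false : true ≢ false
      true≢false ()

    admissible : ∀ m → Admissible (weight (m ∙ᴹ Gᵇ))
    admissible m = even-weight m , zeroOrHeavy (m ≟ⱽ 0ⱽ)
      where
      zeroOrHeavy : Dec (m ≡ 0ⱽ) → weight (m ∙ᴹ Gᵇ) ≡ 0 ⊎ 12 ≤ weight (m ∙ᴹ Gᵇ)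
      zeroOrHeavy (yes m≡0) = inj₁ (trans (cong (λ z → weight (z ∙ᴹ Gᵇ)) m≡0)
                                          (trans (cong weight (𝔹.∙ᴹ-zeroˡ Gᵇ)) (weight-0ⱽ (4 * (k + k)))))
      zeroOrHeavy (no m≢0)  = inj₂ (nonzero⇒12≤weight m m≢0)

    countWords : ∀ {w₀} (certificate : Certificate (4 * (k + k)) (k * 4) w₀ Admissible) →
                 let open Certificate certificate in
                 List.length h ≤ 9 → .{{_ : ℤ.NonZero N}} →
                 ∀ t → All (λ r → ε (weight r) ≡ χ ⟨ φ (𝓡.0ⱽ {k} ++ t) , r ⟩) Gᵇ →
                 ∀ {left right} → lightPairs 4 8 t L ≡ left → lightPairs 3 8 (t 𝓡.∙ᴹ Lᵀ) Lᵀ ≡ right →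
                 ∀ A → Determines certificate left right A → NumberOfWordsOfWeight C w₀ A
    countWords {w₀} certificate length≤9 t inShadow refl refl A (determined arithmetic) =
      numberOfWords-resp (swap (φ-rowSpan G)) (numberOfWords w₀ A
        (ℤ.+-injective (ℤ.*-cancelˡ-≡ N _ (+ A) (∙-cancelʳ M _ _ (begin
          N ℤ.* + List.length (wordsOfWeight w₀) ℤ.+ M
            ≡⟨ certified certificate admissible (φ (𝓡.0ⱽ {k} ++ t)) inShadow ⟩
          2^ (k * 4) ℤ.* ∑ (λ m → at h (weight (φ (𝓡.0ⱽ {k} ++ t) +ⱽ m ∙ᴹ Gᵇ)))
            ≡⟨ cong (2^ (k * 4) ℤ.*_) (shadowEnumerator t h length≤9) ⟩
          2^ (k * 4) ℤ.* shadowSum h (lightPairs 4 8 t L) (lightPairs 3 8 (t 𝓡.∙ᴹ Lᵀ) Lᵀ)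
            ≡⟨ arithmetic ⟩
          N ℤ.* + A ℤ.+ M ∎)))))
      where
      open ≡-Reasoning
      open Certificate certificate
      open GroupProperties (AbelianGroup.group ℤ.+-0-abelianGroup) using (∙-cancelʳ)

    -- That the distance 12 is attained comes from the count itself: the successor makes the list of
    -- words of weight 12 nonempty.
    C-minimumDistance : ∀ {A₁₂} → NumberOfWordsOfWeight C 12 (suc A₁₂) → HasMinimumDistance C 12
    C-minimumDistance words₁₂ = minimumDistance (𝔹.IsSelfDual.linear C-selfDual) (s≤s z≤n) (wordOfWeight words₁₂) λ x x∈C x≢0 →
      let (m , x≡) = proj₁ (φ-rowSpan G) x∈C in
      subst (λ z → 12 ≤ weight z) (sym x≡) (nonzero⇒12≤weight m λ m≡0 →
        x≢0 (trans x≡ (trans (cong (_∙ᴹ Gᵇ) m≡0) (𝔹.∙ᴹ-zeroˡ Gᵇ))))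

-- A positive count at weight 14 supplies a word whose weight is not divisible by 4.
notDoublyEven : ∀ {n N} {C : Code 𝔽₂ n} → NumberOfWordsOfWeight C 14 (suc N) → ¬ DoublyEven C
notDoublyEven words₁₄ doublyEven =
  let (x , x∈C , wx≡14) = wordOfWeight words₁₄ in
  from-no (4 ∣? 14) (subst (4 ∣_) wx≡14 (doublyEven x x∈C))

module _ (lift : CertifiedLift) where

  open CertifiedLift lift
  open SelfDualLift L Lᵀ LLᵀ≡I LᵀL≡I (toWitness orthogonalRows)

  words : ∀ {w₀} (certificate : Certificate 64 32 w₀ Admissible) → let open Certificate certificate in
          List.length h ≤ 9 → .{{_ : ℤ.NonZero N}} →
          ∀ A → Determines certificate left right A → NumberOfWordsOfWeight C w₀ A
  words certificate length≤9 =
    countWords lightFromLeft lightFromRight certificate length≤9 t (toWitness inShadow) {left} {right} shadowFromLeft shadowFromRight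

  𝓛-lifts : 𝓛 IsLiftOf 𝓓
  𝓛-lifts = subst (λ M → image π 𝓛 ≐ rowSpan M)
    (trans (π-zipWith-++ (𝓡.I 8) L) (cong (zipWith _++_ (𝔹.I 8)) lifts)) (π-rowSpan G)

  liftExists : ∀ {A₁₂ A₁₄} → NumberOfWordsOfWeight C 12 (suc A₁₂) → NumberOfWordsOfWeight C 14 (suc A₁₄) →
               ∀ (W : Code 𝔽₂ 64 → Set) → W C → LiftExists W
  liftExists words₁₂ words₁₄ W WC =
      𝓛
    , 𝓡.rowSpan-linear G
    , (L , (λ x∈ → x∈) , (λ x∈ → x∈))
    , 𝓛-lifts
    , record { linear = 𝔹.IsSelfDual.linear C-selfDual ; dimension = dimension ; minimumDistance = minimumDistance₁₂ }
    , record { selfDual = C-selfDual ; minimumDistance = minimumDistance₁₂ }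
    , record { selfDual = C-selfDual ; notDoublyEven = notDoublyEven words₁₄ }
    , WC
    where
    minimumDistance₁₂ : HasMinimumDistance C 12
    minimumDistance₁₂ = C-minimumDistance lightFromLeft lightFromRight words₁₂

  module _ {A₁₂ A₁₄} (count₁₂ : Determines certificate₁₂ left right (suc A₁₂))
                     (count₁₄ : Determines certificate₁₄ left right (suc A₁₄)) where

    words₁₂ : NumberOfWordsOfWeight C 12 (suc A₁₂)
    words₁₂ = words certificate₁₂ ℕ.≤-refl (suc A₁₂) count₁₂

    words₁₄ : NumberOfWordsOfWeight C 14 (suc A₁₄)
    words₁₄ = words certificate₁₄ ℕ.≤-refl (suc A₁₄) count₁₄

    W₆₄,₁-lift : ∀ β → T (14 ≤ᵇ β) → T (β ≤ᵇ 284) → 1312 + 16 * β ≡ suc A₁₂ → 22016 ∸ 64 * β ≡ suc A₁₄ →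
                 LiftExists (λ C → HasWeightEnumeratorW₆₄,₁ C β)
    W₆₄,₁-lift β 14≤β β≤284 A₁₂≡ A₁₄≡ = liftExists words₁₂ words₁₄ (λ C → HasWeightEnumeratorW₆₄,₁ C β) record
      { 14≤β = ℕ.≤ᵇ⇒≤ 14 β 14≤β ; β≤284 = ℕ.≤ᵇ⇒≤ β 284 β≤284
      ; A₁₂ = subst (NumberOfWordsOfWeight C 12) (sym A₁₂≡) words₁₂
      ; A₁₄ = subst (NumberOfWordsOfWeight C 14) (sym A₁₄≡) words₁₄
      }

    W₆₄,₂-lift : ∀ β → T (β ≤ᵇ 277) → 1312 + 16 * β ≡ suc A₁₂ → 23040 ∸ 64 * β ≡ suc A₁₄ →
                 LiftExists (λ C → HasWeightEnumeratorW₆₄,₂ C β)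
    W₆₄,₂-lift β β≤277 A₁₂≡ A₁₄≡ = liftExists words₁₂ words₁₄ (λ C → HasWeightEnumeratorW₆₄,₂ C β) record
      { β≤277 = ℕ.≤ᵇ⇒≤ β 277 β≤277
      ; A₁₂ = subst (NumberOfWordsOfWeight C 12) (sym A₁₂≡) words₁₂
      ; A₁₄ = subst (NumberOfWordsOfWeight C 14) (sym A₁₄≡) words₁₄
      }

-- The fifteen lifts

-- A row of a matrix over R₂ as a hexadecimal number: digit j, counted from the
-- right, has the bits γ₀, γ₁, γ₂, γ₃ (least significant first) of entry j.
binary : ∀ n → ℕ → Vec 𝔽₂ n
binary zero    x = []
binary (suc n) x = (x % 2 ≡ᵇ 1) ∷ binary n (x / 2)

row : ℕ → Vec R₂ 8
row x = unbits (binary 32 x)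

matrix : Vec ℕ 8 → Matrix R₂ 8 8
matrix = map row

-- The parity of the number of set bits in a digit of `L` is the corresponding entry of `A₂`. The
-- digit F is `uv`; every `t` below has entries 0 and `uv` only, so its pairing with φ x depends
-- only on π x. The pairs of sum 8 in the two lists are different shadow words: those in `left` have
-- left weight at most 4, those in `right` at least 5. Their number is B₈, here 2, and (0 , 4) is
-- `t` itself, the one word of weight 4, so that β = 14 + 2.
lift₁,₁₆ : CertifiedLift
lift₁,₁₆ = record
  { L = matrix (0xA2B77A6B ∷ 0xC8EE8910 ∷ 0xCB17B40A ∷ 0xE8634A56 ∷
                0xEEF85C6C ∷ 0x8780F653 ∷ 0x7C412472 ∷ 0xE1F9FE47 ∷ [])
  ; t = row 0x000000F0
  ; left = (4 , 4) ∷ (4 , 4) ∷ (0 , 4) ∷ []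
  ; right = []
  ; lifts = refl
  ; orthogonalRows = _
  ; LLᵀ≡I = refl
  ; LᵀL≡I = refl
  ; lightFromLeft = refl
  ; lightFromRight = refl
  ; inShadow = _
  ; shadowFromLeft = refl
  ; shadowFromRight = refl
  }

lift₁,₂₀ : CertifiedLift
lift₁,₂₀ = record
  { L = matrix (0xA7482957 ∷ 0x97828CE6 ∷ 0x54E8E8AC ∷ 0xB4FCB3AC ∷
                0x4D61A63A ∷ 0x8D85AA33 ∷ 0x79B77E2D ∷ 0xB7C597D1 ∷ [])
  ; t = row 0xF0FFFFFF
  ; left = (4 , 4) ∷ (4 , 4) ∷ (4 , 4) ∷ (4 , 4) ∷ (2 , 6) ∷ (2 , 6) ∷ (4 , 0) ∷ []
  -- The word (4 , 0) of `left` again, with the halves interchanged. `fromRight` drops it because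
  -- its left weight is at most 4, so it is counted once.
  ; right = (0 , 4) ∷ []
  ; lifts = refl
  ; orthogonalRows = _
  ; LLᵀ≡I = refl
  ; LᵀL≡I = refl
  ; lightFromLeft = refl
  ; lightFromRight = refl
  ; inShadow = _
  ; shadowFromLeft = refl
  ; shadowFromRight = refl
  }

lift₁,₂₄ : CertifiedLift
lift₁,₂₄ = record
  { L = matrix (0xC72270F2 ∷ 0x5D8E761C ∷ 0x9DEDD19C ∷ 0xD26CB530 ∷
                0xE7CD5AAA ∷ 0x41B03C6F ∷ 0xDC714218 ∷ 0xDD0C68BE ∷ [])
  ; t = row 0x000000F0
  ; left = (3 , 5) ∷ (3 , 5) ∷ (3 , 5) ∷ (3 , 5) ∷ (2 , 6) ∷ (2 , 6) ∷ (0 , 4) ∷ []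
  ; right = (2 , 6) ∷ (2 , 6) ∷ (2 , 6) ∷ (2 , 6) ∷ []
  ; lifts = refl
  ; orthogonalRows = _
  ; LLᵀ≡I = refl
  ; LᵀL≡I = refl
  ; lightFromLeft = refl
  ; lightFromRight = refl
  ; inShadow = _
  ; shadowFromLeft = refl
  ; shadowFromRight = refl
  }

lift₁,₂₆ : CertifiedLift
lift₁,₂₆ = record
  { L = matrix (0xA1DD8C3B ∷ 0x5871DFD6 ∷ 0x0248BE90 ∷ 0xB8A01AC0 ∷
                0x7E0EA06C ∷ 0x88B9956A ∷ 0x858B4D7B ∷ 0xE19CAB71 ∷ [])
  ; t = row 0x0000000F
  ; left = (4 , 4) ∷ (4 , 4) ∷ (3 , 5) ∷ (3 , 5) ∷ (3 , 5) ∷ (3 , 5) ∷ (0 , 4) ∷ []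
  ; right = (2 , 6) ∷ (2 , 6) ∷ (3 , 5) ∷ (3 , 5) ∷ (3 , 5) ∷ (3 , 5) ∷ []
  ; lifts = refl
  ; orthogonalRows = _
  ; LLᵀ≡I = refl
  ; LᵀL≡I = refl
  ; lightFromLeft = refl
  ; lightFromRight = refl
  ; inShadow = _
  ; shadowFromLeft = refl
  ; shadowFromRight = refl
  }

lift₁,₂₈ : CertifiedLift
lift₁,₂₈ = record
  { L = matrix (0xFBD845C1 ∷ 0xF111B323 ∷ 0xF7B4E7F9 ∷ 0x8236865F ∷
                0x7497F656 ∷ 0x278F30C5 ∷ 0x2648D711 ∷ 0x826C3287 ∷ [])
  ; t = row 0x0000000F
  ; left = (4 , 4) ∷ (4 , 4) ∷ (4 , 4) ∷ (4 , 4) ∷ (2 , 6) ∷ (2 , 6) ∷ (0 , 4) ∷ []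
  ; right = (2 , 6) ∷ (2 , 6) ∷ (2 , 6) ∷ (2 , 6) ∷ (2 , 6) ∷ (2 , 6) ∷ (2 , 6) ∷ (2 , 6) ∷ []
  ; lifts = refl
  ; orthogonalRows = _
  ; LLᵀ≡I = refl
  ; LᵀL≡I = refl
  ; lightFromLeft = refl
  ; lightFromRight = refl
  ; inShadow = _
  ; shadowFromLeft = refl
  ; shadowFromRight = refl
  }

lift₁,₃₀ : CertifiedLift
lift₁,₃₀ = record
  { L = matrix (0x61DB7007 ∷ 0xA447E646 ∷ 0xCD7DD8A5 ∷ 0x8DA68A99 ∷
                0x42F2A936 ∷ 0xB7EAC6AA ∷ 0x151B2EED ∷ 0x28FF5482 ∷ [])
  ; t = row 0xF0FFFFFF
  ; left = (4 , 4) ∷ (4 , 4) ∷ (4 , 4) ∷ (4 , 4) ∷ (4 , 4) ∷ (4 , 4) ∷ (4 , 4) ∷ (4 , 4) ∷ (4 , 4) ∷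
           (4 , 4) ∷ (4 , 4) ∷ (4 , 4) ∷ (2 , 6) ∷ (4 , 4) ∷ (4 , 4) ∷ (2 , 6) ∷ (4 , 0) ∷ []
  ; right = (0 , 4) ∷ []
  ; lifts = refl
  ; orthogonalRows = _
  ; LLᵀ≡I = refl
  ; LᵀL≡I = refl
  ; lightFromLeft = refl
  ; lightFromRight = refl
  ; inShadow = _
  ; shadowFromLeft = refl
  ; shadowFromRight = refl
  }

lift₁,₃₄ : CertifiedLift
lift₁,₃₄ = record
  { L = matrix (0x941E46C7 ∷ 0xA8DB8CB5 ∷ 0x9BB11856 ∷ 0xEDFC1CA9 ∷
                0x2BA46F5F ∷ 0xE7D55C59 ∷ 0x16484771 ∷ 0x4B9C3B2D ∷ [])
  ; t = row 0x000000F0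
  ; left = (4 , 4) ∷ (4 , 4) ∷ (3 , 5) ∷ (3 , 5) ∷ (3 , 5) ∷ (3 , 5) ∷ (4 , 4) ∷ (4 , 4) ∷ (4 , 4) ∷
           (4 , 4) ∷ (2 , 6) ∷ (2 , 6) ∷ (2 , 6) ∷ (2 , 6) ∷ (0 , 4) ∷ []
  ; right = (2 , 6) ∷ (2 , 6) ∷ (2 , 6) ∷ (2 , 6) ∷ (2 , 6) ∷ (2 , 6) ∷ []
  ; lifts = refl
  ; orthogonalRows = _
  ; LLᵀ≡I = refl
  ; LᵀL≡I = refl
  ; lightFromLeft = refl
  ; lightFromRight = refl
  ; inShadow = _
  ; shadowFromLeft = refl
  ; shadowFromRight = refl
  }

lift₁,₃₈ : CertifiedLift
lift₁,₃₈ = record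
  { L = matrix (0x3DDE299D ∷ 0x9DE2E575 ∷ 0x9E728166 ∷ 0xB2FF75F9 ∷
                0x1458CFC5 ∷ 0x42B9F053 ∷ 0x29BD4E74 ∷ 0x220C5D77 ∷ [])
  ; t = row 0xF0FFFFFF
  ; left = (4 , 4) ∷ (4 , 4) ∷ (4 , 4) ∷ (4 , 4) ∷ (4 , 4) ∷ (4 , 4) ∷ (3 , 5) ∷ (3 , 5) ∷ (3 , 5) ∷
           (3 , 5) ∷ (3 , 5) ∷ (3 , 5) ∷ (3 , 5) ∷ (3 , 5) ∷ (3 , 5) ∷ (3 , 5) ∷ (3 , 5) ∷ (3 , 5) ∷
           (4 , 4) ∷ (1 , 7) ∷ (4 , 4) ∷ (1 , 7) ∷ (1 , 7) ∷ (1 , 7) ∷ (4 , 0) ∷ []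
  ; right = (0 , 4) ∷ []
  ; lifts = refl
  ; orthogonalRows = _
  ; LLᵀ≡I = refl
  ; LᵀL≡I = refl
  ; lightFromLeft = refl
  ; lightFromRight = refl
  ; inShadow = _
  ; shadowFromLeft = refl
  ; shadowFromRight = refl
  }

lift₂,₃ : CertifiedLift
lift₂,₃ = record
  { L = matrix (0x0DB72CAE ∷ 0x37448579 ∷ 0xA4B142F5 ∷ 0x11FF2603 ∷
                0x18A79C39 ∷ 0x244596C5 ∷ 0xE5E8D2E7 ∷ 0xB7AC6E72 ∷ [])
  ; t = row 0xF00FF00F
  ; left = (4 , 4) ∷ (4 , 4) ∷ []
  -- A word with zero right half and left weight 8; only the search from the right reaches it.
  ; right = (0 , 8) ∷ []
  ; lifts = refl
  ; orthogonalRows = _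
  ; LLᵀ≡I = refl
  ; LᵀL≡I = refl
  ; lightFromLeft = refl
  ; lightFromRight = refl
  ; inShadow = _
  ; shadowFromLeft = refl
  ; shadowFromRight = refl
  }

lift₂,₇ : CertifiedLift
lift₂,₇ = record
  { L = matrix (0xAB2783F4 ∷ 0x9D781F25 ∷ 0xCE84716F ∷ 0xD8557AA6 ∷
                0xE8676939 ∷ 0xB87335CC ∷ 0x80EDB888 ∷ 0x88653DBE ∷ [])
  ; t = row 0xFFFFFFFF
  ; left = (2 , 6) ∷ (2 , 6) ∷ (2 , 6) ∷ (2 , 6) ∷ (2 , 6) ∷ (2 , 6) ∷ (4 , 4) ∷ []
  ; right = []
  ; lifts = refl
  ; orthogonalRows = _
  ; LLᵀ≡I = refl
  ; LᵀL≡I = refl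
  ; lightFromLeft = refl
  ; lightFromRight = refl
  ; inShadow = _
  ; shadowFromLeft = refl
  ; shadowFromRight = refl
  }

lift₂,₁₁ : CertifiedLift
lift₂,₁₁ = record
  { L = matrix (0xA81E89C7 ∷ 0x3B178319 ∷ 0x0EED7733 ∷ 0x7DC0E9FA ∷
                0x7D68F030 ∷ 0xEE7C6350 ∷ 0x1C78BB18 ∷ 0x41C3CBED ∷ [])
  ; t = row 0x00F00FFF
  ; left = (3 , 5) ∷ (3 , 5) ∷ (3 , 5) ∷ (3 , 5) ∷ []
  ; right = (3 , 5) ∷ (3 , 5) ∷ (3 , 5) ∷ (3 , 5) ∷ (2 , 6) ∷ (2 , 6) ∷ (0 , 8) ∷ []
  ; lifts = refl
  ; orthogonalRows = _
  ; LLᵀ≡I = refl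
  ; LᵀL≡I = refl
  ; lightFromLeft = refl
  ; lightFromRight = refl
  ; inShadow = _
  ; shadowFromLeft = refl
  ; shadowFromRight = refl
  }

lift₂,₁₅ : CertifiedLift
lift₂,₁₅ = record
  { L = matrix (0xCDDD2F0E ∷ 0x0414B3DA ∷ 0x624DE735 ∷ 0xE133D9CF ∷
                0x743DF3A9 ∷ 0x8D1A6F53 ∷ 0x86D88B14 ∷ 0x729607D2 ∷ [])
  ; t = row 0x0F0FF00F
  ; left = (4 , 4) ∷ (4 , 4) ∷ (4 , 4) ∷ (4 , 4) ∷ (4 , 4) ∷ (4 , 4) ∷ (4 , 4) ∷ (4 , 4) ∷ (4 , 4) ∷ []
  ; right = (2 , 6) ∷ (2 , 6) ∷ (3 , 5) ∷ (3 , 5) ∷ (3 , 5) ∷ (3 , 5) ∷ []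
  ; lifts = refl
  ; orthogonalRows = _
  ; LLᵀ≡I = refl
  ; LᵀL≡I = refl
  ; lightFromLeft = refl
  ; lightFromRight = refl
  ; inShadow = _
  ; shadowFromLeft = refl
  ; shadowFromRight = refl
  }

lift₂,₂₆ : CertifiedLift
lift₂,₂₆ = record
  { L = matrix (0xF7DBE0F7 ∷ 0xF7BEDF70 ∷ 0xF7EDB80F ∷ 0x48C373A9 ∷
                0x2857A59C ∷ 0x187966CA ∷ 0x7F124888 ∷ 0x78653777 ∷ [])
  ; t = row 0xFF0000FF
  ; left = (2 , 6) ∷ (4 , 4) ∷ (4 , 4) ∷ (4 , 4) ∷ (4 , 4) ∷ (2 , 6) ∷ (4 , 4) ∷ (2 , 6) ∷ (2 , 6) ∷
           (4 , 4) ∷ (2 , 6) ∷ (2 , 6) ∷ (4 , 4) ∷ []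
  ; right = (3 , 5) ∷ (3 , 5) ∷ (3 , 5) ∷ (3 , 5) ∷ (3 , 5) ∷ (3 , 5) ∷ (3 , 5) ∷ (3 , 5) ∷ (3 , 5) ∷
            (3 , 5) ∷ (3 , 5) ∷ (3 , 5) ∷ (0 , 8) ∷ []
  ; lifts = refl
  ; orthogonalRows = _
  ; LLᵀ≡I = refl
  ; LᵀL≡I = refl
  ; lightFromLeft = refl
  ; lightFromRight = refl
  ; inShadow = _
  ; shadowFromLeft = refl
  ; shadowFromRight = refl
  }

lift₂,₂₇ : CertifiedLift
lift₂,₂₇ = record
  { L = matrix (0xF2EDDF9E ∷ 0xF1EBECBF ∷ 0xF4BBDDFA ∷ 0xE7694A3C ∷
                0xD7A159C6 ∷ 0xB723C5A9 ∷ 0x70888DBE ∷ 0x77A9CBED ∷ [])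
  ; t = row 0x00FFFFFF
  ; left = (4 , 4) ∷ (4 , 4) ∷ (4 , 4) ∷ (4 , 4) ∷ (4 , 4) ∷ (4 , 4) ∷ (4 , 4) ∷ (4 , 4) ∷ (4 , 4) ∷
           (4 , 4) ∷ (4 , 4) ∷ (4 , 4) ∷ (4 , 4) ∷ (4 , 4) ∷ (4 , 4) ∷ (4 , 4) ∷ (4 , 4) ∷ []
  ; right = (2 , 6) ∷ (2 , 6) ∷ (2 , 6) ∷ (2 , 6) ∷ (2 , 6) ∷ (2 , 6) ∷ (1 , 7) ∷ (1 , 7) ∷ (1 , 7) ∷
            (1 , 7) ∷ []
  ; lifts = refl
  ; orthogonalRows = _
  ; LLᵀ≡I = refl
  ; LᵀL≡I = refl
  ; lightFromLeft = refl
  ; lightFromRight = refl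
  ; inShadow = _
  ; shadowFromLeft = refl
  ; shadowFromRight = refl
  }

lift₂,₃₅ : CertifiedLift
lift₂,₃₅ = record
  { L = matrix (0x6114EC92 ∷ 0x342B4C1A ∷ 0x52D2149A ∷ 0x1DF61C93 ∷
                0x4E34FC5A ∷ 0x2B2F569A ∷ 0x7F888BED ∷ 0x87C9A777 ∷ [])
  ; t = row 0xF0000FFF
  ; left = (4 , 4) ∷ (4 , 4) ∷ (4 , 4) ∷ (3 , 5) ∷ (4 , 4) ∷ (4 , 4) ∷ (4 , 4) ∷ (3 , 5) ∷ (4 , 4) ∷
           (4 , 4) ∷ (4 , 4) ∷ (3 , 5) ∷ (4 , 4) ∷ (4 , 4) ∷ (4 , 4) ∷ (3 , 5) ∷ (4 , 4) ∷ (3 , 5) ∷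
           (4 , 4) ∷ (3 , 5) ∷ (4 , 4) ∷ (3 , 5) ∷ (4 , 4) ∷ (3 , 5) ∷ (3 , 5) ∷ (3 , 5) ∷ (3 , 5) ∷
           (3 , 5) ∷ (4 , 4) ∷ []
  ; right = (2 , 6) ∷ (2 , 6) ∷ (2 , 6) ∷ (2 , 6) ∷ (2 , 6) ∷ (2 , 6) ∷ []
  ; lifts = refl
  ; orthogonalRows = _
  ; LLᵀ≡I = refl
  ; LᵀL≡I = refl
  ; lightFromLeft = refl
  ; lightFromRight = refl
  ; inShadow = _
  ; shadowFromLeft = refl
  ; shadowFromRight = refl
  }

-- The base code

A₂-orthogonal : All (λ g → All (λ h → ⟨ g , h ⟩ ≡ false) 𝔹.[I∣ A₂ ]) 𝔹.[I∣ A₂ ]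
A₂-orthogonal = from-yes (All.all? (λ g → All.all? (λ h → ⟨ g , h ⟩ Bool.≟ false) 𝔹.[I∣ A₂ ]) 𝔹.[I∣ A₂ ])

𝓓-selfDual : 𝔹.IsSelfDual 𝓓
𝓓-selfDual = 𝔹.[I∣]-selfDual xor-self A₂ (Vec.transpose A₂) A₂-orthogonal refl

𝓓-code : Is[ 16 , 8 , 4 ]Code 𝓓
𝓓-code = record
  { linear          = 𝔹.rowSpan-linear 𝔹.[I∣ A₂ ]
  ; dimension       = 𝔹.[I∣ A₂ ] , ((λ x∈ → x∈) , (λ x∈ → x∈)) , 𝔹.[I∣]-independent A₂
  ; minimumDistance = minimumDistance (𝔹.rowSpan-linear 𝔹.[I∣ A₂ ]) (s≤s z≤n)
      (e₄ ∙ᴹ 𝔹.[I∣ A₂ ] , (e₄ , refl) , refl)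
      λ { _ (c , refl) x≢0 → lowerBound c (ListAll.lookup checked (∈-all2ⁿ c)) x≢0 }
  }
  where
  -- The fourth row of `A₂` has weight 3, so the fourth generator attains weight 4.
  e₄ : Vec 𝔽₂ 8
  e₄ = false ∷ false ∷ false ∷ true ∷ false ∷ false ∷ false ∷ false ∷ []
  check : ∀ c → Dec (c ∙ᴹ 𝔹.[I∣ A₂ ] ≡ 0ⱽ ⊎ 4 ≤ weight (c ∙ᴹ 𝔹.[I∣ A₂ ]))
  check c = (c ∙ᴹ 𝔹.[I∣ A₂ ] ≟ⱽ 0ⱽ) ⊎-dec (4 ℕ.≤? weight (c ∙ᴹ 𝔹.[I∣ A₂ ]))
  checked : ListAll.All (λ c → c ∙ᴹ 𝔹.[I∣ A₂ ] ≡ 0ⱽ ⊎ 4 ≤ weight (c ∙ᴹ 𝔹.[I∣ A₂ ])) (all2ⁿ 8)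
  checked = from-yes (ListAll.all? check (all2ⁿ 8))
  lowerBound : ∀ c → c ∙ᴹ 𝔹.[I∣ A₂ ] ≡ 0ⱽ ⊎ 4 ≤ weight (c ∙ᴹ 𝔹.[I∣ A₂ ]) →
               c ∙ᴹ 𝔹.[I∣ A₂ ] ≢ 0ⱽ → 4 ≤ weight (c ∙ᴹ 𝔹.[I∣ A₂ ])
  lowerBound c (inj₁ x≡0) x≢0 = ⊥-elim (x≢0 x≡0)
  lowerBound c (inj₂ 4≤w) x≢0 = 4≤w

mainTheorem1 : Binary.IsSelfDual 𝓓
    × Is[ 16 , 8 , 4 ]Code 𝓓
    × (∀ (β : ℕ) → β ∈ 16 ∷ 20 ∷ 24 ∷ 26 ∷ 28 ∷ 30 ∷ 34 ∷ 38 ∷ [] →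
    LiftExists (λ C → HasWeightEnumeratorW₆₄,₁ C β))
    × (∀ (β : ℕ) → β ∈ 3 ∷ 7 ∷ 11 ∷ 15 ∷ 26 ∷ 27 ∷ 35 ∷ [] →
    LiftExists (λ C → HasWeightEnumeratorW₆₄,₂ C β))
mainTheorem1 = 𝓓-selfDual , 𝓓-code , (λ β → ListAll.lookup lifts₁) , (λ β → ListAll.lookup lifts₂)
  where
  lifts₁ : ListAll.All (λ β → LiftExists (λ C → HasWeightEnumeratorW₆₄,₁ C β)) (16 ∷ 20 ∷ 24 ∷ 26 ∷ 28 ∷ 30 ∷ 34 ∷ 38 ∷ [])
  lifts₁ =
    W₆₄,₁-lift lift₁,₁₆ (determined refl) (determined refl) 16 _ _ refl refl ∷
    W₆₄,₁-lift lift₁,₂₀ (determined refl) (determined refl) 20 _ _ refl refl ∷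
    W₆₄,₁-lift lift₁,₂₄ (determined refl) (determined refl) 24 _ _ refl refl ∷
    W₆₄,₁-lift lift₁,₂₆ (determined refl) (determined refl) 26 _ _ refl refl ∷
    W₆₄,₁-lift lift₁,₂₈ (determined refl) (determined refl) 28 _ _ refl refl ∷
    W₆₄,₁-lift lift₁,₃₀ (determined refl) (determined refl) 30 _ _ refl refl ∷
    W₆₄,₁-lift lift₁,₃₄ (determined refl) (determined refl) 34 _ _ refl refl ∷
    W₆₄,₁-lift lift₁,₃₈ (determined refl) (determined refl) 38 _ _ refl refl ∷ []
  lifts₂ : ListAll.All (λ β → LiftExists (λ C → HasWeightEnumeratorW₆₄,₂ C β)) (3 ∷ 7 ∷ 11 ∷ 15 ∷ 26 ∷ 27 ∷ 35 ∷ [])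
  lifts₂ =
    W₆₄,₂-lift lift₂,₃ (determined refl) (determined refl) 3 _ refl refl ∷
    W₆₄,₂-lift lift₂,₇ (determined refl) (determined refl) 7 _ refl refl ∷
    W₆₄,₂-lift lift₂,₁₁ (determined refl) (determined refl) 11 _ refl refl ∷
    W₆₄,₂-lift lift₂,₁₅ (determined refl) (determined refl) 15 _ refl refl ∷
    W₆₄,₂-lift lift₂,₂₆ (determined refl) (determined refl) 26 _ refl refl ∷
    W₆₄,₂-lift lift₂,₂₇ (determined refl) (determined refl) 27 _ refl refl ∷
    W₆₄,₂-lift lift₂,₃₅ (determined refl) (determined refl) 35 _ refl refl ∷ []
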